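{- The family $(\mathsf{HC}_n)_{n\ge 1}$ of non-commutative Hamiltonian cycle polynomials is $\mathsf{VNP}_{\mathsf{A,\overline{C}}}$-complete under $p$-projections.
   Context: Fix a field $\mathbb{F}$ of characteristic $0$. All polynomials are elements of a free associative (non-commutative) algebra $\mathbb{F}\langle X\rangle$ over a set of variables $X$. For each $n$, with variables $x_{i,j}$ ($i,j\in[n]$), let $C_n\subseteq\mathsf{Sym}_n$ be the set of permutations consisting of a single cycle of length $n$, and define $\mathsf{HC}_n = \sum_{\sigma\in C_n} x_{1,\sigma(1)}\,x_{\sigma(1),\sigma^2(1)}\,x_{\sigma^2(1),\sigma^3(1)}\cdots x_{\sigma^{n-1}(1),1}$ (product in the indicated order). A family $(f_n)$ of non-commutative polynomials is in $\mathsf{VP}_{\mathsf{A,\overline{C}}}$ if the number of variables and the degree of $f_n$ are polynomially bounded in $n$ and $f_n$ is computed by an arithmetic circuit over $\mathbb{F}$ of size polynomial in $n$ whose multiplication gates are non-commutative (associative) with ordered inputs. $(f_n)$ is in $\mathsf{VNP}_{\mathsf{A,\overline{C}}}$ if there are a polynomially bounded $m(n)$ and $(g_n)\in\mathsf{VP}_{\mathsf{A,\overline{C}}}$ with $f_n(x)=\sum_{e\in\{0,1\}^{m(n)}} g_n(x,e)$. A family $(f_n)$ is a $p$-projection of $(g_n)$ if there is a polynomially bounded $t(n)$ such that $f_n$ is obtained from $g_{t(n)}$ by substituting each variable by a variable or a constant from $\mathbb{F}$. $\mathsf{VNP}_{\mathsf{A,\overline{C}}}$-completeness under $p$-projections means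 membership in $\mathsf{VNP}_{\mathsf{A,\overline{C}}}$ and every family in $\mathsf{VNP}_{\mathsf{A,\overline{C}}}$ is a $p$-projection of it. -}

module Defs where

open import Level using (Level; _⊔_)
open import Algebra.Bundles using (CommutativeRing)
open import Data.Nat as ℕ using (ℕ; zero; suc; _≤_; _<_; _^_; _<ᵇ_)
open import Data.Bool using (Bool; true; false; if_then_else_; _∧_; not)
open import Data.List as List using (List; []; _∷_; _++_; length; concatMap; map; foldr)
open import Data.List.Relation.Unary.All using (All)
open import Data.List.Properties using (≡-dec)
open import Data.Fin as Fin using (Fin; toℕ)
open import Data.Fin.Properties using () renaming (_≟_ to _≟ᶠ_)
open import Data.Vec as Vec using (Vec)
open import Data.Product using (Σ; ∃; ∃-syntax; _×_; _,_; proj₁; proj₂)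
open import Relation.Nullary using (¬_; does)
open import Relation.Binary.PropositionalEquality using (_≡_)

module _ {c ℓ : Level} (F : CommutativeRing c ℓ) where
  open CommutativeRing F

  IsField : Set (c ⊔ ℓ)
  IsField = (¬ (0# ≈ 1#)) × (∀ x → ¬ (x ≈ 0#) → ∃[ y ] (x * y ≈ 1#))

  _·1 : ℕ → Carrier
  zero ·1 = 0#
  suc n ·1 = 1# + (n ·1)

  CharZero : Set ℓ
  CharZero = ∀ n → ¬ ((suc n ·1) ≈ 0#)

-- Everything below is over a fixed commutative ring (intended: a field of char. 0)

module NC {c ℓ : Level} (F : CommutativeRing c ℓ) where
  open CommutativeRing F

  -- Non-commutative polynomials over variables indexed by ℕ.
  -- A word (monomial of F⟨X⟩) is a list of variable indices; a polynomial is
  -- represented by a finite list of (coefficient, word) terms, and two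
  -- representations are identified when all coefficients agree.

  Word : Set
  Word = List ℕ

  Poly : Set c
  Poly = List (Carrier × Word)

  coeff : Poly → Word → Carrier
  coeff [] w = 0#
  coeff ((a , u) ∷ p) w = if does (≡-dec ℕ._≟_ u w) then a + coeff p w else coeff p w

  _≈P_ : Poly → Poly → Set ℓ
  p ≈P q = ∀ w → coeff p w ≈ coeff q w

  0P : Poly
  0P = []

  varP : ℕ → Poly
  varP i = (1# , i ∷ []) ∷ []

  constP : Carrier → Poly
  constP a = (a , []) ∷ []

  _+P_ : Poly → Poly → Poly
  p +P q = p ++ q

  _*P_ : Poly → Poly → Poly
  p *P q = concatMap (λ { (a , u) → map (λ { (b , v) → (a * b , u ++ v) }) q }) p

  sumP : List Poly → Poly
  sumP = foldr _+P_ 0P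

  prodP : List Poly → Poly
  prodP = foldr _*P_ (constP 1#)

  DegreeAtMost : ℕ → Poly → Set ℓ
  DegreeAtMost d p = ∀ w → d < length w → coeff p w ≈ 0#

  VarsBelow : ℕ → Poly → Set ℓ
  VarsBelow v p = ∀ w → ¬ All (_< v) w → coeff p w ≈ 0#

  data Subst : Set c where
    var   : ℕ → Subst
    const : Carrier → Subst

  substWord : (ℕ → Subst) → Word → Carrier × Word
  substWord σ [] = (1# , [])
  substWord σ (i ∷ w) with σ i | substWord σ w
  ... | var j   | (a , u) = (a , j ∷ u)
  ... | const b | (a , u) = (b * a , u)

  subst : (ℕ → Subst) → Poly → Poly
  subst σ = map (λ { (a , w) → let (b , u) = substWord σ w in (a * b , u) })

  -- Arithmetic circuits with non-commutative, ordered multiplication gates.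
  -- A circuit is a straight-line program: gate number k may only refer to
  -- gates with smaller numbers (indices are taken modulo availability: a
  -- reference to a non-existing earlier gate is not allowed, enforced by Fin).

  data Gate (k : ℕ) : Set c where
    input : ℕ → Gate k
    cnst  : Carrier → Gate k
    add   : Fin k → Fin k → Gate k
    mul   : Fin k → Fin k → Gate k

  data Circuit : ℕ → Set c where
    []  : Circuit 0
    _▷_ : ∀ {k} → Circuit k → Gate k → Circuit (suc k)

  evalAll : ∀ {k} → Circuit k → Vec Poly k
  evalAll [] = Vec.[]
  evalAll (C ▷ g) = let vs = evalAll C in Vec._∷ʳ_ vs (evalGate vs g)
    where
    evalGate : ∀ {k} → Vec Poly k → Gate k → Poly
    evalGate vs (input i) = varP i
    evalGate vs (cnst a)  = constP a
    evalGate vs (add i j) = Vec.lookup vs i +P Vec.lookup vs j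
    evalGate vs (mul i j) = Vec.lookup vs i *P Vec.lookup vs j

  Computes : ∀ {s} → Circuit (suc s) → Poly → Set ℓ
  Computes C p = Vec.last (evalAll C) ≈P p

  PolyBounded : (ℕ → ℕ) → Set
  PolyBounded t = ∃[ k ] (∀ n → t n ≤ n ^ k ℕ.+ k)

  Family : Set c
  Family = ℕ → Poly

  InVP : Family → Set (c ⊔ ℓ)
  InVP f = Σ (ℕ → ℕ) λ nv → Σ (ℕ → ℕ) λ deg → Σ (ℕ → ℕ) λ size →
             PolyBounded nv × PolyBounded deg × PolyBounded size ×
             (∀ n → VarsBelow (nv n) (f n) × DegreeAtMost (deg n) (f n) ×
                    Σ ℕ λ s → s ≤ size n × Σ (Circuit (suc s)) λ C → Computes C (f n))

  allBits : ℕ → List (List Bool)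
  allBits zero = [] ∷ []
  allBits (suc m) = map (false ∷_) (allBits m) ++ map (true ∷_) (allBits m)

  bitAt : List Bool → ℕ → Carrier
  bitAt [] i = 0#
  bitAt (b ∷ e) zero = if b then 1# else 0#
  bitAt (b ∷ e) (suc i) = bitAt e i

  -- g(x, e): the first m variables x_0..x_{m-1} of g are the e-variables,
  -- the variable x_{m+j} of g plays the role of x_j.
  plugBits : ℕ → List Bool → ℕ → Subst
  plugBits m e i = if i <ᵇ m then const (bitAt e i) else var (i ℕ.∸ m)

  sumOverCube : ℕ → Poly → Poly
  sumOverCube m g = sumP (map (λ e → subst (plugBits m e) g) (allBits m))

  InVNP : Family → Set (c ⊔ ℓ)
  InVNP f = Σ (ℕ → ℕ) λ m → Σ Family λ g →
              PolyBounded m × InVP g × (∀ n → f n ≈P sumOverCube (m n) (g n))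

  PProjection : Family → Family → Set (c ⊔ ℓ)
  PProjection f g = Σ (ℕ → ℕ) λ t → PolyBounded t ×
                      (∀ n → Σ (ℕ → Subst) λ σ → f n ≈P subst σ (g (t n)))

  VNPComplete : Family → Set (c ⊔ ℓ)
  VNPComplete h = InVNP h × (∀ f → InVNP f → PProjection f h)

  -- Hamiltonian cycle polynomials.
  -- Vertices [n] are represented by Fin n (vertex 1 ↦ Fin.zero); the variable
  -- x_{i,j} is x_{toℕ i * n + toℕ j}.

  xIdx : ∀ {n} → Fin n → Fin n → ℕ
  xIdx {n} i j = toℕ i ℕ.* n ℕ.+ toℕ j

  allMaps : (n m : ℕ) → List (Fin n → Fin m)
  allMaps zero m = (λ ()) ∷ []
  allMaps (suc n) m =
    concatMap (λ f → map (λ a → λ { Fin.zero → a ; (Fin.suc i) → f i }) (List.allFin m))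
              (allMaps n m)

  iter : ∀ {n} → (Fin n → Fin n) → ℕ → Fin n → Fin n
  iter σ zero a = a
  iter σ (suc k) a = σ (iter σ k a)

  orbit : ∀ {n} → (Fin (suc n) → Fin (suc n)) → List (Fin (suc n))
  orbit {n} σ = map (λ k → iter σ k Fin.zero) (List.upTo (suc n))

  eqᶠ : ∀ {n} → Fin n → Fin n → Bool
  eqᶠ a b = does (a ≟ᶠ b)

  anyEq : ∀ {n} → Fin n → List (Fin n) → Bool
  anyEq a [] = false
  anyEq a (b ∷ bs) = if eqᶠ a b then true else anyEq a bs

  distinct : ∀ {n} → List (Fin n) → Bool
  distinct [] = true
  distinct (a ∷ as) = not (anyEq a as) ∧ distinct as

  -- σ : [n] → [n] is a permutation consisting of a single cycle of length n
  -- iff 1, σ(1), ..., σ^{n-1}(1) are pairwise distinct and σ^n(1) = 1.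
  isNCycle : ∀ {n} → (Fin (suc n) → Fin (suc n)) → Bool
  isNCycle {n} σ = distinct (orbit σ) ∧ eqᶠ (iter σ (suc n) Fin.zero) Fin.zero

  cycleMonomial : ∀ {n} → (Fin (suc n) → Fin (suc n)) → Poly
  cycleMonomial {n} σ =
    prodP (map (λ k → varP (xIdx (iter σ k Fin.zero) (iter σ (suc k) Fin.zero)))
               (List.upTo (suc n)))

  -- HC_n (HC_0 := 0; the family of interest is n ≥ 1)
  HC : Family
  HC zero = 0P
  HC (suc n) = sumP (map cycleMonomial (List.filterᵇ isNCycle (allMaps (suc n) (suc n))))

-- HC is in VNP by inclusion–exclusion over the sets e of allowed vertices:
--   HC_n = Σ_e (Π_v (2 e_v − 1)) · e_1 · Σ x_{1,v₁} e_{v₁} x_{v₁,v₂} e_{v₂} ⋯ x_{v_{n−1},1},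
-- since a walk with n − 1 intermediate stops survives the signed sum over e only if it visits every vertex, and the
-- inner sum, being an iterated matrix product, has small circuits.
--
-- For the hardness, split each gate of a circuit into homogeneous components. Up to scalars, those of positive degree
-- are generated by a weighted grammar in Chomsky normal form, whose rules are the multiplication gates. Its derivation
-- trees for a word at the positions p, …, q − 1 are walked depth first, which meets the letters in the order of the
-- product. The only memory such a walk needs is which rule was split at the position k, and each k is split once
-- and resumed once; hence it suffices to let a walk without repeated vertices run through a graph with a
-- node W_κ and a node R_κ for each rule κ placed at an interval with a split point, and to demand that both or
-- none of W_κ and R_κ be visited. Such local constraints, as well as the sum over the bits, are enforced in a
-- Hamiltonian cycle by replacing each node by a path of three vertices with edges in both directions: the cycle
-- traverses it forwards if the walk uses the node, and backwards in a final clean-up phase if it does not.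
module Submission where

open import Defs
open import Algebra.Bundles using (Semiring; CommutativeRing)
open import Level using (Level)
open import Data.Bool using (Bool; true; false; if_then_else_; _∧_; _∨_; not; T; _xor_)
open import Data.List using (List; []; _∷_; _++_; map; concatMap; filterᵇ; cartesianProduct; allFin; length; deduplicate; applyUpTo; lookup)
open import Data.List.Membership.Propositional using (_∈_)
open import Data.List.Relation.Unary.Any as Any using (here; there)
open import Data.List.Relation.Unary.All as All using (All; []; _∷_)
open import Data.List.Relation.Unary.AllPairs as AllPairs using ([]; _∷_)
open import Data.List.Relation.Unary.Unique.Propositional using (Unique)
open import Data.Product using (_×_; _,_; proj₁; proj₂; Σ; ∃; ∃-syntax)
open import Function using (_∘_; _∋_)
open import Relation.Nullary using (¬_; does; yes; no; Dec)
open import Data.Empty using (⊥-elim)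
open import Relation.Binary.PropositionalEquality as ≡ using (_≡_; _≢_; _≗_)
open import Data.List.Membership.Propositional.Properties using (∈-allFin; ∈-map⁺; ∈-++⁺ˡ; ∈-++⁺ʳ; ∈-deduplicate⁺; ∈-map⁻; ∈-cartesianProduct⁺; ∈-++⁻; ∈-lookup)
open import Data.Nat as ℕ using (ℕ; _≡ᵇ_; _<_; zero; suc; _≤_; z≤n; s≤s; _<ᵇ_; _≤ᵇ_)
open import Data.Fin as Fin using (Fin; toℕ; zero; suc)
import Data.Fin.Properties as Finₚ
open import Relation.Nullary.Decidable using (dec-true; dec-false; map′)
import Data.Bool.Properties as 𝔹ₚ
import Data.Nat.Properties as ℕₚ
import Data.List.Properties as Listₚ
open import Relation.Binary.Definitions using (DecidableEquality; tri<; tri≈; tri>)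
open import Data.Sum using (inj₁; inj₂; _⊎_)
open import Data.List.Relation.Unary.Unique.DecPropositional.Properties using (deduplicate-!)
open import Algebra.Structures using (IsSemiring)
import Data.List.Relation.Unary.Unique.Propositional.Properties as Uniqueₚ
open import Data.Product.Properties using () renaming (≡-dec to ×-≡-dec)
open import Data.List.Relation.Unary.Any.Properties using (lookup-index)
open import Data.Sum.Properties using (inj₁-injective; inj₂-injective) renaming (≡-dec to ⊎-≡-dec)
import Data.Nat.Solver
open import Data.Vec as Vec using (Vec)
import Data.Vec.Properties as Vecₚ
import Data.List.Relation.Unary.All.Properties as Allₚ

-- The graph of `HC`, the gadget graph and the program graph are all described by one recursive sum
-- `walk`, which carries the set of vertices still alive. Passing from one level to the next is thus
-- an induction on the number of steps, and no bijection between cycles, paths and derivation trees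
-- is ever written down. Non-commutativity dictates the shape of the program: a letter must be
-- emitted exactly when its factor is due in the product, so a derivation has to be walked in the
-- order of its word. Whatever cannot be checked on the way is postponed to the clean-up, all of
-- whose labels are 0 or 1 and hence leave the product alone. A graph of polynomial size cannot hold
-- a stack in its current vertex; the set of visited vertices holds it instead. A bit variable
-- occupies a position of the word, although it is replaced by a scalar in the end. Homogeneous
-- components are taken before the bits are substituted, since the substitution changes degrees;
-- this way a single grammar serves all assignments of the bits.

-- Finite sums and guarded terms in a semiring

module Sums {c ℓ : Level} (R : Semiring c ℓ) where
  open Semiring R
  open import Relation.Binary.Reasoning.Setoid setoid

  private variable
    a b : Level
    A : Set a
    B : Set b

  ∑ : List A → (A → Carrier) → Carrier
  ∑ [] f = 0#
  ∑ (x ∷ xs) f = f x + ∑ xs f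

  when : Bool → Carrier → Carrier
  when b x = if b then x else 0#

  when-cong : ∀ b {x y} → (b ≡ true → x ≈ y) → when b x ≈ when b y
  when-cong true e = e ≡.refl
  when-cong false e = refl

  when-≡ : ∀ {b b'} {x y} → b ≡ b' → x ≈ y → when b x ≈ when b' y
  when-≡ {b} ≡.refl e = when-cong b (λ _ → e)

  when-0 : ∀ b {x} → x ≈ 0# → when b x ≈ 0#
  when-0 true e = e
  when-0 false e = refl

  when-true : ∀ {b x} → b ≡ true → when b x ≈ x
  when-true ≡.refl = refl

  when-false : ∀ {b x} → b ≡ false → when b x ≈ 0#
  when-false ≡.refl = refl

  when-*ʳ : ∀ b x y → when b x * y ≈ when b (x * y)
  when-*ʳ true x y = refl
  when-*ʳ false x y = zeroˡ y

  when-*ˡ : ∀ b x y → x * when b y ≈ when b (x * y)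
  when-*ˡ true x y = refl
  when-*ˡ false x y = zeroʳ x

  when-∧ : ∀ a b x → when (a ∧ b) x ≡ when a (when b x)
  when-∧ true b x = ≡.refl
  when-∧ false b x = ≡.refl

  +-zeroˡ : ∀ {x y} → x ≈ 0# → x + y ≈ y
  +-zeroˡ {x} {y} e = trans (+-congʳ e) (+-identityˡ y)

  +-zeroʳ : ∀ {x y} → y ≈ 0# → x + y ≈ x
  +-zeroʳ {x} {y} e = trans (+-congˡ e) (+-identityʳ x)

  *-zeroˡ : ∀ {x y} → x ≈ 0# → x * y ≈ 0#
  *-zeroˡ {x} {y} e = trans (*-congʳ e) (zeroˡ y)

  *-zeroʳ : ∀ {x y} → y ≈ 0# → x * y ≈ 0#
  *-zeroʳ {x} {y} e = trans (*-congˡ e) (zeroʳ x)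

  ∑-cong-∈ : ∀ (xs : List A) {f g : A → Carrier} → (∀ {x} → x ∈ xs → f x ≈ g x) → ∑ xs f ≈ ∑ xs g
  ∑-cong-∈ [] e = refl
  ∑-cong-∈ (x ∷ xs) e = +-cong (e (here ≡.refl)) (∑-cong-∈ xs (e ∘ there))

  ∑-cong : ∀ (xs : List A) {f g : A → Carrier} → (∀ x → f x ≈ g x) → ∑ xs f ≈ ∑ xs g
  ∑-cong xs e = ∑-cong-∈ xs (λ {x} _ → e x)

  ∑-0-∈ : ∀ (xs : List A) {f : A → Carrier} → (∀ {x} → x ∈ xs → f x ≈ 0#) → ∑ xs f ≈ 0#
  ∑-0-∈ [] e = refl
  ∑-0-∈ (x ∷ xs) e = trans (+-cong (e (here ≡.refl)) (∑-0-∈ xs (e ∘ there))) (+-identityˡ 0#)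

  ∑-0 : ∀ (xs : List A) {f : A → Carrier} → (∀ x → f x ≈ 0#) → ∑ xs f ≈ 0#
  ∑-0 xs e = ∑-0-∈ xs (λ {x} _ → e x)

  +-interchange : ∀ w x y z → (w + x) + (y + z) ≈ (w + y) + (x + z)
  +-interchange w x y z = begin
    (w + x) + (y + z) ≈⟨ +-assoc w x (y + z) ⟩
    w + (x + (y + z)) ≈⟨ +-congˡ (trans (sym (+-assoc x y z)) (trans (+-congʳ (+-comm x y)) (+-assoc y x z))) ⟩
    w + (y + (x + z)) ≈⟨ +-assoc w y (x + z) ⟨
    (w + y) + (x + z) ∎

  ∑-+ : ∀ (xs : List A) (f g : A → Carrier) → ∑ xs (λ x → f x + g x) ≈ ∑ xs f + ∑ xs g
  ∑-+ [] f g = sym (+-identityˡ 0#)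
  ∑-+ (x ∷ xs) f g = trans (+-congˡ (∑-+ xs f g)) (+-interchange (f x) (g x) (∑ xs f) (∑ xs g))

  ∑-++ : ∀ (xs ys : List A) (f : A → Carrier) → ∑ (xs ++ ys) f ≈ ∑ xs f + ∑ ys f
  ∑-++ [] ys f = sym (+-identityˡ _)
  ∑-++ (x ∷ xs) ys f = trans (+-congˡ (∑-++ xs ys f)) (sym (+-assoc _ _ _))

  ∑-map : ∀ (h : A → B) (xs : List A) (f : B → Carrier) → ∑ (map h xs) f ≡ ∑ xs (f ∘ h)
  ∑-map h [] f = ≡.refl
  ∑-map h (x ∷ xs) f = ≡.cong (f (h x) +_) (∑-map h xs f)

  ∑-concatMap : ∀ (h : A → List B) (xs : List A) (f : B → Carrier) →
    ∑ (concatMap h xs) f ≈ ∑ xs (λ x → ∑ (h x) f)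
  ∑-concatMap h [] f = refl
  ∑-concatMap h (x ∷ xs) f = trans (∑-++ (h x) (concatMap h xs) f) (+-congˡ (∑-concatMap h xs f))

  ∑-*ˡ : ∀ (y : Carrier) (xs : List A) (f : A → Carrier) → y * ∑ xs f ≈ ∑ xs (λ x → y * f x)
  ∑-*ˡ y [] f = zeroʳ y
  ∑-*ˡ y (x ∷ xs) f = trans (distribˡ y (f x) (∑ xs f)) (+-congˡ (∑-*ˡ y xs f))

  ∑-*ʳ : ∀ (y : Carrier) (xs : List A) (f : A → Carrier) → ∑ xs f * y ≈ ∑ xs (λ x → f x * y)
  ∑-*ʳ y [] f = zeroˡ y
  ∑-*ʳ y (x ∷ xs) f = trans (distribʳ y (f x) (∑ xs f)) (+-congˡ (∑-*ʳ y xs f))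

  ∑-swap : ∀ (xs : List A) (ys : List B) (f : A → B → Carrier) →
    ∑ xs (λ x → ∑ ys (f x)) ≈ ∑ ys (λ y → ∑ xs (λ x → f x y))
  ∑-swap [] ys f = sym (∑-0 ys (λ _ → refl))
  ∑-swap (x ∷ xs) ys f = trans (+-congˡ (∑-swap xs ys f)) (sym (∑-+ ys (f x) (λ y → ∑ xs (λ x → f x y))))

  ∑-when : ∀ b (xs : List A) (f : A → Carrier) → when b (∑ xs f) ≈ ∑ xs (λ x → when b (f x))
  ∑-when true xs f = refl
  ∑-when false xs f = sym (∑-0 xs (λ _ → refl))

  ∑-filter : ∀ (p : A → Bool) (xs : List A) (f : A → Carrier) →
    ∑ (filterᵇ p xs) f ≈ ∑ xs (λ x → when (p x) (f x))
  ∑-filter p [] f = refl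
  ∑-filter p (x ∷ xs) f with p x
  ... | true = +-congˡ (∑-filter p xs f)
  ... | false = trans (∑-filter p xs f) (sym (+-identityˡ _))

  ∑-single : ∀ {xs : List A} {v} (f : A → Carrier) → Unique xs → v ∈ xs →
    (∀ {x} → x ≢ v → f x ≈ 0#) → ∑ xs f ≈ f v
  ∑-single {xs = x ∷ xs} f (px ∷ _) (here ≡.refl) z =
    +-zeroʳ (∑-0-∈ xs (λ {y} y∈ → z (λ { ≡.refl → All.lookup px y∈ ≡.refl })))
  ∑-single {xs = x ∷ xs} f (px ∷ u) (there v∈) z =
    trans (+-zeroˡ (z (All.lookup px v∈))) (∑-single f u v∈ z)

  ∑-cartesianProduct : ∀ (xs : List A) (ys : List B) (f : A × B → Carrier) →
    ∑ (cartesianProduct xs ys) f ≈ ∑ xs (λ x → ∑ ys (λ y → f (x , y)))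
  ∑-cartesianProduct [] ys f = refl
  ∑-cartesianProduct (x ∷ xs) ys f = trans (∑-++ (map (x ,_) ys) (cartesianProduct xs ys) f)
    (+-cong (reflexive (∑-map (x ,_) ys f)) (∑-cartesianProduct xs ys f))

  ∑-toℕ : ∀ n p (p<n : p < n) (f : Fin n → Carrier) → ∑ (allFin n) (λ i → when (toℕ i ≡ᵇ p) (f i)) ≈ f (Fin.fromℕ< p<n)
  ∑-toℕ n p p<n f = trans
    (∑-single _ (Uniqueₚ.allFin⁺ n) (∈-allFin i) (λ {j} j≢ → when-false (dec-false (toℕ j ℕ.≟ p) (λ e → j≢ (Finₚ.toℕ-injective (≡.trans e (≡.sym i≡)))))))
    (when-true (dec-true (toℕ i ℕ.≟ p) i≡))
    where
    i = Fin.fromℕ< p<n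
    i≡ : toℕ i ≡ p
    i≡ = Finₚ.toℕ-fromℕ< p<n

-- Walks without repeated vertices

module Walks where
  open import Data.List using (_∷ʳ_)
  false≢true : false ≢ true
  false≢true ()

  ∧-true : ∀ {a b} → a ∧ b ≡ true → a ≡ true × b ≡ true
  ∧-true {true} {true} e = ≡.refl , ≡.refl
  ∧-true {true} {false} ()
  ∧-true {false} ()

  bool-≡ : ∀ {a b} → (a ≡ true → b ≡ true) → (b ≡ true → a ≡ true) → a ≡ b
  bool-≡ {true} {true} f g = ≡.refl
  bool-≡ {true} {false} f g = ≡.sym (f ≡.refl)
  bool-≡ {false} {true} f g = g ≡.refl
  bool-≡ {false} {false} f g = ≡.refl

  ≢true : ∀ {a} → a ≢ true → a ≡ false
  ≢true {true} f = ⊥-elim (f ≡.refl)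
  ≢true {false} f = ≡.refl

  allF : ∀ {n} → (Fin n → Bool) → Bool
  allF {zero} p = true
  allF {suc n} p = p zero ∧ allF (p ∘ suc)

  allF⁺ : ∀ {n} (p : Fin n → Bool) → (∀ i → p i ≡ true) → allF p ≡ true
  allF⁺ {zero} p h = ≡.refl
  allF⁺ {suc n} p h = ≡.cong₂ _∧_ (h zero) (allF⁺ (p ∘ suc) (h ∘ suc))

  allF⁻ : ∀ {n} (p : Fin n → Bool) → allF p ≡ true → ∀ i → p i ≡ true
  allF⁻ p e zero = proj₁ (∧-true e)
  allF⁻ p e (suc i) = allF⁻ (p ∘ suc) (proj₂ (∧-true {p zero} e)) i

  allF-cong : ∀ {n} {p q : Fin n → Bool} → p ≗ q → allF p ≡ allF q
  allF-cong {zero} e = ≡.refl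
  allF-cong {suc n} e = ≡.cong₂ _∧_ (e zero) (allF-cong (e ∘ suc))

  <⇒<ᵇ≡true : ∀ {m n} → m < n → (m ℕ.<ᵇ n) ≡ true
  <⇒<ᵇ≡true {zero} (s≤s p) = ≡.refl
  <⇒<ᵇ≡true {suc m} (s≤s p) = <⇒<ᵇ≡true p

  <ᵇ-irrefl : ∀ n → (n ℕ.<ᵇ n) ≡ false
  <ᵇ-irrefl zero = ≡.refl
  <ᵇ-irrefl (suc n) = <ᵇ-irrefl n

  ≡ᵇ-refl : ∀ n → (n ℕ.≡ᵇ n) ≡ true
  ≡ᵇ-refl zero = ≡.refl
  ≡ᵇ-refl (suc n) = ≡ᵇ-refl n

  ≡ᵇ-≢ : ∀ {m n} → m ≢ n → (m ℕ.≡ᵇ n) ≡ false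
  ≡ᵇ-≢ {m} {n} m≢n = dec-false (m ℕ.≟ n) m≢n

  ≡ᵇ⇒≡ : ∀ {m n} → (m ℕ.≡ᵇ n) ≡ true → m ≡ n
  ≡ᵇ⇒≡ {m} {n} e = ℕₚ.≡ᵇ⇒≡ m n (≡.subst T (≡.sym e) _)

  bools : List Bool
  bools = false ∷ true ∷ []

  bools-! : Unique bools
  bools-! = ((λ ()) ∷ []) ∷ ([] ∷ [])

  ∈-bools : ∀ b → b ∈ bools
  ∈-bools false = here ≡.refl
  ∈-bools true = there (here ≡.refl)

  length-cartesianProduct : ∀ {a b} {A : Set a} {B : Set b} (xs : List A) (ys : List B) →
    length (cartesianProduct xs ys) ≡ length xs ℕ.* length ys
  length-cartesianProduct [] ys = ≡.refl
  length-cartesianProduct (x ∷ xs) ys = ≡.trans (Listₚ.length-++ (map (x ,_) ys))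
    (≡.cong₂ ℕ._+_ (Listₚ.length-map (x ,_) ys) (length-cartesianProduct xs ys))

  length-allFin : ∀ n → length (allFin n) ≡ n
  length-allFin n = Listₚ.length-tabulate {n = n} (λ i → i)

  allAlive : ∀ {a} {A : Set a} → A → Bool
  allAlive _ = true

  bitStrings : ℕ → List (List Bool)
  bitStrings zero = [] ∷ []
  bitStrings (suc k) = map (false ∷_) (bitStrings k) ++ map (true ∷_) (bitStrings k)

  -- The default `true` matters: a bit not guessed yet counts as true, so that appending `true` to
  -- the guessed bits changes nothing (`nth-∷ʳ-true`).
  nth : List Bool → ℕ → Bool
  nth [] i = true
  nth (b ∷ bs) zero = b
  nth (b ∷ bs) (suc i) = nth bs i

  nth-∷ʳ-true : ∀ bs i → nth (bs ∷ʳ true) i ≡ nth bs i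
  nth-∷ʳ-true [] zero = ≡.refl
  nth-∷ʳ-true [] (suc i) = ≡.refl
  nth-∷ʳ-true (b ∷ bs) zero = ≡.refl
  nth-∷ʳ-true (b ∷ bs) (suc i) = nth-∷ʳ-true bs i

  nth-∷ʳ-length : ∀ bs b → nth (bs ∷ʳ b) (length bs) ≡ b
  nth-∷ʳ-length [] b = ≡.refl
  nth-∷ʳ-length (_ ∷ bs) b = nth-∷ʳ-length bs b

  nth-∷ʳ-≢ : ∀ bs b i → i ≢ length bs → nth (bs ∷ʳ b) i ≡ nth bs i
  nth-∷ʳ-≢ [] b zero ne = ⊥-elim (ne ≡.refl)
  nth-∷ʳ-≢ [] b (suc i) ne = ≡.refl
  nth-∷ʳ-≢ (_ ∷ bs) b zero ne = ≡.refl
  nth-∷ʳ-≢ (_ ∷ bs) b (suc i) ne = nth-∷ʳ-≢ bs b i (ne ∘ ≡.cong suc)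

  -- A predicate `α` on the vertices is read as the set of vertices not yet visited.
  module Alive {V : Set} (_≟_ : DecidableEquality V) where

    infix 6 _==_
    _==_ : V → V → Bool
    x == y = does (x ≟ y)

    ==-refl : ∀ x → (x == x) ≡ true
    ==-refl x = dec-true (x ≟ x) ≡.refl

    ==-≢ : ∀ {x y} → x ≢ y → (x == y) ≡ false
    ==-≢ {x} {y} = dec-false (x ≟ y)

    ==⇒≡ : ∀ {x y} → (x == y) ≡ true → x ≡ y
    ==⇒≡ {x} {y} e with yes p ← x ≟ y = p

    infixl 7 _∖_
    opaque
      _∖_ : (V → Bool) → V → (V → Bool)
      (α ∖ v) x = α x ∧ not (x == v)

      ∖-def : ∀ α v x → (α ∖ v) x ≡ α x ∧ not (x == v)
      ∖-def α v x = ≡.refl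

      ∖-self : ∀ α v → (α ∖ v) v ≡ false
      ∖-self α v rewrite ==-refl v = 𝔹ₚ.∧-zeroʳ (α v)

      ∖-other : ∀ α {v x} → x ≢ v → (α ∖ v) x ≡ α x
      ∖-other α {v} {x} x≢v rewrite ==-≢ x≢v = 𝔹ₚ.∧-identityʳ (α x)

      ∖-false : ∀ α v {x} → α x ≡ false → (α ∖ v) x ≡ false
      ∖-false α v {x} e rewrite e = ≡.refl

      ∖-cong : ∀ {α β} v → α ≗ β → (α ∖ v) ≗ (β ∖ v)
      ∖-cong v e x = ≡.cong (_∧ not (x == v)) (e x)

    alive-≢ : ∀ (α : V → Bool) {x y} → α x ≡ true → α y ≡ false → x ≢ y
    alive-≢ α p q ≡.refl = false≢true (≡.trans (≡.sym q) p)

    bit : Bool → ℕ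
    bit b = if b then 1 else 0

    count : (V → Bool) → List V → ℕ
    count α [] = 0
    count α (x ∷ xs) = bit (α x) ℕ.+ count α xs

    count-cong : ∀ {α β} xs → (∀ {x} → x ∈ xs → α x ≡ β x) → count α xs ≡ count β xs
    count-cong [] e = ≡.refl
    count-cong (x ∷ xs) e = ≡.cong₂ (λ a n → bit a ℕ.+ n) (e (here ≡.refl)) (count-cong xs (e ∘ there))

    count-∖ : ∀ {α v xs} → Unique xs → v ∈ xs → α v ≡ true → count α xs ≡ suc (count (α ∖ v) xs)
    count-∖ {α} {v} {x ∷ xs} (px ∷ uq) (here ≡.refl) e rewrite e | ∖-self α x =
      ≡.cong suc (count-cong xs (λ y∈ → ≡.sym (∖-other α (λ { ≡.refl → All.lookup px y∈ ≡.refl }))))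
    count-∖ {α} {v} {x ∷ xs} (px ∷ uq) (there v∈) e
      rewrite ∖-other α {v} {x} (All.lookup px v∈) =
        ≡.trans (≡.cong (bit (α x) ℕ.+_) (count-∖ {α} uq v∈ e)) (ℕₚ.+-suc _ _)

    count-≤-length : ∀ α xs → count α xs ≤ length xs
    count-≤-length α [] = z≤n
    count-≤-length α (x ∷ xs) with α x
    ... | true = s≤s (count-≤-length α xs)
    ... | false = ℕₚ.m≤n⇒m≤1+n (count-≤-length α xs)

    count-dead : ∀ {α xs x} → count α xs ≡ 0 → x ∈ xs → α x ≡ false
    count-dead {α} {x ∷ xs} e (here ≡.refl) with α x | e
    ... | false | _ = ≡.refl
    count-dead {α} {y ∷ xs} e (there x∈) with α y | e
    ... | false | e' = count-dead e' x∈

    none : (V → Bool) → List V → Bool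
    none α [] = true
    none α (x ∷ xs) = not (α x) ∧ none α xs

    none-cong : ∀ {α β} xs → α ≗ β → none α xs ≡ none β xs
    none-cong [] e = ≡.refl
    none-cong (x ∷ xs) e = ≡.cong₂ (λ a b → not a ∧ b) (e x) (none-cong xs e)

    none-true : ∀ {α} xs → (∀ {x} → x ∈ xs → α x ≡ false) → none α xs ≡ true
    none-true [] e = ≡.refl
    none-true (x ∷ xs) e rewrite e (here ≡.refl) = none-true xs (e ∘ there)

    none-false : ∀ {α x xs} → x ∈ xs → α x ≡ true → none α xs ≡ false
    none-false {xs = x ∷ xs} (here ≡.refl) e rewrite e = ≡.refl
    none-false {α} {xs = y ∷ xs} (there x∈) e rewrite none-false {α} x∈ e = 𝔹ₚ.∧-zeroʳ _

    count-none : ∀ {α} xs → count α xs ≡ 0 → none α xs ≡ true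
    count-none xs e = none-true xs (count-dead {xs = xs} e)

  module Walk {c ℓ : Level} (R : Semiring c ℓ) {V : Set} (_≟_ : DecidableEquality V) (vs : List V)
    (lab : V → V → Semiring.Carrier R) (end : V → (V → Bool) → Semiring.Carrier R) where
    open Semiring R hiding (zero)
    open Sums R
    open Alive _≟_

    -- Cuts a sum over all vertices down to the few neighbours with a nonzero label. The elements of
    -- `ys` are split off one at a time; since `ys` has no duplicates, none of them is counted
    -- twice.
    ∑-among : ∀ {xs} (f : V → Carrier) (ys : List V) → Unique xs → Unique ys → (∀ {y} → y ∈ ys → y ∈ xs) →
      (∀ x → ¬ x ∈ ys → f x ≈ 0#) → ∑ xs f ≈ ∑ ys f
    ∑-among {xs} f [] uq uq' sub z = ∑-0 xs (λ x → z x (λ ()))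
    ∑-among {xs} f (y ∷ ys) uq (y∉ ∷ uq') sub z = begin
      ∑ xs f ≈⟨ ∑-cong xs split ⟩
      ∑ xs (λ x → when (x == y) (f x) + when (not (x == y)) (f x)) ≈⟨ ∑-+ xs _ _ ⟩
      ∑ xs (λ x → when (x == y) (f x)) + ∑ xs (λ x → when (not (x == y)) (f x))
        ≈⟨ +-cong
             (trans (∑-single _ uq (sub (here ≡.refl)) (λ {x} x≢y → reflexive (≡.cong (λ b → when b (f x)) (==-≢ x≢y))))
               (reflexive (≡.cong (λ b → when b (f y)) (==-refl y))))
             (∑-among _ ys uq uq' (sub ∘ there) outside) ⟩
      f y + ∑ ys (λ x → when (not (x == y)) (f x))
        ≈⟨ +-congˡ (∑-cong-∈ ys (λ {x} x∈ → reflexive (≡.cong (λ b → when (not b) (f x))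
             (==-≢ (λ { ≡.refl → All.lookup y∉ x∈ ≡.refl }))))) ⟩
      f y + ∑ ys f ∎
      where
      open import Relation.Binary.Reasoning.Setoid setoid
      split : ∀ x → f x ≈ when (x == y) (f x) + when (not (x == y)) (f x)
      split x with x == y
      ... | true = sym (+-identityʳ _)
      ... | false = sym (+-identityˡ _)
      outside : ∀ x → ¬ x ∈ ys → when (not (x == y)) (f x) ≈ 0#
      outside x x∉ with x ≟ y
      ... | yes _ = refl
      ... | no x≢y = z x (λ { (here e) → x≢y e ; (there x∈) → x∉ x∈ })

    -- The sum over all paths that leave u, visit at most n vertices alive in α (each at most once) and stop at a
    -- vertex v, where the path is weighted by the labels and by end v on the set of vertices still alive.
    opaque
      walk : ℕ → V → (V → Bool) → Carrier
      walk zero u α = end u α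
      walk (suc n) u α = ∑ vs (λ v → when (α v) (lab u v * walk n v (α ∖ v))) + end u α

      walk-zero : ∀ u α → walk zero u α ≡ end u α
      walk-zero u α = ≡.refl

      walk-step : ∀ n u α →
        walk (suc n) u α ≡ ∑ vs (λ v → when (α v) (lab u v * walk n v (α ∖ v))) + end u α
      walk-step n u α = ≡.refl

      walk-cong : (∀ u {α β} → α ≗ β → end u α ≈ end u β) → ∀ n u {α β} → α ≗ β → walk n u α ≈ walk n u β
      walk-cong end-cong zero u e = end-cong u e
      walk-cong end-cong (suc n) u e = +-cong
        (∑-cong vs (λ v → when-≡ (e v) (*-congˡ (walk-cong end-cong n v (∖-cong v e)))))
        (end-cong u e)

      -- Every step uses up an alive vertex. Once none is left, all summands of a further step
      -- vanish and the end value remains.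
      walk-suc : (uq : Unique vs) → ∀ n u α → count α vs ≤ n → walk (suc n) u α ≈ walk n u α
      walk-suc uq zero u α c≤ = +-zeroˡ (∑-0-∈ vs (λ {v} v∈ →
        reflexive (≡.cong (λ b → when b (lab u v * walk 0 v (α ∖ v))) (count-dead {α} (ℕₚ.n≤0⇒n≡0 c≤) v∈))))
      walk-suc uq (suc n) u α c≤ = +-congʳ (∑-cong-∈ vs (λ {v} v∈ → when-cong (α v) (λ e →
        *-congˡ (walk-suc uq n v (α ∖ v) (ℕₚ.≤-pred (≡.subst (_≤ suc n) (count-∖ {α} uq v∈ e) c≤))))))

    walk-fuel : (uq : Unique vs) → ∀ m n u α → count α vs ≤ n → walk (m ℕ.+ n) u α ≈ walk n u α
    walk-fuel uq zero n u α c≤ = refl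
    walk-fuel uq (suc m) n u α c≤ =
      trans (walk-suc uq (m ℕ.+ n) u α (ℕₚ.≤-trans c≤ (ℕₚ.m≤n+m n m))) (walk-fuel uq m n u α c≤)

    walk-fuel-≥ : (uq : Unique vs) → ∀ m n u α → count α vs ≤ m → count α vs ≤ n → walk m u α ≈ walk n u α
    walk-fuel-≥ uq m n u α c≤m c≤n = trans (sym (reduce m c≤m)) (reduce n c≤n)
      where
      reduce : ∀ m → count α vs ≤ m → walk (count α vs) u α ≈ walk m u α
      reduce m c≤m = trans (sym (walk-fuel uq (m ℕ.∸ count α vs) (count α vs) u α ℕₚ.≤-refl))
        (reflexive (≡.cong (λ k → walk k u α) (ℕₚ.m∸n+n≡m c≤m)))

  -- Renaming of vertices along an injection, which commutes with the removal of a vertex. It is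
  -- applied twice, to number the vertices of the gadget graph by `Fin` and to number the groups of
  -- the program graph.
  module WalkMap {c ℓ : Level} (R : Semiring c ℓ)
    {V : Set} (_≟_ : DecidableEquality V) (vs : List V)
    {V' : Set} (_≟'_ : DecidableEquality V')
    (φ : V → V') (φ-inj : ∀ {x y} → φ x ≡ φ y → x ≡ y)
    (lab : V' → V' → Semiring.Carrier R)
    (end : V → (V → Bool) → Semiring.Carrier R) (end' : V' → (V' → Bool) → Semiring.Carrier R)
    (end-cong : ∀ u {α β} → α ≗ β → Semiring._≈_ R (end u α) (end u β))
    (end-φ : ∀ u α → Semiring._≈_ R (end u (α ∘ φ)) (end' (φ u) α)) where
    open Semiring R hiding (zero)
    open Sums R
    module A = Alive _≟_
    module A' = Alive _≟'_
    module W = Walk R _≟_ vs (λ u v → lab (φ u) (φ v)) end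
    module W' = Walk R _≟'_ (map φ vs) lab end'

    ∖-φ : ∀ α v → (α A'.∖ φ v) ∘ φ ≗ ((α ∘ φ) A.∖ v)
    ∖-φ α v x with x ≟ v
    ... | yes ≡.refl = ≡.trans (A'.∖-self α (φ x)) (≡.sym (A.∖-self (α ∘ φ) x))
    ... | no x≢v = ≡.trans (A'.∖-other α (x≢v ∘ φ-inj)) (≡.sym (A.∖-other (α ∘ φ) x≢v))

    opaque
      unfolding Walk.walk
      walk-map : ∀ n u α → W.walk n u (α ∘ φ) ≈ W'.walk n (φ u) α
      walk-map zero u α = end-φ u α
      walk-map (suc n) u α = +-cong
        (trans (∑-cong vs (λ v → when-cong (α (φ v)) (λ _ → *-congˡ
            (trans (W.walk-cong end-cong n v (λ x → ≡.sym (∖-φ α v x))) (walk-map n v (α A'.∖ φ v))))))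
          (sym (reflexive (∑-map φ vs _))))
        (end-φ u α)

  module WalkLabels {c ℓ : Level} (R : Semiring c ℓ) {V : Set} (_≟_ : DecidableEquality V) (vs : List V)
    {lab lab' : V → V → Semiring.Carrier R} {end end' : V → (V → Bool) → Semiring.Carrier R}
    (lab≈ : ∀ u v → Semiring._≈_ R (lab u v) (lab' u v)) (end≈ : ∀ u α → Semiring._≈_ R (end u α) (end' u α)) where
    open Semiring R hiding (zero)
    open Sums R

    opaque
      unfolding Walk.walk
      walk-labels : ∀ n u α → Walk.walk R _≟_ vs lab end n u α ≈ Walk.walk R _≟_ vs lab' end' n u α
      walk-labels zero u α = end≈ u α
      walk-labels (suc n) u α = +-cong
        (∑-cong vs (λ v → when-cong (α v) (λ _ → *-cong (lab≈ u v) (walk-labels n v _)))) (end≈ u α)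

open Walks

-- Polynomially bounded functions

module PolyBounds where
  open import Data.Nat using (_+_; _*_; _^_)
  Bounded : (ℕ → ℕ) → Set
  Bounded t = ∃[ k ] (∀ n → t n ≤ n ^ k + k)

  private
    small : ∀ n k → n ≤ 1 → n ^ k ≤ 1
    small n k n≤1 = ℕₚ.≤-trans (ℕₚ.^-monoˡ-≤ k n≤1) (ℕₚ.≤-reflexive (ℕₚ.^-zeroˡ k))

    k≤n^k : ∀ n k → 2 ≤ n → k ≤ n ^ k
    k≤n^k n zero 2≤n = z≤n
    k≤n^k n (suc k) 2≤n = ℕₚ.≤-trans (ℕₚ.+-mono-≤ one (k≤n^k n k 2≤n))
      (ℕₚ.≤-trans (ℕₚ.≤-reflexive (≡.cong (n ^ k +_) (≡.sym (ℕₚ.+-identityʳ (n ^ k))))) (ℕₚ.*-monoˡ-≤ (n ^ k) 2≤n))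
      where
      one : 1 ≤ n ^ k
      one = ℕₚ.≤-trans (ℕₚ.≤-reflexive (≡.sym (ℕₚ.^-zeroˡ k))) (ℕₚ.^-monoˡ-≤ k (ℕₚ.≤-trans (s≤s z≤n) 2≤n))

    large : ∀ n k → 2 ≤ n → n ^ k + k ≤ n ^ suc k
    large n k 2≤n = ℕₚ.≤-trans (ℕₚ.+-monoʳ-≤ (n ^ k) (k≤n^k n k 2≤n))
      (ℕₚ.≤-trans (ℕₚ.≤-reflexive (≡.cong (n ^ k +_) (≡.sym (ℕₚ.+-identityʳ (n ^ k))))) (ℕₚ.*-monoˡ-≤ (n ^ k) 2≤n))

    -- From n = 2 on, k ≤ n ^ k, so powers absorb additive constants (`large`). For n ≤ 1 powers do
    -- not grow, and the summand k of the bound has to suffice.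
    bounded : ∀ {t} K c → (∀ n → 2 ≤ n → t n ≤ n ^ K) → (∀ n → n ≤ 1 → t n ≤ c) → Bounded t
    bounded {t} K c big little = K + c , go
      where
      go : ∀ n → t n ≤ n ^ (K + c) + (K + c)
      go n with ℕₚ.<-≤-connex n 2
      ... | inj₁ (s≤s n≤1) = ℕₚ.≤-trans (little n n≤1) (ℕₚ.≤-trans (ℕₚ.m≤n+m c K) (ℕₚ.m≤n+m (K + c) (n ^ (K + c))))
      ... | inj₂ 2≤n@(s≤s _) = ℕₚ.≤-trans (big n 2≤n) (ℕₚ.≤-trans (ℕₚ.^-monoʳ-≤ n (ℕₚ.m≤m+n K c)) (ℕₚ.m≤m+n (n ^ (K + c)) (K + c)))

  bounded-≤ : ∀ {t u} → (∀ n → t n ≤ u n) → Bounded u → Bounded t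
  bounded-≤ t≤u (k , h) = k , λ n → ℕₚ.≤-trans (t≤u n) (h n)

  bounded-const : ∀ c → Bounded (λ _ → c)
  bounded-const c = c , λ n → ℕₚ.m≤n+m c (n ^ c)

  bounded-id : Bounded (λ n → n)
  bounded-id = 1 , λ n → ℕₚ.≤-trans (ℕₚ.≤-reflexive (≡.sym (ℕₚ.*-identityʳ n))) (ℕₚ.m≤m+n (n ^ 1) 1)

  infixl 7 _⊠_
  infixl 6 _⊞_

  _⊠_ : ∀ {t u} → Bounded t → Bounded u → Bounded (λ n → t n * u n)
  _⊠_ (k , h) (l , g) = bounded (suc k + suc l) ((1 + k) * (1 + l))
    (λ n 2≤n → ℕₚ.≤-trans (ℕₚ.*-mono-≤ (ℕₚ.≤-trans (h n) (large n k 2≤n)) (ℕₚ.≤-trans (g n) (large n l 2≤n)))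
      (ℕₚ.≤-reflexive (≡.sym (ℕₚ.^-distribˡ-+-* n (suc k) (suc l)))))
    (λ n n≤1 → ℕₚ.*-mono-≤ (ℕₚ.≤-trans (h n) (ℕₚ.+-monoˡ-≤ k (small n k n≤1))) (ℕₚ.≤-trans (g n) (ℕₚ.+-monoˡ-≤ l (small n l n≤1))))

  _⊞_ : ∀ {t u} → Bounded t → Bounded u → Bounded (λ n → t n + u n)
  -- Sums are reduced to products by t + u ≤ (1 + t)(1 + u).
  _⊞_ {t} {u} bt bu = bounded-≤ sum≤ (succ bt ⊠ succ bu)
    where
    succ : ∀ {t} → Bounded t → Bounded (λ n → suc (t n))
    succ {t} (k , h) = bounded (suc (suc k)) (2 + k)
      (λ n 2≤n → ℕₚ.≤-trans (s≤s (ℕₚ.≤-trans (h n) (large n k 2≤n))) (ℕₚ.≤-trans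
        (ℕₚ.≤-trans (ℕₚ.≤-reflexive (ℕₚ.+-comm 1 _)) (ℕₚ.+-monoʳ-≤ (n ^ suc k) (s≤s z≤n))) (large n (suc k) 2≤n)))
      (λ n n≤1 → s≤s (ℕₚ.≤-trans (h n) (ℕₚ.+-monoˡ-≤ k (small n k n≤1))))
    sum≤ : ∀ n → t n + u n ≤ suc (t n) * suc (u n)
    sum≤ n = ℕₚ.≤-trans (ℕₚ.≤-reflexive (ℕₚ.+-comm (t n) (u n))) (ℕₚ.+-mono-≤ (ℕₚ.n≤1+n (u n)) (ℕₚ.m≤m*n (t n) (suc (u n))))

open PolyBounds

-- The free algebra as a semiring, and substitution

module PolyAlg {c ℓ : Level} (F : CommutativeRing c ℓ) where
  open CommutativeRing F
  open NC F
  open Sums semiring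
  open import Relation.Binary.Reasoning.Setoid setoid

  _≟ʷ_ : (u v : Word) → Dec (u ≡ v)
  _≟ʷ_ = Listₚ.≡-dec ℕ._≟_

  -- The linear extension of φ from words to polynomials. A polynomial is determined by the functionals
  -- φ ↦ ext φ p, for which products and substitutions are given by composition.
  ext : (Word → Carrier) → Poly → Carrier
  ext φ p = ∑ p (λ t → proj₁ t * φ (proj₂ t))

  δ : Word → Word → Carrier
  δ w u = when (does (u ≟ʷ w)) 1#

  coeff-ext : ∀ p w → coeff p w ≈ ext (δ w) p
  coeff-ext [] w = refl
  coeff-ext ((a , u) ∷ p) w with does (u ≟ʷ w)
  ... | true = +-cong (sym (*-identityʳ a)) (coeff-ext p w)
  ... | false = trans (coeff-ext p w) (sym (+-zeroˡ (zeroʳ a)))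

  -- Unlike ≈P, whose unfolding hides them, ≋ lets the two polynomials be inferred from a proof.
  record _≋_ (p q : Poly) : Set ℓ where
    constructor mk≋
    field coeffs : p ≈P q
  open _≋_ public

  ≋-ext : ∀ {p q} → (∀ φ → ext φ p ≈ ext φ q) → p ≋ q
  ≋-ext {p} {q} e = mk≋ λ w → trans (coeff-ext p w) (trans (e (δ w)) (sym (coeff-ext q w)))

  ext-cong-φ : ∀ {φ ψ} p → (∀ w → φ w ≈ ψ w) → ext φ p ≈ ext ψ p
  ext-cong-φ p e = ∑-cong p (λ t → *-congˡ (e (proj₂ t)))

  -- Grouping the terms by their words shows that `ext φ p` depends on the coefficients of `p` only.
  -- The list `ws` may be larger than the support, so that one list can serve two polynomials in
  -- `ext-cong`.
  ext-support : ∀ φ (ws : List Word) → Unique ws → ∀ p → (∀ {t} → t ∈ p → proj₂ t ∈ ws) →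
    ext φ p ≈ ∑ ws (λ w → coeff p w * φ w)
  ext-support φ ws uq [] _ = sym (∑-0 ws (λ w → zeroˡ (φ w)))
  ext-support φ ws uq ((a , u) ∷ p) sub = begin
    a * φ u + ext φ p ≈⟨ +-cong (sym lemma₁) (ext-support φ ws uq p (sub ∘ there)) ⟩
    ∑ ws (λ w → when (does (u ≟ʷ w)) (a * φ w)) + ∑ ws (λ w → coeff p w * φ w) ≈⟨ ∑-+ ws _ _ ⟨
    ∑ ws (λ w → when (does (u ≟ʷ w)) (a * φ w) + coeff p w * φ w) ≈⟨ ∑-cong ws lemma₂ ⟩
    ∑ ws (λ w → coeff ((a , u) ∷ p) w * φ w) ∎
    where
    lemma₁ : ∑ ws (λ w → when (does (u ≟ʷ w)) (a * φ w)) ≈ a * φ u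
    lemma₁ = trans
      (∑-single _ uq (sub (here ≡.refl))
        (λ {w} w≢u → reflexive (≡.cong (λ b → when b (a * φ w)) (dec-false (u ≟ʷ w) (w≢u ∘ ≡.sym)))))
      (reflexive (≡.cong (λ b → when b (a * φ u)) (dec-true (u ≟ʷ u) ≡.refl)))
    lemma₂ : ∀ w → when (does (u ≟ʷ w)) (a * φ w) + coeff p w * φ w ≈ coeff ((a , u) ∷ p) w * φ w
    lemma₂ w with does (u ≟ʷ w)
    ... | true = sym (distribʳ (φ w) a (coeff p w))
    ... | false = +-identityˡ _

  ext-cong : ∀ φ {p q} → p ≋ q → ext φ p ≈ ext φ q
  ext-cong φ {p} {q} (mk≋ e) = begin
    ext φ p ≈⟨ ext-support φ ws uq p (λ t∈ → ∈-deduplicate⁺ _≟ʷ_ (∈-++⁺ˡ (∈-map⁺ proj₂ t∈))) ⟩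
    ∑ ws (λ w → coeff p w * φ w) ≈⟨ ∑-cong ws (λ w → *-congʳ (e w)) ⟩
    ∑ ws (λ w → coeff q w * φ w)
      ≈⟨ ext-support φ ws uq q (λ t∈ → ∈-deduplicate⁺ _≟ʷ_ (∈-++⁺ʳ (map proj₂ p) (∈-map⁺ proj₂ t∈))) ⟨
    ext φ q ∎
    where
    ws = deduplicate _≟ʷ_ (map proj₂ p ++ map proj₂ q)
    uq : Unique ws
    uq = deduplicate-! _≟ʷ_ (map proj₂ p ++ map proj₂ q)

  ext-+ : ∀ φ p q → ext φ (p +P q) ≈ ext φ p + ext φ q
  ext-+ φ p q = ∑-++ p q _

  ext-φ-+ : ∀ φ ψ p → ext (λ w → φ w + ψ w) p ≈ ext φ p + ext ψ p
  ext-φ-+ φ ψ p = trans (∑-cong p (λ t → distribˡ _ _ _)) (∑-+ p _ _)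

  ext-φ-0 : ∀ {φ} p → (∀ w → φ w ≈ 0#) → ext φ p ≈ 0#
  ext-φ-0 p e = ∑-0 p (λ t → *-zeroʳ (e (proj₂ t)))

  ext-φ-*ˡ : ∀ a φ p → ext (λ w → a * φ w) p ≈ a * ext φ p
  ext-φ-*ˡ a φ p = trans (∑-cong p (λ t → begin
    proj₁ t * (a * φ (proj₂ t)) ≈⟨ *-assoc _ _ _ ⟨
    (proj₁ t * a) * φ (proj₂ t) ≈⟨ *-congʳ (*-comm _ _) ⟩
    (a * proj₁ t) * φ (proj₂ t) ≈⟨ *-assoc _ _ _ ⟩
    a * (proj₁ t * φ (proj₂ t)) ∎)) (sym (∑-*ˡ a p _))

  ext-φ-when : ∀ b φ p → ext (λ w → when b (φ w)) p ≈ when b (ext φ p)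
  ext-φ-when true φ p = refl
  ext-φ-when false φ p = ext-φ-0 p (λ _ → refl)

  ext-φ-∑ : ∀ {a} {A : Set a} (xs : List A) (φ : A → Word → Carrier) p →
    ext (λ w → ∑ xs (λ x → φ x w)) p ≈ ∑ xs (λ x → ext (φ x) p)
  ext-φ-∑ [] φ p = ext-φ-0 p (λ _ → refl)
  ext-φ-∑ (x ∷ xs) φ p = trans (ext-φ-+ (φ x) (λ w → ∑ xs (λ y → φ y w)) p) (+-congˡ (ext-φ-∑ xs φ p))

  ext-* : ∀ φ p q → ext φ (p *P q) ≈ ext (λ u → ext (λ v → φ (u ++ v)) q) p
  ext-* φ [] q = refl
  ext-* φ ((a , u) ∷ p) q = trans (∑-++ (map _ q) (p *P q) _) (+-cong first (ext-* φ p q))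
    where
    first : ∑ (map (λ { (b , v) → (a * b , u ++ v) }) q) (λ t → proj₁ t * φ (proj₂ t)) ≈ a * ext (λ v → φ (u ++ v)) q
    first = trans (reflexive (∑-map _ q _))
              (trans (∑-cong q (λ { (b , v) → *-assoc a b (φ (u ++ v)) })) (sym (∑-*ˡ a q _)))

  ext-const : ∀ φ a → ext φ (constP a) ≈ a * φ []
  ext-const φ a = +-identityʳ _

  +P-cong : ∀ {p p' q q'} → p ≋ p' → q ≋ q' → (p +P q) ≋ (p' +P q')
  +P-cong {p} {p'} {q} {q'} e f = ≋-ext λ φ →
    trans (ext-+ φ p q) (trans (+-cong (ext-cong φ e) (ext-cong φ f)) (sym (ext-+ φ p' q')))

  *P-cong : ∀ {p p' q q'} → p ≋ p' → q ≋ q' → (p *P q) ≋ (p' *P q')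
  *P-cong {p} {p'} {q} {q'} e f = ≋-ext λ φ → begin
    ext φ (p *P q) ≈⟨ ext-* φ p q ⟩
    ext (λ u → ext (λ v → φ (u ++ v)) q) p ≈⟨ ext-cong _ e ⟩
    ext (λ u → ext (λ v → φ (u ++ v)) q) p' ≈⟨ ext-cong-φ p' (λ u → ext-cong _ f) ⟩
    ext (λ u → ext (λ v → φ (u ++ v)) q') p' ≈⟨ ext-* φ p' q' ⟨
    ext φ (p' *P q') ∎

  ≡⇒≋ : ∀ {p q} → p ≡ q → p ≋ q
  ≡⇒≋ ≡.refl = mk≋ λ w → refl

  -- Opaque copies of +P and *P, to keep polynomial expressions from unfolding
  opaque
    infixl 6 _⊕_
    infixl 7 _⊗_
    _⊕_ _⊗_ : Poly → Poly → Poly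
    _⊕_ = _+P_
    _⊗_ = _*P_

    ⊕-def : ∀ p q → p ⊕ q ≡ p +P q
    ⊕-def p q = ≡.refl

    ⊗-def : ∀ p q → p ⊗ q ≡ p *P q
    ⊗-def p q = ≡.refl

  opaque
    unfolding _⊕_

    -- Tested on functionals, a product becomes a nested `ext`; associativity of the product then
    -- comes down to that of `++`, and distributivity to the additivity of `ext`.
    poly-isSemiring : IsSemiring _≋_ _⊕_ _⊗_ 0P (constP 1#)
    poly-isSemiring = record
      { isSemiringWithoutAnnihilatingZero = record
        { +-isCommutativeMonoid = record
          { isMonoid = record
            { isSemigroup = record
              { isMagma = record
                { isEquivalence = record
                  { refl = mk≋ λ w → refl
                  ; sym = λ e → mk≋ λ w → sym (coeffs e w)
                  ; trans = λ e f → mk≋ λ w → trans (coeffs e w) (coeffs f w) }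
                ; ∙-cong = +P-cong }
              ; assoc = λ p q r → ≡⇒≋ (Listₚ.++-assoc p q r) }
            ; identity = (λ p → ≡⇒≋ ≡.refl) , (λ p → ≡⇒≋ (Listₚ.++-identityʳ p)) }
          ; comm = λ p q → ≋-ext λ φ →
              trans (ext-+ φ p q) (trans (+-comm _ _) (sym (ext-+ φ q p))) }
        ; *-cong = *P-cong
        ; *-assoc = λ p q r → ≋-ext λ φ → begin
            ext φ ((p *P q) *P r) ≈⟨ ext-* φ (p *P q) r ⟩
            ext (λ u → ext (λ v → φ (u ++ v)) r) (p *P q) ≈⟨ ext-* _ p q ⟩
            ext (λ u → ext (λ v → ext (λ w → φ ((u ++ v) ++ w)) r) q) p
              ≈⟨ ext-cong-φ p (λ u → ext-cong-φ q (λ v → ext-cong-φ r (λ w →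
                   reflexive (≡.cong φ (Listₚ.++-assoc u v w))))) ⟩
            ext (λ u → ext (λ v → ext (λ w → φ (u ++ (v ++ w))) r) q) p
              ≈⟨ ext-cong-φ p (λ u → sym (ext-* _ q r)) ⟩
            ext (λ u → ext (λ v → φ (u ++ v)) (q *P r)) p ≈⟨ ext-* φ p (q *P r) ⟨
            ext φ (p *P (q *P r)) ∎
        ; *-identity =
            (λ p → ≋-ext λ φ →
               trans (ext-* φ (constP 1#) p) (trans (ext-const (λ u → ext (λ v → φ (u ++ v)) p) 1#) (*-identityˡ _))) ,
            (λ p → ≋-ext λ φ →
               trans (ext-* φ p (constP 1#)) (ext-cong-φ p (λ u →
                 trans (ext-const (λ v → φ (u ++ v)) 1#) (trans (*-identityˡ _) (reflexive (≡.cong φ (Listₚ.++-identityʳ u)))))))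
        ; distrib =
            (λ p q r → ≋-ext λ φ → begin
               ext φ (p *P (q +P r)) ≈⟨ ext-* φ p (q +P r) ⟩
               ext (λ u → ext (λ v → φ (u ++ v)) (q +P r)) p ≈⟨ ext-cong-φ p (λ u → ext-+ _ q r) ⟩
               ext (λ u → ext (λ v → φ (u ++ v)) q + ext (λ v → φ (u ++ v)) r) p ≈⟨ ext-φ-+ _ _ p ⟩
               ext (λ u → ext (λ v → φ (u ++ v)) q) p + ext (λ u → ext (λ v → φ (u ++ v)) r) p
                 ≈⟨ +-cong (ext-* φ p q) (ext-* φ p r) ⟨
               ext φ (p *P q) + ext φ (p *P r) ≈⟨ ext-+ φ (p *P q) (p *P r) ⟨
               ext φ ((p *P q) +P (p *P r)) ∎) ,
            (λ p q r → ≋-ext λ φ → begin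
               ext φ ((q +P r) *P p) ≈⟨ ext-* φ (q +P r) p ⟩
               ext (λ u → ext (λ v → φ (u ++ v)) p) (q +P r) ≈⟨ ext-+ _ q r ⟩
               ext (λ u → ext (λ v → φ (u ++ v)) p) q + ext (λ u → ext (λ v → φ (u ++ v)) p) r
                 ≈⟨ +-cong (ext-* φ q p) (ext-* φ r p) ⟨
               ext φ (q *P p) + ext φ (r *P p) ≈⟨ ext-+ φ (q *P p) (r *P p) ⟨
               ext φ ((q *P p) +P (r *P p)) ∎) }
      ; zero = (λ p → ≡⇒≋ ≡.refl) ,
               (λ p → ≋-ext λ φ → trans (ext-* φ p 0P) (ext-φ-0 p (λ _ → refl))) }

  polySemiring : Semiring c ℓ
  polySemiring = record
    { Carrier = Poly ; _≈_ = _≋_ ; _+_ = _⊕_ ; _*_ = _⊗_ ; 0# = 0P ; 1# = constP 1# ; isSemiring = poly-isSemiring }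

  private module P = Semiring polySemiring
  open Sums polySemiring public using () renaming (∑ to ∑P; when to whenP)

  constP-cong : ∀ {a b} → a ≈ b → constP a P.≈ constP b
  constP-cong {a} {b} e = ≋-ext λ φ → +-congʳ (*-congʳ e)

  constP-0 : constP 0# P.≈ P.0#
  constP-0 = ≋-ext λ φ → trans (ext-const φ 0#) (zeroˡ _)

  opaque
    unfolding _⊕_

    constP-+ : ∀ a b → constP (a + b) P.≈ constP a P.+ constP b
    constP-+ a b = ≋-ext λ φ →
      trans (ext-const φ (a + b)) (trans (distribʳ _ a b)
        (sym (trans (ext-+ φ (constP a) (constP b)) (+-cong (ext-const φ a) (ext-const φ b)))))

  opaque
    unfolding _⊕_

    constP-* : ∀ a b → constP (a * b) P.≈ constP a P.* constP b
    constP-* a b = ≋-ext λ φ → begin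
      ext φ (constP (a * b)) ≈⟨ ext-const φ (a * b) ⟩
      a * b * φ [] ≈⟨ *-assoc _ _ _ ⟩
      a * (b * φ []) ≈⟨ *-congˡ (ext-const φ b) ⟨
      a * ext φ (constP b) ≈⟨ ext-const (λ u → ext (λ v → φ (u ++ v)) (constP b)) a ⟨
      ext (λ u → ext (λ v → φ (u ++ v)) (constP b)) (constP a) ≈⟨ ext-* φ (constP a) (constP b) ⟨
      ext φ (constP a *P constP b) ∎

  opaque
    unfolding _⊕_

    -- Commutativity of the coefficients is all that is used. It lets the constant term of a right
    -- factor move to the front in `rep-*`.
    constP-central : ∀ a p → constP a P.* p P.≈ p P.* constP a
    constP-central a p = ≋-ext λ φ → begin
      ext φ (constP a *P p) ≈⟨ ext-* φ (constP a) p ⟩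
      ext (λ u → ext (λ v → φ (u ++ v)) p) (constP a) ≈⟨ ext-const (λ u → ext (λ v → φ (u ++ v)) p) a ⟩
      a * ext φ p ≈⟨ ext-φ-*ˡ a φ p ⟨
      ext (λ u → a * φ u) p
        ≈⟨ ext-cong-φ p (λ u → trans (*-congˡ (reflexive (≡.cong φ (≡.sym (Listₚ.++-identityʳ u))))) (sym (ext-const (λ v → φ (u ++ v)) a))) ⟩
      ext (λ u → ext (λ v → φ (u ++ v)) (constP a)) p ≈⟨ ext-* φ p (constP a) ⟨
      ext φ (p *P constP a) ∎

  coeff-+ : ∀ p q w → coeff (p +P q) w ≈ coeff p w + coeff q w
  coeff-+ p q w = trans (coeff-ext (p +P q) w)
    (trans (ext-+ _ p q) (sym (+-cong (coeff-ext p w) (coeff-ext q w))))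

  opaque
    unfolding _⊕_

    coeff-∑ : ∀ {a} {A : Set a} (xs : List A) (f : A → Poly) w → coeff (∑P xs f) w ≈ ∑ xs (λ x → coeff (f x) w)
    coeff-∑ [] f w = refl
    coeff-∑ (x ∷ xs) f w = trans (coeff-+ (f x) (∑P xs f) w) (+-congˡ (coeff-∑ xs f w))

  opaque
    unfolding _⊕_

    ext-∑ : ∀ {a} {A : Set a} φ (xs : List A) (f : A → Poly) → ext φ (∑P xs f) ≈ ∑ xs (λ x → ext φ (f x))
    ext-∑ φ [] f = refl
    ext-∑ φ (x ∷ xs) f = trans (ext-+ φ (f x) (∑P xs f)) (+-congˡ (ext-∑ φ xs f))

  opaque
    unfolding _⊕_

    sumP-map : ∀ {a} {A : Set a} (f : A → Poly) (xs : List A) → sumP (map f xs) ≡ ∑P xs f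
    sumP-map f [] = ≡.refl
    sumP-map f (x ∷ xs) = ≡.cong (f x +P_) (sumP-map f xs)

  -- Substitution

  atom : Subst → Poly
  atom (var j) = varP j
  atom (const b) = constP b

  ext-subst : ∀ φ σ p → ext φ (subst σ p) ≈ ext (λ u → proj₁ (substWord σ u) * φ (proj₂ (substWord σ u))) p
  ext-subst φ σ [] = refl
  ext-subst φ σ ((a , u) ∷ p) = +-cong (*-assoc _ _ _) (ext-subst φ σ p)

  subst-cong : ∀ σ {p q} → p P.≈ q → subst σ p P.≈ subst σ q
  subst-cong σ {p} {q} e = ≋-ext λ φ →
    trans (ext-subst φ σ p) (trans (ext-cong _ e) (sym (ext-subst φ σ q)))

  subst-+ : ∀ σ p q → subst σ (p +P q) ≡ subst σ p +P subst σ q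
  subst-+ σ p q = Listₚ.map-++ _ p q

  opaque
    unfolding _⊕_

    subst-∑ : ∀ {a} {A : Set a} σ (xs : List A) (f : A → Poly) → subst σ (∑P xs f) ≡ ∑P xs (λ x → subst σ (f x))
    subst-∑ σ [] f = ≡.refl
    subst-∑ σ (x ∷ xs) f = ≡.trans (subst-+ σ (f x) (∑P xs f)) (≡.cong (subst σ (f x) +P_) (subst-∑ σ xs f))

  subst-when : ∀ σ b p → subst σ (whenP b p) ≡ whenP b (subst σ p)
  subst-when σ true p = ≡.refl
  subst-when σ false p = ≡.refl

  subst-const : ∀ σ a → subst σ (constP a) P.≈ constP a
  subst-const σ a = constP-cong (*-identityʳ a)

  subst-var : ∀ σ i → subst σ (varP i) P.≈ atom (σ i)
  subst-var σ i with σ i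
  ... | var j = ≋-ext λ φ → +-congʳ (*-congʳ (*-identityʳ 1#))
  ... | const b = constP-cong (trans (*-identityˡ _) (*-identityʳ b))

  -- The functional `φ` is arbitrary because the induction changes it: a variable put in front of
  -- the word is absorbed into `φ`.
  substWord-++ : ∀ σ u v (φ : Word → Carrier) →
    proj₁ (substWord σ (u ++ v)) * φ (proj₂ (substWord σ (u ++ v))) ≈
    proj₁ (substWord σ u) * (proj₁ (substWord σ v) * φ (proj₂ (substWord σ u) ++ proj₂ (substWord σ v)))
  substWord-++ σ [] v φ = sym (*-identityˡ _)
  substWord-++ σ (i ∷ u) v φ with σ i
  ... | var j = substWord-++ σ u v (λ w → φ (j ∷ w))
  ... | const b = begin
    b * proj₁ (substWord σ (u ++ v)) * φ (proj₂ (substWord σ (u ++ v))) ≈⟨ *-assoc _ _ _ ⟩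
    b * (proj₁ (substWord σ (u ++ v)) * φ (proj₂ (substWord σ (u ++ v)))) ≈⟨ *-congˡ (substWord-++ σ u v φ) ⟩
    b * (proj₁ (substWord σ u) * _) ≈⟨ *-assoc _ _ _ ⟨
    b * proj₁ (substWord σ u) * _ ∎

  opaque
    unfolding _⊕_

    subst-* : ∀ σ p q → subst σ (p *P q) P.≈ subst σ p P.* subst σ q
    subst-* σ p q = ≋-ext λ φ → begin
      ext φ (subst σ (p *P q)) ≈⟨ ext-subst φ σ (p *P q) ⟩
      ext (λ u → proj₁ (substWord σ u) * φ (proj₂ (substWord σ u))) (p *P q) ≈⟨ ext-* _ p q ⟩
      ext (λ u → ext (λ v → proj₁ (substWord σ (u ++ v)) * φ (proj₂ (substWord σ (u ++ v)))) q) p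
        ≈⟨ ext-cong-φ p (λ u → ext-cong-φ q (λ v → substWord-++ σ u v φ)) ⟩
      ext (λ u → ext (λ v → proj₁ (substWord σ u) *
        (proj₁ (substWord σ v) * φ (proj₂ (substWord σ u) ++ proj₂ (substWord σ v)))) q) p
        ≈⟨ ext-cong-φ p (λ u → trans (ext-φ-*ˡ _ _ q) (*-congˡ (sym (ext-subst _ σ q)))) ⟩
      ext (λ u → proj₁ (substWord σ u) * ext (λ v → φ (proj₂ (substWord σ u) ++ v)) (subst σ q)) p
        ≈⟨ ext-subst _ σ p ⟨
      ext (λ u → ext (λ v → φ (u ++ v)) (subst σ q)) (subst σ p) ≈⟨ ext-* φ (subst σ p) (subst σ q) ⟨
      ext φ (subst σ p *P subst σ q) ∎

-- Hamiltonian cycle polynomials as sums over walks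

module CycleSum {c ℓ c' ℓ' : Level} (F : CommutativeRing c ℓ) (R : Semiring c' ℓ') where
  open NC F using (allMaps; anyEq; distinct; iter; isNCycle)
  open Semiring R hiding (zero)
  open Sums R
  open import Relation.Binary.Reasoning.Setoid setoid

  module FinAlive {n : ℕ} = Alive (Finₚ._≟_ {n})
  open FinAlive

  ∑-δ : ∀ {n} (u : Fin n) (h : Fin n → Carrier) → ∑ (allFin n) (λ v → when (u == v) (h v)) ≈ h u
  ∑-δ {n} u h = trans
    (∑-single _ (Uniqueₚ.allFin⁺ n) (∈-allFin u) (λ v≢u → reflexive (≡.cong (λ b → when b _) (==-≢ (v≢u ∘ ≡.sym)))))
    (reflexive (≡.cong (λ b → when b _) (==-refl u)))

  -- Exactly one listed map passes the test. The test is pointwise, since a map built by `allMaps`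
  -- equals `f` only extensionally.
  ∑-maps-single : ∀ n m (f : Fin n → Fin m) x →
    ∑ (allMaps n m) (λ τ → when (allF (λ i → f i == τ i)) x) ≈ x
  ∑-maps-single zero m f x = +-identityʳ x
  ∑-maps-single (suc n) m f x = begin
    ∑ (allMaps (suc n) m) (λ τ → when (allF (λ i → f i == τ i)) x)
      ≈⟨ ∑-concatMap _ (allMaps n m) _ ⟩
    ∑ (allMaps n m) (λ τ → ∑ (map _ (allFin m)) (λ τ' → when (allF (λ i → f i == τ' i)) x))
      ≈⟨ ∑-cong (allMaps n m) (λ τ → trans (reflexive (∑-map _ (allFin m) _)) (trans
           (∑-cong (allFin m) (λ a → reflexive (when-∧ (f zero == a) _ x))) (∑-δ (f zero) _))) ⟩
    ∑ (allMaps n m) (λ τ → when (allF (λ i → f (suc i) == τ i)) x)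
      ≈⟨ ∑-maps-single n m (f ∘ suc) x ⟩
    x ∎

  module _ {n : ℕ} (L : Fin (suc n) → Fin (suc n) → Carrier) where

    open Walk R Finₚ._≟_ (allFin (suc n)) L
      (λ u α → when (none α (allFin (suc n))) (L u zero)) using (walk; walk-zero; walk-step)

    orbitProd : (Fin (suc n) → Fin (suc n)) → Fin (suc n) → ℕ → Carrier
    orbitProd τ u zero = 1#
    orbitProd τ u (suc k) = L u (τ u) * orbitProd τ (τ u) k

    -- For k = n and all vertices but `zero` alive this is `isNCycle` (see `isNCycle-≡`), in a form
    -- that unfolds in step with `walk`.
    closes : (Fin (suc n) → Fin (suc n)) → ℕ → Fin (suc n) → (Fin (suc n) → Bool) → Bool
    closes τ zero u α = τ u == zero
    closes τ (suc k) u α = α (τ u) ∧ closes τ k (τ u) (α ∖ τ u)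

    _[_≔_] : (Fin (suc n) → Fin (suc n)) → Fin (suc n) → Fin (suc n) → Fin (suc n) → Fin (suc n)
    (f [ u ≔ v ]) x = if u == x then v else f x

    [≔]-same : ∀ f u v → (f [ u ≔ v ]) u ≡ v
    [≔]-same f u v rewrite ==-refl u = ≡.refl

    [≔]-other : ∀ f u v {x} → x ≢ u → (f [ u ≔ v ]) x ≡ f x
    [≔]-other f u v x≢u rewrite ==-≢ (x≢u ∘ ≡.sym) = ≡.refl

    -- Prescribes `τ` at the vertices that have been left already; its values at the alive vertices
    -- and at the current vertex `u` are still free.
    agreesAt : (Fin (suc n) → Fin (suc n)) → (Fin (suc n) → Bool) → Fin (suc n) → (Fin (suc n) → Fin (suc n)) →
      Fin (suc n) → Bool
    agreesAt f α u τ x = α x ∨ u == x ∨ f x == τ x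

    agrees : (Fin (suc n) → Fin (suc n)) → (Fin (suc n) → Bool) → Fin (suc n) → (Fin (suc n) → Fin (suc n)) → Bool
    agrees f α u τ = allF (agreesAt f α u τ)

    agrees⁻ : ∀ f α u τ → agrees f α u τ ≡ true → ∀ x → α x ≡ false → x ≢ u → f x ≡ τ x
    agrees⁻ f α u τ e x αx x≢u with allF⁻ (agreesAt f α u τ) e x
    ... | e' rewrite αx | ==-≢ (x≢u ∘ ≡.sym) = ==⇒≡ e'

    agrees⁺ : ∀ f α u τ → (∀ x → α x ≡ false → x ≢ u → f x ≡ τ x) → agrees f α u τ ≡ true
    agrees⁺ f α u τ h = allF⁺ (agreesAt f α u τ) go
      where
      go : ∀ x → (α x ∨ u == x ∨ f x == τ x) ≡ true
      go x with α x in αx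
      ... | true = ≡.refl
      ... | false with u Finₚ.≟ x
      ...   | yes _ = ≡.refl
      ...   | no u≢x = ≡.trans (≡.cong (_== τ x) (h x αx (u≢x ∘ ≡.sym))) (==-refl (τ x))

    -- Choosing τ u = v makes `u` a vertex with prescribed value and `v` the current one.
    agrees-step : ∀ f α u v τ → α u ≡ false → α v ≡ true →
      ((τ u == v) ∧ agrees f α u τ) ≡ agrees (f [ u ≔ v ]) (α ∖ v) v τ
    agrees-step f α u v τ αu αv = bool-≡ to from
      where
      u≢v : u ≢ v
      u≢v = alive-≢ α αv αu ∘ ≡.sym
      to : ((τ u == v) ∧ agrees f α u τ) ≡ true → agrees (f [ u ≔ v ]) (α ∖ v) v τ ≡ true
      to e = agrees⁺ _ (α ∖ v) v τ go
        where
        go : ∀ x → (α ∖ v) x ≡ false → x ≢ v → (f [ u ≔ v ]) x ≡ τ x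
        go x αx x≢v with x Finₚ.≟ u
        ... | yes ≡.refl = ≡.trans ([≔]-same f u v) (≡.sym (==⇒≡ (proj₁ (∧-true e))))
        ... | no x≢u = ≡.trans ([≔]-other f u v x≢u)
                (agrees⁻ f α u τ (proj₂ (∧-true {τ u == v} e)) x (≡.trans (≡.sym (∖-other α x≢v)) αx) x≢u)
      from : agrees (f [ u ≔ v ]) (α ∖ v) v τ ≡ true → ((τ u == v) ∧ agrees f α u τ) ≡ true
      from e = ≡.cong₂ _∧_
        (≡.trans (≡.cong (_== v) (≡.trans (≡.sym (val u (∖-false α v αu) u≢v)) ([≔]-same f u v))) (==-refl v))
        (agrees⁺ f α u τ λ x αx x≢u → ≡.trans (≡.sym ([≔]-other f u v x≢u))
          (val x (∖-false α v αx) (λ { ≡.refl → false≢true (≡.trans (≡.sym αx) αv) })))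
        where
        val = agrees⁻ _ (α ∖ v) v τ e

    -- Summing over the values of τ one at a time along the orbit: f fixes τ off the alive vertices and u.
    ∑-orbits : ∀ k u α f → count α (allFin (suc n)) ≡ k → α u ≡ false →
      ∑ (allMaps (suc n) (suc n)) (λ τ → when (closes τ k u α ∧ agrees f α u τ) (orbitProd τ u (suc k)))
        ≈ walk k u α
    ∑-orbits zero u α f ct αu = begin
      ∑ maps (λ τ → when ((τ u == zero) ∧ agrees f α u τ) (L u (τ u) * 1#))
        ≈⟨ ∑-cong maps (λ τ → trans (when-cong ((τ u == zero) ∧ agrees f α u τ) (λ e →
             trans (*-identityʳ _) (reflexive (≡.cong (L u) (==⇒≡ (proj₁ (∧-true e)))))))
             (reflexive (≡.cong (λ b → when b (L u zero)) (bool-≡ (to τ) (from τ))))) ⟩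
      ∑ maps (λ τ → when (allF (λ i → (f [ u ≔ zero ]) i == τ i)) (L u zero))
        ≈⟨ ∑-maps-single (suc n) (suc n) (f [ u ≔ zero ]) (L u zero) ⟩
      L u zero
        ≈⟨ reflexive (≡.cong (λ b → when b (L u zero)) (count-none (allFin (suc n)) ct)) ⟨
      when (none α (allFin (suc n))) (L u zero) ≈⟨ reflexive (walk-zero u α) ⟨
      walk zero u α ∎
      where
      maps = allMaps (suc n) (suc n)
      to : ∀ τ → ((τ u == zero) ∧ agrees f α u τ) ≡ true → allF (λ i → (f [ u ≔ zero ]) i == τ i) ≡ true
      to τ e = allF⁺ (λ i → (f [ u ≔ zero ]) i == τ i) λ x → ≡.trans (≡.cong (_== τ x) (go x)) (==-refl (τ x))
        where
        go : ∀ x → (f [ u ≔ zero ]) x ≡ τ x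
        go x with x Finₚ.≟ u
        ... | yes ≡.refl = ≡.trans ([≔]-same f u zero) (≡.sym (==⇒≡ (proj₁ (∧-true e))))
        ... | no x≢u = ≡.trans ([≔]-other f u zero x≢u)
                (agrees⁻ f α u τ (proj₂ (∧-true {τ u == zero} e)) x (count-dead ct (∈-allFin x)) x≢u)
      from : ∀ τ → allF (λ i → (f [ u ≔ zero ]) i == τ i) ≡ true → ((τ u == zero) ∧ agrees f α u τ) ≡ true
      from τ e = ≡.cong₂ _∧_
        (≡.trans (≡.cong (_== zero) (≡.trans (≡.sym (val u)) ([≔]-same f u zero))) (==-refl {suc n} zero))
        (agrees⁺ f α u τ λ x αx x≢u → ≡.trans (≡.sym ([≔]-other f u zero x≢u)) (val x))
        where
        val : ∀ x → (f [ u ≔ zero ]) x ≡ τ x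
        val x = ==⇒≡ (allF⁻ (λ i → (f [ u ≔ zero ]) i == τ i) e x)
    ∑-orbits (suc k) u α f ct αu = begin
      ∑ maps (λ τ → when (closes τ (suc k) u α ∧ agrees f α u τ) (L u (τ u) * orbitProd τ (τ u) (suc k)))
        -- The value of `τ` at `u` becomes a summation variable `v`, so that `v` can be summed
        -- outside and the remaining values of `τ` inside.
        ≈⟨ ∑-cong maps (λ τ → ∑-δ (τ u) (λ v → when ((α v ∧ closes τ k v (α ∖ v)) ∧ agrees f α u τ)
             (L u v * orbitProd τ v (suc k)))) ⟨
      ∑ maps (λ τ → ∑ (allFin (suc n)) (λ v → when (τ u == v)
        (when ((α v ∧ closes τ k v (α ∖ v)) ∧ agrees f α u τ) (L u v * orbitProd τ v (suc k)))))
        ≈⟨ ∑-cong maps (λ τ → ∑-cong (allFin (suc n)) (λ v → step τ v)) ⟩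
      ∑ maps (λ τ → ∑ (allFin (suc n)) (λ v → when (α v) (L u v *
        when (closes τ k v (α ∖ v) ∧ agrees (f [ u ≔ v ]) (α ∖ v) v τ) (orbitProd τ v (suc k)))))
        ≈⟨ ∑-swap maps (allFin (suc n)) _ ⟩
      ∑ (allFin (suc n)) (λ v → ∑ maps (λ τ → when (α v) (L u v *
        when (closes τ k v (α ∖ v) ∧ agrees (f [ u ≔ v ]) (α ∖ v) v τ) (orbitProd τ v (suc k)))))
        ≈⟨ ∑-cong (allFin (suc n)) (λ v → trans (sym (∑-when (α v) maps _)) (when-cong (α v) (λ αv →
             trans (sym (∑-*ˡ (L u v) maps _)) (*-congˡ (∑-orbits k v (α ∖ v) (f [ u ≔ v ])
               (ℕₚ.suc-injective (≡.trans (≡.sym (count-∖ {α = α} (Uniqueₚ.allFin⁺ (suc n)) (∈-allFin v) αv)) ct)) (∖-self α v)))))) ⟩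
      ∑ (allFin (suc n)) (λ v → when (α v) (L u v * walk k v (α ∖ v)))
        ≈⟨ trans (reflexive (walk-step k u α))
             (+-zeroʳ (reflexive (≡.cong (λ b → when b (L u zero)) (some-alive (allFin (suc n)) ct)))) ⟨
      walk (suc k) u α ∎
      where
      maps = allMaps (suc n) (suc n)
      some-alive : ∀ xs → count α xs ≡ suc k → none α xs ≡ false
      some-alive (x ∷ xs) e with α x
      ... | true = ≡.refl
      ... | false = some-alive xs e
      step : ∀ τ v → when (τ u == v)
          (when ((α v ∧ closes τ k v (α ∖ v)) ∧ agrees f α u τ) (L u v * orbitProd τ v (suc k)))
        ≈ when (α v) (L u v *
          when (closes τ k v (α ∖ v) ∧ agrees (f [ u ≔ v ]) (α ∖ v) v τ) (orbitProd τ v (suc k)))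
      step τ v with α v in αv
      ... | false = when-0 (τ u == v) refl
      ... | true rewrite ≡.sym (agrees-step f α u v τ αu αv) with τ u == v | closes τ k v (α ∖ v)
      ...   | true | true = sym (when-*ˡ (agrees f α u τ) (L u v) _)
      ...   | true | false = sym (zeroʳ _)
      ...   | false | true = sym (zeroʳ _)
      ...   | false | false = sym (zeroʳ _)

  aliveAll : ∀ {n} → (Fin n → Bool) → List (Fin n) → Bool
  aliveAll α [] = true
  aliveAll α (x ∷ xs) = α x ∧ aliveAll α xs

  -- Distinctness tested by successive removal, as `closes` does it; the link to `distinct` is
  -- `aliveDistinct-≡`.
  aliveDistinct : ∀ {n} → (Fin n → Bool) → List (Fin n) → Bool
  aliveDistinct α [] = true
  aliveDistinct α (x ∷ xs) = α x ∧ aliveDistinct (α ∖ x) xs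

  aliveAll-∖ : ∀ {n} (α : Fin n → Bool) x xs → aliveAll (α ∖ x) xs ≡ (aliveAll α xs ∧ not (anyEq x xs))
  aliveAll-∖ α x [] = ≡.refl
  aliveAll-∖ α x (y ∷ ys) rewrite aliveAll-∖ α x ys | ∖-def α x y with x Finₚ.≟ y
  ... | yes ≡.refl rewrite ==-refl y | 𝔹ₚ.∧-zeroʳ (α y) = ≡.sym (𝔹ₚ.∧-zeroʳ _)
  ... | no x≢y rewrite ==-≢ (x≢y ∘ ≡.sym) | 𝔹ₚ.∧-identityʳ (α y) = ≡.sym (𝔹ₚ.∧-assoc (α y) _ _)

  aliveDistinct-≡ : ∀ {n} (α : Fin n → Bool) xs → aliveDistinct α xs ≡ (aliveAll α xs ∧ distinct xs)
  aliveDistinct-≡ α [] = ≡.refl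
  aliveDistinct-≡ α (x ∷ xs)
    rewrite aliveDistinct-≡ (α ∖ x) xs | aliveAll-∖ α x xs with α x | aliveAll α xs
  ... | false | _ = ≡.refl
  ... | true | false = ≡.refl
  ... | true | true = ≡.refl

  aliveAll-allAlive : ∀ {n} (xs : List (Fin n)) → aliveAll allAlive xs ≡ true
  aliveAll-allAlive [] = ≡.refl
  aliveAll-allAlive (x ∷ xs) = aliveAll-allAlive xs

  iter-shift : ∀ {m} (τ : Fin m → Fin m) j x → iter τ (suc j) x ≡ iter τ j (τ x)
  iter-shift τ zero x = ≡.refl
  iter-shift τ (suc j) x = ≡.cong τ (iter-shift τ j x)

  module _ {n : ℕ} (L : Fin (suc n) → Fin (suc n) → Carrier) where

    -- The orbit is given by an arbitrary enumeration `f`, because `applyUpTo` recurses with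
    -- `f ∘ suc`.
    closes-≡ : ∀ τ k u α (f : ℕ → Fin (suc n)) → (∀ j → f j ≡ iter τ j (τ u)) →
      closes L τ k u α ≡ (aliveDistinct α (applyUpTo f k) ∧ (f k == zero))
    closes-≡ τ zero u α f h = ≡.cong (_== zero) (≡.sym (h 0))
    closes-≡ τ (suc k) u α f h
      rewrite closes-≡ τ k (τ u) (α ∖ τ u) (f ∘ suc) (λ j → ≡.trans (h (suc j)) (iter-shift τ j (τ u)))
            | h 0 = ≡.sym (𝔹ₚ.∧-assoc (α (τ u)) _ _)

  isNCycle-≡ : ∀ {n} (L : Fin (suc n) → Fin (suc n) → Carrier) τ →
    isNCycle τ ≡ closes L τ n zero (allAlive ∖ zero)
  isNCycle-≡ {n} L τ = ≡.sym (≡.trans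
    (closes-≡ L τ n zero (allAlive ∖ zero) (λ j → iter τ (suc j) zero) (λ j → iter-shift τ j zero))
    (≡.cong (_∧ (iter τ (suc n) zero == zero)) (≡.trans
      (≡.trans (aliveDistinct-≡ allAlive (applyUpTo (λ j → iter τ j zero) (suc n)))
         (≡.cong (_∧ distinct (applyUpTo (λ j → iter τ j zero) (suc n)))
           (aliveAll-allAlive (applyUpTo (λ j → iter τ j zero) (suc n)))))
      (≡.cong distinct (≡.sym (Listₚ.map-upTo (λ j → iter τ j zero) (suc n)))))))

  count-allAlive : ∀ {m} (xs : List (Fin m)) → count allAlive xs ≡ length xs
  count-allAlive [] = ≡.refl
  count-allAlive (x ∷ xs) = ≡.cong suc (count-allAlive xs)

  ∑-cycles : ∀ n (L : Fin (suc n) → Fin (suc n) → Carrier) →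
    ∑ (allMaps (suc n) (suc n)) (λ τ → when (isNCycle τ) (orbitProd L τ zero (suc n))) ≈
      Walk.walk R Finₚ._≟_ (allFin (suc n)) L
        (λ u α → when (none α (allFin (suc n))) (L u zero)) n zero (allAlive ∖ zero)
  ∑-cycles n L = trans (∑-cong (allMaps (suc n) (suc n)) (λ τ → when-≡ (cond τ) refl))
      -- The identity is a placeholder: every vertex except the current one is alive, so no value of
      -- `τ` is prescribed yet.
      (∑-orbits L n zero (allAlive ∖ zero) (λ i → i) ct (∖-self allAlive zero))
    where
    ct : count (allAlive ∖ zero) (allFin (suc n)) ≡ n
    ct = ℕₚ.suc-injective (≡.trans (≡.sym (count-∖ {α = allAlive} (Uniqueₚ.allFin⁺ (suc n)) (∈-allFin zero) ≡.refl))
      (≡.trans (count-allAlive (allFin (suc n))) (Listₚ.length-tabulate {n = suc n} (λ i → i))))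
    cond : ∀ τ → isNCycle τ ≡ (closes L τ n zero (allAlive ∖ zero) ∧ agrees L (λ i → i) (allAlive ∖ zero) zero τ)
    cond τ = ≡.trans (isNCycle-≡ L τ) (≡.trans (≡.sym (𝔹ₚ.∧-identityʳ _)) (≡.cong (closes L τ n zero (allAlive ∖ zero) ∧_)
      (≡.sym (agrees⁺ L (λ i → i) (allAlive ∖ zero) zero τ λ x αx x≢0 →
        ⊥-elim (false≢true (≡.trans (≡.sym αx) (∖-other allAlive x≢0)))))))

module HamSum {c ℓ : Level} (F : CommutativeRing c ℓ) where
  open NC F
  open PolyAlg F
  open Semiring polySemiring hiding (zero)
  open Sums polySemiring
  open CycleSum F polySemiring
  open import Relation.Binary.Reasoning.Setoid setoid

  subst-orbit : ∀ {n} σ τ k (u : Fin (suc n)) (f : ℕ → Fin (suc n)) → (∀ j → f j ≡ iter τ j u) →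
    subst σ (prodP (applyUpTo (λ j → varP (xIdx (f j) (f (suc j)))) k)) ≈ orbitProd (λ i j → atom (σ (xIdx i j))) τ u k
  subst-orbit σ τ zero u f h = subst-const σ _
  subst-orbit σ τ (suc k) u f h = trans (subst-* σ (varP (xIdx (f 0) (f 1))) (prodP (applyUpTo (λ j → varP (xIdx (f (suc j)) (f (suc (suc j))))) k)))
    (*-cong (trans (subst-var σ (xIdx (f 0) (f 1))) (reflexive (≡.cong₂ (λ i j → atom (σ (xIdx i j))) (h 0) (h 1))))
      (subst-orbit σ τ k (τ u) (f ∘ suc) (λ j → ≡.trans (h (suc j)) (iter-shift τ j u))))

  subst-HC : ∀ n σ → let L = λ i j → atom (σ (xIdx {suc n} i j)) in
    subst σ (HC (suc n)) ≈
      Walk.walk polySemiring Finₚ._≟_ (allFin (suc n)) L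
        (λ u α → when (FinAlive.none α (allFin (suc n))) (L u zero)) n zero (FinAlive._∖_ allAlive zero)
  subst-HC n σ = begin
    subst σ (HC (suc n)) ≈⟨ reflexive (≡.cong (subst σ) (sumP-map cycleMonomial (filterᵇ isNCycle maps))) ⟩
    subst σ (∑ (filterᵇ isNCycle maps) cycleMonomial) ≈⟨ subst-cong σ (∑-filter isNCycle maps cycleMonomial) ⟩
    subst σ (∑ maps (λ τ → when (isNCycle τ) (cycleMonomial τ)))
      ≈⟨ reflexive (subst-∑ σ maps (λ τ → when (isNCycle τ) (cycleMonomial τ))) ⟩
    ∑ maps (λ τ → subst σ (when (isNCycle τ) (cycleMonomial τ))) ≈⟨ ∑-cong maps monomial ⟩
    ∑ maps (λ τ → when (isNCycle τ) (orbitProd L τ zero (suc n))) ≈⟨ ∑-cycles n L ⟩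
    Walk.walk polySemiring Finₚ._≟_ (allFin (suc n)) L
        (λ u α → when (FinAlive.none α (allFin (suc n))) (L u zero)) n zero (FinAlive._∖_ allAlive zero) ∎
    where
    L : Fin (suc n) → Fin (suc n) → Carrier
    L i j = atom (σ (xIdx i j))
    maps = allMaps (suc n) (suc n)
    edge : (Fin (suc n) → Fin (suc n)) → ℕ → Poly
    edge τ k = varP (xIdx (iter τ k zero) (iter τ (suc k) zero))
    monomial : ∀ τ → subst σ (when (isNCycle τ) (cycleMonomial τ)) ≈ when (isNCycle τ) (orbitProd L τ zero (suc n))
    monomial τ = trans (reflexive (subst-when σ (isNCycle τ) (cycleMonomial τ))) (when-cong (isNCycle τ) (λ _ →
      trans (reflexive (≡.cong (λ ps → subst σ (prodP ps)) (Listₚ.map-upTo (edge τ) (suc n))))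
        (subst-orbit σ τ (suc n) zero (λ j → iter τ j zero) (λ j → ≡.refl))))

-- From walks with local constraints to Hamiltonian cycles

module Gadget where
  -- A node v becomes the bidirected path tip false v ↔ mid v ↔ tip true v, which a Hamiltonian cycle traverses
  -- in one of its two directions: forwards if the simulated walk visits v, backwards in the final clean-up.
  -- The clean-up runs through the groups of two nodes, and between the separators sep g and sep (g + 1)
  -- it can be completed only if the pair of unvisited nodes of the group g satisfies the relation ρ g.
  module Vertices (G : ℕ) where

    Node : Set
    Node = Fin G × Bool

    _≟N_ : DecidableEquality Node
    _≟N_ = ×-≡-dec Finₚ._≟_ 𝔹ₚ._≟_

    data Vtx : Set where
      start : Vtx
      sep   : Fin (suc G) → Vtx
      mid   : Node → Vtx
      tip   : Bool → Node → Vtx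

    sep-injective : ∀ {i j} → sep i ≡ sep j → i ≡ j
    sep-injective ≡.refl = ≡.refl

    mid-injective : ∀ {v w} → mid v ≡ mid w → v ≡ w
    mid-injective ≡.refl = ≡.refl

    tip-injective : ∀ {d e v w} → tip d v ≡ tip e w → d ≡ e × v ≡ w
    tip-injective ≡.refl = ≡.refl , ≡.refl

    _≟V_ : DecidableEquality Vtx
    start ≟V start = yes ≡.refl
    start ≟V sep _ = no λ ()
    start ≟V mid _ = no λ ()
    start ≟V tip _ _ = no λ ()
    sep _ ≟V start = no λ ()
    sep i ≟V sep j = map′ (≡.cong sep) sep-injective (i Finₚ.≟ j)
    sep _ ≟V mid _ = no λ ()
    sep _ ≟V tip _ _ = no λ ()
    mid _ ≟V start = no λ ()
    mid _ ≟V sep _ = no λ ()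
    mid v ≟V mid w = map′ (≡.cong mid) mid-injective (v ≟N w)
    mid _ ≟V tip _ _ = no λ ()
    tip _ _ ≟V start = no λ ()
    tip _ _ ≟V sep _ = no λ ()
    tip _ _ ≟V mid _ = no λ ()
    tip d v ≟V tip e w = map′ (λ { ≡.refl → ≡.refl }) (λ { ≡.refl → ≡.refl }) (×-≡-dec 𝔹ₚ._≟_ _≟N_ (d , v) (e , w))

    nodes : List Node
    nodes = cartesianProduct (allFin G) bools

    seps mids tipsF tipsT inner vertices : List Vtx
    seps = map sep (allFin (suc G))
    mids = map mid nodes
    tipsF = map (tip false) nodes
    tipsT = map (tip true) nodes
    inner = seps ++ (mids ++ (tipsF ++ tipsT))
    vertices = start ∷ inner

    nodes-! : Unique nodes
    nodes-! = Uniqueₚ.cartesianProduct⁺ (Uniqueₚ.allFin⁺ G) bools-!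

    ∈-nodes : ∀ v → v ∈ nodes
    ∈-nodes (g , b) = ∈-cartesianProduct⁺ (∈-allFin g) (∈-bools b)

    inner-! : Unique inner
    inner-! = Uniqueₚ.++⁺ (Uniqueₚ.map⁺ sep-injective (Uniqueₚ.allFin⁺ (suc G)))
      (Uniqueₚ.++⁺ (Uniqueₚ.map⁺ mid-injective nodes-!)
        (Uniqueₚ.++⁺ (Uniqueₚ.map⁺ (proj₂ ∘ tip-injective) nodes-!) (Uniqueₚ.map⁺ (proj₂ ∘ tip-injective) nodes-!)
          (λ (p , q) → tF≢tT p q))
        (λ (p , q) → m≢t p q))
      (λ (p , q) → s≢r p q)
      where
      tF≢tT : ∀ {x} → x ∈ tipsF → ¬ x ∈ tipsT
      tF≢tT p q with ∈-map⁻ (tip false) p | ∈-map⁻ (tip true) q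
      ... | _ , _ , ≡.refl | _ , _ , ()
      m≢t : ∀ {x} → x ∈ mids → ¬ x ∈ (tipsF ++ tipsT)
      m≢t p q with ∈-map⁻ mid p | ∈-++⁻ tipsF q
      ... | _ , _ , ≡.refl | inj₁ r with ∈-map⁻ (tip false) r
      ...   | _ , _ , ()
      m≢t p q | _ , _ , ≡.refl | inj₂ r with ∈-map⁻ (tip true) r
      ...   | _ , _ , ()
      s≢r : ∀ {x} → x ∈ seps → ¬ x ∈ (mids ++ (tipsF ++ tipsT))
      s≢r p q with ∈-map⁻ sep p | ∈-++⁻ mids q
      ... | _ , _ , ≡.refl | inj₁ r with ∈-map⁻ mid r
      ...   | _ , _ , ()
      s≢r p q | _ , _ , ≡.refl | inj₂ r with ∈-++⁻ tipsF r
      ... | inj₁ t with ∈-map⁻ (tip false) t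
      ...   | _ , _ , ()
      s≢r p q | _ , _ , ≡.refl | inj₂ r | inj₂ t with ∈-map⁻ (tip true) t
      ...   | _ , _ , ()

    ∈-inner-sep : ∀ i → sep i ∈ inner
    ∈-inner-sep i = ∈-++⁺ˡ (∈-map⁺ sep (∈-allFin i))

    ∈-inner-mid : ∀ v → mid v ∈ inner
    ∈-inner-mid v = ∈-++⁺ʳ seps (∈-++⁺ˡ (∈-map⁺ mid (∈-nodes v)))

    ∈-inner-tip : ∀ d v → tip d v ∈ inner
    ∈-inner-tip false v = ∈-++⁺ʳ seps (∈-++⁺ʳ mids (∈-++⁺ˡ (∈-map⁺ (tip false) (∈-nodes v))))
    ∈-inner-tip true v = ∈-++⁺ʳ seps (∈-++⁺ʳ mids (∈-++⁺ʳ tipsF (∈-map⁺ (tip true) (∈-nodes v))))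

    ∈-vertices : ∀ x → x ∈ vertices
    ∈-vertices start = here ≡.refl
    ∈-vertices (sep i) = there (∈-inner-sep i)
    ∈-vertices (mid v) = there (∈-inner-mid v)
    ∈-vertices (tip d v) = there (∈-inner-tip d v)

    vertices-! : Unique vertices
    vertices-! = All.tabulate (λ p → start∉ p) ∷ inner-!
      where
      start∉ : ∀ {x} → x ∈ inner → start ≢ x
      start∉ p ≡.refl with ∈-++⁻ seps p
      ... | inj₁ q with ∈-map⁻ sep q
      ...   | _ , _ , ()
      start∉ p ≡.refl | inj₂ q with ∈-++⁻ mids q
      ... | inj₁ r with ∈-map⁻ mid r
      ...   | _ , _ , ()
      start∉ p ≡.refl | inj₂ q | inj₂ r with ∈-++⁻ tipsF r
      ... | inj₁ t with ∈-map⁻ (tip false) t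
      ...   | _ , _ , ()
      start∉ p ≡.refl | inj₂ q | inj₂ r | inj₂ t with ∈-map⁻ (tip true) t
      ...   | _ , _ , ()

    length-nodes : length nodes ≡ G ℕ.* 2
    length-nodes = ≡.trans (length-cartesianProduct (allFin G) bools) (≡.cong (ℕ._* 2) (length-allFin G))

    length-inner : length inner ≡ suc G ℕ.+ (G ℕ.* 2 ℕ.+ (G ℕ.* 2 ℕ.+ G ℕ.* 2))
    length-inner = ≡.trans (Listₚ.length-++ seps) (≡.cong₂ ℕ._+_
      (≡.trans (Listₚ.length-map sep (allFin (suc G))) (length-allFin (suc G)))
      (≡.trans (Listₚ.length-++ mids) (≡.cong₂ ℕ._+_ (same mid)
        (≡.trans (Listₚ.length-++ tipsF) (≡.cong₂ ℕ._+_ (same (tip false)) (same (tip true)))))))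
      where
      same : ∀ (f : Node → Vtx) → length (map f nodes) ≡ G ℕ.* 2
      same f = ≡.trans (Listₚ.length-map f nodes) length-nodes

    open Alive _≟N_ public using () renaming (_==_ to _==N_)
    module AN = Alive _≟N_
    module AV = Alive _≟V_

    -- Labels are kept as data, so that they can be read off as substitutions by variables and constants.
    module Edges {a} {A : Set a} (𝟘 𝟙 : A) (λ₀ : Node → A) (lab : Node → Node → A) (fin : Node → A)
      (ρ : Fin G → Bool → Bool → Bool) where

      if1 : Bool → A
      if1 b = if b then 𝟙 else 𝟘

      -- The arguments of `ρ g` tell whether the two nodes of the group are still unvisited. For
      -- each of the four pairs there is one route from `sep` number g to the next separator, and
      -- the test of `ρ` sits on an edge that no other route uses: the direct edge for none, the
      -- first edge for the second node alone, the last edge for the first node alone, and the edge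
      -- between the nodes for both.
      edge : Vtx → Vtx → A
      edge start (tip false v) = λ₀ v
      edge (tip d v) (mid w) = if1 (v ==N w)
      edge (mid v) (tip d w) = if1 (v ==N w)
      edge (tip true v) (tip false w) = lab v w
      edge (tip true v) (sep zero) = fin v
      edge (sep i) (tip true (g , b)) = if1 ((toℕ i ℕ.≡ᵇ toℕ g) ∧ (not b ∨ ρ g false true))
      edge (sep i) (sep (suc g)) = if1 ((toℕ i ℕ.≡ᵇ toℕ g) ∧ ρ g false false)
      edge (sep i) start = if1 (toℕ i ℕ.≡ᵇ G)
      edge (tip false (g , false)) (tip true (h , true)) = if1 ((toℕ g ℕ.≡ᵇ toℕ h) ∧ ρ g true true)
      edge (tip false (g , false)) (sep (suc h)) = if1 ((toℕ g ℕ.≡ᵇ toℕ h) ∧ ρ g true false)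
      edge (tip false (g , true)) (sep (suc h)) = if1 (toℕ g ℕ.≡ᵇ toℕ h)
      edge _ _ = 𝟘

  module Simulation {c ℓ : Level} (R : Semiring c ℓ) (G : ℕ)
    {a : Level} {A : Set a} (𝟘 𝟙 : A) (⟦_⟧ : A → Semiring.Carrier R)
    (⟦𝟘⟧ : Semiring._≈_ R ⟦ 𝟘 ⟧ (Semiring.0# R)) (⟦𝟙⟧ : Semiring._≈_ R ⟦ 𝟙 ⟧ (Semiring.1# R))
    (λ₀ : Vertices.Node G → A) (lab : Vertices.Node G → Vertices.Node G → A) (fin : Vertices.Node G → A)
    (ρ : Fin G → Bool → Bool → Bool) where
    open Vertices G
    open Semiring R hiding (zero)
    open Sums R
    open Edges 𝟘 𝟙 λ₀ lab fin ρ
    open import Relation.Binary.Reasoning.Setoid setoid hiding (start)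

    E : Vtx → Vtx → Carrier
    E u v = ⟦ edge u v ⟧

    endV : Vtx → (Vtx → Bool) → Carrier
    endV u α = when (AV.none α vertices) (E u start)

    open Walk R _≟V_ vertices E endV
    open AV using (_∖_)

    E-if1 : ∀ b → ⟦ if1 b ⟧ ≈ when b 1#
    E-if1 true = ⟦𝟙⟧
    E-if1 false = ⟦𝟘⟧

    endV-cong : ∀ u {α β} → α ≗ β → endV u α ≈ endV u β
    endV-cong u e = when-≡ (AV.none-cong vertices e) refl

    endV-alive : ∀ u α w → α w ≡ true → endV u α ≈ 0#
    endV-alive u α w αw = reflexive (≡.cong (λ b → when b (E u start)) (AV.none-false {α} (∈-vertices w) αw))

    endV-0 : ∀ u α → E u start ≈ 0# → endV u α ≈ 0#
    endV-0 u α e = when-0 (AV.none α vertices) e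

    walk-≗ : ∀ n u {α β} → α ≗ β → walk n u α ≈ walk n u β
    walk-≗ = walk-cong endV-cong

    opaque
      unfolding walk
      forced : ∀ n u α w → α w ≡ true → (∀ v → v ≢ w → α v ≡ true → E u v * walk n v (α ∖ v) ≈ 0#) →
        walk (suc n) u α ≈ E u w * walk n w (α ∖ w)
      forced n u α w αw z = trans (+-zeroʳ (endV-alive u α w αw))
        (trans (∑-single _ vertices-! (∈-vertices w) (λ {v} v≢w →
            trans (when-cong (α v) (z v v≢w)) (when-0 (α v) refl)))
          (reflexive (≡.cong (λ b → when b (E u w * walk n w (α ∖ w))) αw)))

    E-mid : ∀ w x → (∀ d → x ≢ tip d w) → E (mid w) x ≈ 0#
    E-mid w start x≢ = ⟦𝟘⟧
    E-mid w (sep i) x≢ = ⟦𝟘⟧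
    E-mid w (mid v) x≢ = ⟦𝟘⟧
    E-mid w (tip d v) x≢ = trans (E-if1 (w ==N v)) (reflexive (≡.cong (λ b → when b 1#)
      (AN.==-≢ (λ w≡v → x≢ d (≡.cong (tip d) (≡.sym w≡v))))))

    E-to-mid : ∀ w x → (∀ d → x ≢ tip d w) → E x (mid w) ≈ 0#
    E-to-mid w start x≢ = ⟦𝟘⟧
    E-to-mid w (sep i) x≢ = ⟦𝟘⟧
    E-to-mid w (mid v) x≢ = ⟦𝟘⟧
    E-to-mid w (tip d v) x≢ = trans (E-if1 (v ==N w)) (reflexive (≡.cong (λ b → when b 1#)
      (AN.==-≢ (λ v≡w → x≢ d (≡.cong (tip d) v≡w)))))

    opaque
      unfolding walk
      stuck : ∀ n w α → (∀ d → α (tip d w) ≡ false) → walk n (mid w) α ≈ 0#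
      stuck zero w α dead = endV-0 (mid w) α ⟦𝟘⟧
      stuck (suc n) w α dead = trans (+-zeroʳ (endV-0 (mid w) α ⟦𝟘⟧)) (∑-0 vertices (λ x →
        trans (when-cong (α x) (λ αx → *-zeroˡ (E-mid w x (λ d e → AV.alive-≢ α αx (dead d) e)))) (when-0 (α x) refl)))

      -- An unvisited mid w whose neighbour tip d w is lost cannot be passed through any more.
      trap : ∀ n u α d w → α (mid w) ≡ true → α (tip d w) ≡ false → α u ≡ false → u ≢ tip d w → walk n u α ≈ 0#
      trap zero u α d w αm αd αu u≢ = endV-alive u α (mid w) αm
      trap (suc n) u α d w αm αd αu u≢ = trans (+-zeroʳ (endV-alive u α (mid w) αm)) (∑-0 vertices (λ x →
        trans (when-cong (α x) (step x)) (when-0 (α x) refl)))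
        where
        step : ∀ x → α x ≡ true → E u x * walk n x (α ∖ x) ≈ 0#
        step x αx with x ≟V mid w
        ... | no x≢ = *-zeroʳ (trap n x (α ∖ x) d w
                (≡.trans (AV.∖-other α (x≢ ∘ ≡.sym)) αm) (AV.∖-false α x αd) (AV.∖-self α x) (AV.alive-≢ α αx αd))
        ... | yes ≡.refl with u ≟V tip (not d) w
        ...   | no u≢' = *-zeroˡ (E-to-mid w u (λ e → both e))
          where
          both : ∀ e → u ≢ tip e w
          both e with e 𝔹ₚ.≟ d
          ... | yes ≡.refl = u≢
          ... | no e≢d = λ { ≡.refl → u≢' (≡.cong (λ b → tip b w) (𝔹ₚ.¬-not e≢d)) }
        ...   | yes ≡.refl = *-zeroʳ (stuck n w (α ∖ mid w) dead)
          where
          dead : ∀ e → (α ∖ mid w) (tip e w) ≡ false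
          dead e with e 𝔹ₚ.≟ d
          ... | yes ≡.refl = AV.∖-false α (mid w) αd
          ... | no e≢d = AV.∖-false α (mid w) (≡.subst (λ b → α (tip b w) ≡ false) (≡.sym (𝔹ₚ.¬-not e≢d)) αu)

    -- Between two traversals the three vertices of a path are all alive or all dead. Hence the
    -- unvisited nodes `β` and the number `i` of separators passed describe the whole set.
    state : (Node → Bool) → ℕ → Vtx → Bool
    state β i start = false
    state β i (sep j) = i ≤ᵇ toℕ j
    state β i (mid v) = β v
    state β i (tip d v) = β v

    -- Leaving `tip d w` for any vertex but `mid w` turns `mid w` into a trap, and from `mid w` only
    -- the opposite tip is left. So a path once entered is crossed completely, in either direction
    -- and with label 1.
    through : ∀ n d w β i → β w ≡ true →
      walk (2 ℕ.+ n) (tip d w) (state β i ∖ tip d w) ≈ walk n (tip (not d) w) (state (β AN.∖ w) i)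
    through n d w β i βw = begin
      walk (2 ℕ.+ n) (tip d w) α₁
        ≈⟨ forced (suc n) (tip d w) α₁ (mid w) αm (λ x x≢ αx → *-zeroʳ (trap (suc n) x (α₁ ∖ x) d w
             (≡.trans (AV.∖-other α₁ (x≢ ∘ ≡.sym)) αm) (AV.∖-false α₁ x αd) (AV.∖-self α₁ x) (AV.alive-≢ α₁ αx αd))) ⟩
      E (tip d w) (mid w) * walk (suc n) (mid w) α₂ ≈⟨ *-congˡ (forced n (mid w) α₂ (tip (not d) w) αd' only) ⟩
      E (tip d w) (mid w) * (E (mid w) (tip (not d) w) * walk n (tip (not d) w) (α₂ ∖ tip (not d) w))
        ≈⟨ trans (*-cong one (*-cong one (walk-≗ n (tip (not d) w) final))) (trans (*-identityˡ _) (*-identityˡ _)) ⟩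
      walk n (tip (not d) w) (state (β AN.∖ w) i) ∎
      where
      α₁ = state β i ∖ tip d w
      α₂ = α₁ ∖ mid w
      αm : α₁ (mid w) ≡ true
      αm = ≡.trans (AV.∖-other (state β i) (λ ())) βw
      αd : α₁ (tip d w) ≡ false
      αd = AV.∖-self (state β i) (tip d w)
      not-≢ : ∀ d → not d ≢ d
      not-≢ false ()
      not-≢ true ()
      αd' : α₂ (tip (not d) w) ≡ true
      αd' = ≡.trans (AV.∖-other α₁ (λ ())) (≡.trans (AV.∖-other (state β i) (not-≢ d ∘ proj₁ ∘ tip-injective)) βw)
      one : ⟦ if1 (w ==N w) ⟧ ≈ 1#
      one = trans (E-if1 (w ==N w)) (reflexive (≡.cong (λ b → when b 1#) (AN.==-refl w)))
      only : ∀ x → x ≢ tip (not d) w → α₂ x ≡ true → E (mid w) x * walk n x (α₂ ∖ x) ≈ 0#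
      only x x≢ αx = *-zeroˡ (E-mid w x both)
        where
        both : ∀ e → x ≢ tip e w
        both e x≡ with e 𝔹ₚ.≟ d
        ... | yes ≡.refl = AV.alive-≢ α₂ αx (AV.∖-false α₁ (mid w) αd) x≡
        ... | no e≢d = x≢ (≡.trans x≡ (≡.cong (λ b → tip b w) (𝔹ₚ.¬-not e≢d)))
      final : (α₂ ∖ tip (not d) w) ≗ state (β AN.∖ w) i
      final start = AV.∖-false α₂ (tip (not d) w) (AV.∖-false α₁ (mid w) (AV.∖-false (state β i) (tip d w) ≡.refl))
      final (sep j) = ≡.trans (AV.∖-other α₂ (λ ())) (≡.trans (AV.∖-other α₁ (λ ())) (AV.∖-other (state β i) (λ ())))
      final (mid v) = go (v ≟N w)
        where
        go : Dec (v ≡ w) → (α₂ ∖ tip (not d) w) (mid v) ≡ (β AN.∖ w) v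
        go (yes ≡.refl) = ≡.trans (AV.∖-false α₂ (tip (not d) w) (AV.∖-self α₁ (mid v))) (≡.sym (AN.∖-self β v))
        go (no v≢w) = ≡.trans (AV.∖-other α₂ {tip (not d) w} {mid v} (λ ())) (≡.trans
          (AV.∖-other α₁ {mid w} {mid v} (v≢w ∘ mid-injective)) (≡.trans
          (AV.∖-other (state β i) {tip d w} {mid v} (λ ())) (≡.sym (AN.∖-other β v≢w))))
      final (tip e v) = go (v ≟N w) (e 𝔹ₚ.≟ d)
        where
        go : Dec (v ≡ w) → Dec (e ≡ d) → (α₂ ∖ tip (not d) w) (tip e v) ≡ (β AN.∖ w) v
        go (no v≢w) _ = ≡.trans (AV.∖-other α₂ {tip (not d) w} {tip e v} (v≢w ∘ proj₂ ∘ tip-injective)) (≡.trans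
          (AV.∖-other α₁ {mid w} {tip e v} (λ ())) (≡.trans
          (AV.∖-other (state β i) {tip d w} {tip e v} (v≢w ∘ proj₂ ∘ tip-injective)) (≡.sym (AN.∖-other β v≢w))))
        go (yes ≡.refl) (yes ≡.refl) =
          ≡.trans (AV.∖-false α₂ (tip (not d) w) {tip e v} (AV.∖-false α₁ (mid w) αd)) (≡.sym (AN.∖-self β v))
        go (yes ≡.refl) (no e≢d) = ≡.trans
          (≡.cong (λ b → (α₂ ∖ tip (not d) w) (tip b v)) (𝔹ₚ.¬-not e≢d))
          (≡.trans (AV.∖-self α₂ (tip (not d) w)) (≡.sym (AN.∖-self β v)))

    -- The groups below `i` lie behind the clean-up, so a node left there is lost; the other groups
    -- still have to pass `ρ`.
    okAt : ℕ → (Node → Bool) → Fin G → Bool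
    okAt i β g = if toℕ g <ᵇ i then not (β (g , false)) ∧ not (β (g , true)) else ρ g (β (g , false)) (β (g , true))

    ok : ℕ → (Node → Bool) → Bool
    ok i β = allF (okAt i β)

    <ᵇ-suc : ∀ n → (n <ᵇ suc n) ≡ true
    <ᵇ-suc zero = ≡.refl
    <ᵇ-suc (suc n) = <ᵇ-suc n

    <ᵇ-suc-≢ : ∀ m n → m ≢ n → (m <ᵇ suc n) ≡ (m <ᵇ n)
    <ᵇ-suc-≢ zero zero ne = ⊥-elim (ne ≡.refl)
    <ᵇ-suc-≢ zero (suc n) ne = ≡.refl
    <ᵇ-suc-≢ (suc m) zero ne = ≡.refl
    <ᵇ-suc-≢ (suc m) (suc n) ne = <ᵇ-suc-≢ m n (ne ∘ ≡.cong suc)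

    module Cleaning (g : Fin G) where
      i = toℕ g

      value : (Node → Bool) → Carrier
      value β = when (ok (suc i) β) 1#

      value-dirty : ∀ β b → β (g , b) ≡ true → value β ≈ 0#
      value-dirty β b βb = reflexive (≡.cong (λ x → when x 1#) (≢true λ e → lemma b βb (allF⁻ (okAt (suc i) β) e g)))
        where
        lemma : ∀ b → β (g , b) ≡ true → okAt (suc i) β g ≢ true
        lemma false βb e rewrite <ᵇ-suc i | βb = false≢true e
        lemma true βb e rewrite <ᵇ-suc i | βb = false≢true (≡.trans (≡.sym (𝔹ₚ.∧-zeroʳ _)) e)

      value-clean : ∀ β β' → (∀ h b → h ≢ g → β' (h , b) ≡ β (h , b)) → (∀ b → β' (g , b) ≡ false) →
        when (ρ g (β (g , false)) (β (g , true))) (value β') ≈ when (ok i β) 1#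
      value-clean β β' same clean = trans (reflexive (≡.sym (when-∧ (ρ g (β (g , false)) (β (g , true))) (ok (suc i) β') 1#)))
        (reflexive (≡.cong (λ x → when x 1#) (bool-≡ to from)))
        where
        other : ∀ h → h ≢ g → okAt (suc i) β' h ≡ okAt i β h
        other h h≢g rewrite <ᵇ-suc-≢ (toℕ h) i (h≢g ∘ Finₚ.toℕ-injective) | same h false h≢g | same h true h≢g = ≡.refl
        here-i : okAt i β g ≡ ρ g (β (g , false)) (β (g , true))
        here-i rewrite <ᵇ-irrefl i = ≡.refl
        here-suc : okAt (suc i) β' g ≡ true
        here-suc rewrite <ᵇ-suc i | clean false | clean true = ≡.refl
        to : ρ g (β (g , false)) (β (g , true)) ∧ ok (suc i) β' ≡ true → ok i β ≡ true
        to e = allF⁺ _ go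
          where
          go : ∀ h → okAt i β h ≡ true
          go h with h Finₚ.≟ g
          ... | yes ≡.refl = ≡.trans here-i (proj₁ (∧-true e))
          ... | no h≢g = ≡.trans (≡.sym (other h h≢g)) (allF⁻ _ (proj₂ (∧-true {ρ g (β (g , false)) (β (g , true))} e)) h)
        from : ok i β ≡ true → ρ g (β (g , false)) (β (g , true)) ∧ ok (suc i) β' ≡ true
        from e = ≡.cong₂ _∧_ (≡.trans (≡.sym here-i) (allF⁻ (okAt i β) e g)) (allF⁺ _ go)
          where
          go : ∀ h → okAt (suc i) β' h ≡ true
          go h with h Finₚ.≟ g
          ... | yes ≡.refl = here-suc
          ... | no h≢g = ≡.trans (other h h≢g) (allF⁻ _ e h)

      E-cond : ∀ {m n} b → m ≡ n → ⟦ if1 ((m ℕ.≡ᵇ n) ∧ b) ⟧ ≈ when b 1#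
      E-cond {m} b ≡.refl = trans (E-if1 _) (reflexive (≡.cong (λ x → when (x ∧ b) 1#) (≡ᵇ-refl m)))

      E-cond' : ∀ {m n} b → m ≢ n → ⟦ if1 ((m ℕ.≡ᵇ n) ∧ b) ⟧ ≈ 0#
      E-cond' {m} b m≢n = trans (E-if1 _) (reflexive (≡.cong (λ x → when (x ∧ b) 1#) (≡ᵇ-≢ m≢n)))

      ≢-toℕ : ∀ {h : Fin G} → h ≢ g → i ≢ toℕ h
      ≢-toℕ h≢g e = h≢g (Finₚ.toℕ-injective (≡.sym e))

      next-state : ∀ β → (state β (suc i) ∖ sep (suc g)) ≗ state β (suc (suc i))
      next-state β start = AV.∖-false _ (sep (suc g)) ≡.refl
      next-state β (mid v) = AV.∖-other _ (λ ())
      next-state β (tip d v) = AV.∖-other _ (λ ())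
      next-state β (sep h) with h Finₚ.≟ suc g
      ... | yes ≡.refl = ≡.trans (AV.∖-self _ (sep h)) (≡.sym (<ᵇ-irrefl i))
      ... | no h≢ = ≡.trans (AV.∖-other _ (h≢ ∘ sep-injective)) (step h (h≢ ∘ Finₚ.toℕ-injective))
        where
        step : ∀ (h : Fin (suc G)) → toℕ h ≢ suc i → (suc i ≤ᵇ toℕ h) ≡ (suc (suc i) ≤ᵇ toℕ h)
        step zero ne = ≡.refl
        step (suc h) ne = lemma i (toℕ h) (ne ∘ ≡.cong suc)
          where
          lemma : ∀ i n → n ≢ i → (i <ᵇ suc n) ≡ (i <ᵇ n)
          lemma i n ne = <ᵇ-suc-≢ i n (ne ∘ ≡.sym)

      alive-next : ∀ β → state β (suc i) (sep (suc g)) ≡ true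
      alive-next β = <ᵇ-suc i

      module _ (N₀ : ℕ)
        (rest : ∀ N β → N₀ ≤ N → walk N (sep (suc g)) (state β (suc (suc i))) ≈ value β) where

        to-next : ∀ N β u → N₀ ≤ N →
          when (state β (suc i) (sep (suc g))) (E u (sep (suc g)) * walk N (sep (suc g)) (state β (suc i) ∖ sep (suc g)))
            ≈ E u (sep (suc g)) * value β
        to-next N β u le = trans
          (reflexive (≡.cong (λ b → when b (E u (sep (suc g)) * walk N (sep (suc g)) (state β (suc i) ∖ sep (suc g)))) (alive-next β)))
          (*-congˡ (trans (walk-≗ N (sep (suc g)) (next-state β)) (rest N β le)))

        from-second : ∀ N β → N₀ ≤ N → β (g , true) ≡ false →
          walk (suc N) (tip false (g , true)) (state β (suc i)) ≈ value β
        from-second N β le dead = trans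
          (forced N (tip false (g , true)) (state β (suc i)) (sep (suc g)) (alive-next β) others)
          (trans (*-cong (trans (E-if1 _) (reflexive (≡.cong (λ b → when b 1#) (≡ᵇ-refl i))))
            (trans (walk-≗ N (sep (suc g)) (next-state β)) (rest N β le))) (*-identityˡ _))
          where
          others : ∀ v → v ≢ sep (suc g) → state β (suc i) v ≡ true →
            E (tip false (g , true)) v * walk N v (state β (suc i) ∖ v) ≈ 0#
          others (sep zero) ne al = *-zeroˡ ⟦𝟘⟧
          others (sep (suc h)) ne al = *-zeroˡ (trans (E-if1 _) (reflexive (≡.cong (λ b → when b 1#)
            (≡ᵇ-≢ (≢-toℕ (λ h≡g → ne (≡.cong (sep ∘ suc) h≡g)))))))
          others (mid w) ne al = *-zeroˡ (trans (E-if1 _) (reflexive (≡.cong (λ b → when b 1#)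
            (AN.==-≢ {g , true} {w} (AN.alive-≢ β al dead ∘ ≡.sym)))))
          others (tip false w) ne al = *-zeroˡ ⟦𝟘⟧
          others (tip true w) ne al = *-zeroˡ ⟦𝟘⟧

        via-second : ∀ N β u → N₀ ≤ N →
          when (β (g , true)) (E u (tip true (g , true)) *
            walk (3 ℕ.+ N) (tip true (g , true)) (state β (suc i) ∖ tip true (g , true)))
          ≈ when (β (g , true)) (E u (tip true (g , true)) * value (β AN.∖ (g , true)))
        via-second N β u le = when-cong (β (g , true)) (λ e → *-congˡ (trans
          (through (suc N) true (g , true) β (suc i) e)
          (from-second N (β AN.∖ (g , true)) le (AN.∖-self β (g , true)))))

        from-first : ∀ N β → N₀ ≤ N → β (g , false) ≡ false →
          walk (4 ℕ.+ N) (tip false (g , false)) (state β (suc i)) ≈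
            when (ρ g true false) 1# * value β +
            when (β (g , true)) (when (ρ g true true) 1# * value (β AN.∖ (g , true)))
        from-first N β le dead = begin
          walk (4 ℕ.+ N) u α
            ≈⟨ trans (reflexive (walk-step _ u α)) (+-zeroʳ (endV-alive u α (sep (suc g)) (alive-next β))) ⟩
          ∑ vertices (λ v → when (α v) (E u v * walk (3 ℕ.+ N) v (α ∖ v)))
            ≈⟨ ∑-among _ (sep (suc g) ∷ tip true (g , true) ∷ []) vertices-! (((λ ()) ∷ []) ∷ ([] ∷ [])) (λ {y} _ → ∈-vertices y) others ⟩
          when (α (sep (suc g))) (E u (sep (suc g)) * walk (3 ℕ.+ N) (sep (suc g)) (α ∖ sep (suc g)))
            + (when (β (g , true)) (E u (tip true (g , true)) * walk (3 ℕ.+ N) (tip true (g , true)) (α ∖ tip true (g , true))) + 0#)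
            ≈⟨ +-cong (trans (to-next (3 ℕ.+ N) β u (ℕₚ.m≤n⇒m≤o+n 3 le)) (*-congʳ (E-cond {i} (ρ g true false) ≡.refl)))
                 (trans (+-identityʳ _) (trans (via-second N β u le)
                   (when-cong (β (g , true)) (λ _ → *-congʳ (E-cond {i} (ρ g true true) ≡.refl))))) ⟩
          when (ρ g true false) 1# * value β +
            when (β (g , true)) (when (ρ g true true) 1# * value (β AN.∖ (g , true))) ∎
          where
          u = tip false (g , false)
          α = state β (suc i)
          others : ∀ v → ¬ v ∈ (sep (suc g) ∷ tip true (g , true) ∷ []) → when (α v) (E u v * walk (3 ℕ.+ N) v (α ∖ v)) ≈ 0#
          others start ne = refl
          others (sep zero) ne = refl
          others (sep (suc h)) ne = when-0 (α (sep (suc h))) (*-zeroˡ (E-cond' (ρ g true false)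
            (≢-toℕ (λ h≡g → ne (here (≡.cong (sep ∘ suc) h≡g))))))
          others (mid w) ne = trans (when-cong (β w) (λ al → *-zeroˡ (trans (E-if1 _) (reflexive (≡.cong (λ b → when b 1#)
            (AN.==-≢ {g , false} {w} (AN.alive-≢ β al dead ∘ ≡.sym))))))) (when-0 (β w) refl)
          others (tip false w) ne = when-0 (β w) (*-zeroˡ ⟦𝟘⟧)
          others (tip true (h , false)) ne = when-0 (β (h , false)) (*-zeroˡ ⟦𝟘⟧)
          others (tip true (h , true)) ne = when-0 (β (h , true)) (*-zeroˡ (E-cond' (ρ g true true)
            (≢-toℕ (λ h≡g → ne (there (here (≡.cong (λ h → tip true (h , true)) h≡g)))))))

        -- Seven steps are the longest route to the next separator: three vertices for each of the
        -- two nodes, and the separator itself. Shorter routes leave fuel over, which is why `rest`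
        -- is assumed for all fuel from `N₀` on.
        clean-step : ∀ N β (j : Fin (suc G)) → toℕ j ≡ i → N₀ ≤ N →
          walk (7 ℕ.+ N) (sep j) (state β (suc i)) ≈ when (ok i β) 1#
        clean-step N β j j≡ le = begin
          walk (7 ℕ.+ N) u α
            ≈⟨ trans (reflexive (walk-step _ u α)) (+-zeroʳ (endV-alive u α (sep (suc g)) (alive-next β))) ⟩
          ∑ vertices (λ v → when (α v) (E u v * walk (6 ℕ.+ N) v (α ∖ v)))
            ≈⟨ ∑-among _ (sep (suc g) ∷ tip true (g , false) ∷ tip true (g , true) ∷ []) vertices-!
                 (((λ ()) ∷ (λ ()) ∷ []) ∷ (((λ ()) ∷ []) ∷ ([] ∷ []))) (λ {y} _ → ∈-vertices y) others ⟩
          when (α (sep (suc g))) (E u (sep (suc g)) * walk (6 ℕ.+ N) (sep (suc g)) (α ∖ sep (suc g)))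
            + (when (β (g , false)) (E u (tip true (g , false)) * walk (6 ℕ.+ N) (tip true (g , false)) (α ∖ tip true (g , false)))
            + (when (β (g , true)) (E u (tip true (g , true)) * walk (6 ℕ.+ N) (tip true (g , true)) (α ∖ tip true (g , true))) + 0#))
            ≈⟨ +-cong (trans (to-next (6 ℕ.+ N) β u (ℕₚ.m≤n⇒m≤o+n 6 le)) (*-congʳ (E-cond (ρ g false false) j≡)))
                 (+-cong (when-cong (β (g , false)) (λ e → trans
                       (*-cong (E-cond true j≡) (trans (through (4 ℕ.+ N) true (g , false) β (suc i) e)
                         (from-first N (β AN.∖ (g , false)) le (AN.∖-self β (g , false))))) (*-identityˡ _)))
                   (trans (+-identityʳ _) (trans (via-second (3 ℕ.+ N) β u (ℕₚ.m≤n⇒m≤o+n 3 le))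
                     (when-cong (β (g , true)) (λ _ → *-congʳ (E-cond (ρ g false true) j≡)))))) ⟩
          when (ρ g false false) 1# * value β
            + (when (β (g , false)) (when (ρ g true false) 1# * value β₁ +
                 when (β₁ (g , true)) (when (ρ g true true) 1# * value (β₁ AN.∖ (g , true))))
            + when (β (g , true)) (when (ρ g false true) 1# * value (β AN.∖ (g , true))))
            ≈⟨ cases ⟩
          when (ok i β) 1# ∎
          where
          u = sep j
          α = state β (suc i)
          β₁ = β AN.∖ (g , false)
          others : ∀ v → ¬ v ∈ (sep (suc g) ∷ tip true (g , false) ∷ tip true (g , true) ∷ []) →
            when (α v) (E u v * walk (6 ℕ.+ N) v (α ∖ v)) ≈ 0#
          others start ne = refl
          others (sep zero) ne = refl
          others (sep (suc h)) ne = when-0 (α (sep (suc h))) (*-zeroˡ (E-cond' _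
            (λ e → ≢-toℕ (λ h≡g → ne (here (≡.cong (sep ∘ suc) h≡g))) (≡.trans (≡.sym j≡) e))))
          others (mid w) ne = when-0 (β w) (*-zeroˡ ⟦𝟘⟧)
          others (tip false w) ne = when-0 (β w) (*-zeroˡ ⟦𝟘⟧)
          others (tip true (h , false)) ne = when-0 (β (h , false)) (*-zeroˡ (E-cond' _
            (λ e → ≢-toℕ (λ h≡g → ne (there (here (≡.cong (λ h → tip true (h , false)) h≡g)))) (≡.trans (≡.sym j≡) e))))
          others (tip true (h , true)) ne = when-0 (β (h , true)) (*-zeroˡ (E-cond' _
            (λ e → ≢-toℕ (λ h≡g → ne (there (there (here (≡.cong (λ h → tip true (h , true)) h≡g))))) (≡.trans (≡.sym j≡) e))))
          when-*-1 : ∀ b x → when b 1# * x ≈ when b x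
          when-*-1 true x = *-identityˡ x
          when-*-1 false x = zeroˡ x
          rem : ∀ γ b {h b'} → h ≢ g → (γ AN.∖ (g , b)) (h , b') ≡ γ (h , b')
          rem γ b h≢g = AN.∖-other γ (h≢g ∘ ≡.cong proj₁)
          dead : ∀ γ b → γ (g , not b) ≡ false → ∀ b' → (γ AN.∖ (g , b)) (g , b') ≡ false
          dead γ b e b' with b' 𝔹ₚ.≟ b
          ... | yes ≡.refl = AN.∖-self γ (g , b)
          ... | no b'≢b = AN.∖-false γ (g , b) (≡.subst (λ x → γ (g , x) ≡ false) (≡.sym (𝔹ₚ.¬-not b'≢b)) e)
          β₁t : β₁ (g , true) ≡ β (g , true)
          β₁t = AN.∖-other β (λ ())
          clean : ∀ a b → β (g , false) ≡ a → β (g , true) ≡ b → ∀ β' → (∀ h b → h ≢ g → β' (h , b) ≡ β (h , b)) →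
            (∀ b → β' (g , b) ≡ false) → when (ρ g a b) 1# * value β' ≈ when (ok i β) 1#
          clean a b ≡.refl ≡.refl β' same dead = trans (when-*-1 _ _) (value-clean β β' same dead)
          cases : when (ρ g false false) 1# * value β
            + (when (β (g , false)) (when (ρ g true false) 1# * value β₁ +
                 when (β₁ (g , true)) (when (ρ g true true) 1# * value (β₁ AN.∖ (g , true))))
            + when (β (g , true)) (when (ρ g false true) 1# * value (β AN.∖ (g , true)))) ≈ when (ok i β) 1#
          -- Only the route matching the actual pair survives. A route through a visited node is
          -- excluded by its guard, and one that skips an unvisited node vanishes by `value-dirty`.
          cases rewrite β₁t with β (g , false) in ea | β (g , true) in eb
          ... | false | false = trans (+-zeroʳ (+-identityʳ 0#)) (clean false false ea eb β (λ _ _ _ → ≡.refl) (λ { false → ea ; true → eb }))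
          ... | false | true = trans (+-zeroˡ (*-zeroʳ (value-dirty β true eb))) (trans (+-identityˡ _)
                  (clean false true ea eb _ (λ h b → rem β true) (dead β true ea)))
          ... | true | false = trans (+-zeroˡ (*-zeroʳ (value-dirty β false ea))) (trans (+-identityʳ _) (trans (+-identityʳ _)
                  (clean true false ea eb _ (λ h b → rem β false) (dead β false eb))))
          ... | true | true = trans (+-zeroˡ (*-zeroʳ (value-dirty β false ea)))
                  (trans (+-zeroʳ (*-zeroʳ (value-dirty (β AN.∖ (g , true)) false (≡.trans (AN.∖-other β (λ ())) ea))))
                  (trans (+-zeroˡ (*-zeroʳ (value-dirty β₁ true (≡.trans β₁t eb))))
                  (clean true true ea eb _ (λ h b h≢g → ≡.trans (rem β₁ true h≢g) (rem β false h≢g))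
                    (dead β₁ true (AN.∖-self β (g , false))))))

    none-ok : ∀ β → AV.none (state β (suc G)) vertices ≡ ok G β
    none-ok β = bool-≡ to from
      where
      okAt-G : ∀ g → okAt G β g ≡ not (β (g , false)) ∧ not (β (g , true))
      okAt-G g rewrite bool-≡ {toℕ g <ᵇ G} {true} (λ _ → ≡.refl) (λ _ → <⇒<ᵇ≡true (Finₚ.toℕ<n g)) = ≡.refl
      to : AV.none (state β (suc G)) vertices ≡ true → ok G β ≡ true
      to e = allF⁺ (okAt G β) λ g → ≡.trans (okAt-G g) (≡.cong₂ (λ a b → not a ∧ not b) (dead (g , false)) (dead (g , true)))
        where
        dead : ∀ v → β v ≡ false
        dead v = ≢true λ βv → false≢true (≡.trans (≡.sym (AV.none-false {state β (suc G)} (∈-vertices (mid v)) βv)) e)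
      from : ok G β ≡ true → AV.none (state β (suc G)) vertices ≡ true
      from e = AV.none-true vertices (λ {x} _ → dead x)
        where
        deadN : ∀ g b → β (g , b) ≡ false
        deadN g b with ∧-true {not (β (g , false))} {not (β (g , true))} (≡.trans (≡.sym (okAt-G g)) (allF⁻ (okAt G β) e g))
        deadN g false | p , q = 𝔹ₚ.not-injective p
        deadN g true | p , q = 𝔹ₚ.not-injective q
        dead : ∀ x → state β (suc G) x ≡ false
        dead start = ≡.refl
        dead (sep j) = ≢true λ p → ℕₚ.<-irrefl ≡.refl
          (ℕₚ.<-≤-trans (Finₚ.toℕ<n j) (ℕₚ.≤ᵇ⇒≤ (suc G) (toℕ j) (≡.subst T (≡.sym p) _)))
        dead (mid (g , b)) = deadN g b
        dead (tip d (g , b)) = deadN g b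

    clean-up : ∀ k i N β (j : Fin (suc G)) → toℕ j ≡ i → i ℕ.+ k ≡ G → k ℕ.* 7 ≤ N →
      walk N (sep j) (state β (suc i)) ≈ when (ok i β) 1#
    clean-up zero i N β j j≡ i+k≡ _ rewrite ℕₚ.+-identityʳ i | i+k≡ = last N
      where
      endValue : endV (sep j) (state β (suc G)) ≈ when (ok G β) 1#
      endValue = when-≡ (none-ok β) (trans (E-if1 (toℕ j ℕ.≡ᵇ G))
        (reflexive (≡.cong (λ b → when b 1#) (≡.trans (≡.cong (ℕ._≡ᵇ G) j≡) (≡ᵇ-refl G)))))
      last : ∀ N → walk N (sep j) (state β (suc G)) ≈ when (ok G β) 1#
      last zero = trans (reflexive (walk-zero (sep j) _)) endValue
      last (suc N) = trans (reflexive (walk-step N (sep j) _)) (trans (+-zeroˡ (∑-0 vertices none-left)) endValue)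
        where
        off : ∀ (g : Fin G) b → ⟦ if1 ((toℕ j ℕ.≡ᵇ toℕ g) ∧ b) ⟧ ≈ 0#
        off g b = Cleaning.E-cond' g b (λ e → ℕₚ.<-irrefl (≡.trans (≡.sym e) j≡) (Finₚ.toℕ<n g))
        none-left : ∀ x → when (state β (suc G) x) (E (sep j) x * walk N x (state β (suc G) ∖ x)) ≈ 0#
        none-left start = refl
        none-left (sep zero) = refl
        none-left (sep (suc h)) = when-0 (state β (suc G) (sep (suc h))) (*-zeroˡ (off h _))
        none-left (mid v) = when-0 (β v) (*-zeroˡ ⟦𝟘⟧)
        none-left (tip false v) = when-0 (β v) (*-zeroˡ ⟦𝟘⟧)
        none-left (tip true (g , b)) = when-0 (β (g , b)) (*-zeroˡ (off g _))
    clean-up (suc k) i N β j j≡ i+k≡ le = go (Fin.fromℕ< i<G) (Finₚ.toℕ-fromℕ< i<G) N le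
      where
      i<G : i < G
      i<G = ≡.subst (i <_) i+k≡ (ℕₚ.m<m+n i (s≤s z≤n))
      go : ∀ (g : Fin G) → toℕ g ≡ i → ∀ N → suc k ℕ.* 7 ≤ N → walk N (sep j) (state β (suc i)) ≈ when (ok i β) 1#
      go g ≡.refl _ (s≤s (s≤s (s≤s (s≤s (s≤s (s≤s (s≤s {n = N} le))))))) = Cleaning.clean-step g (k ℕ.* 7)
        (λ N β → clean-up k (suc i) N β (suc g) ≡.refl (≡.trans (≡.sym (ℕₚ.+-suc i k)) i+k≡)) N β j j≡ le

    ending : ∀ β N → G ℕ.* 7 ≤ N → walk N (sep zero) (state β 0 ∖ sep zero) ≈ when (ok 0 β) 1#
    ending β N le = trans (walk-≗ N (sep zero) same) (clean-up G 0 N β zero ≡.refl ≡.refl le)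
      where
      same : (state β 0 ∖ sep zero) ≗ state β 1
      same start = AV.∖-false _ (sep zero) ≡.refl
      same (sep zero) = AV.∖-self _ (sep zero)
      same (sep (suc i)) = AV.∖-other _ (λ ())
      same (mid v) = AV.∖-other _ (λ ())
      same (tip d v) = AV.∖-other _ (λ ())

    tipsF-! : Unique tipsF
    tipsF-! = Uniqueₚ.map⁺ (proj₂ ∘ tip-injective) nodes-!

    forwards : ∀ N β u → (∀ w → when (β w) (E u (tip false w) * walk (2 ℕ.+ N) (tip false w) (state β 0 ∖ tip false w))
      ≈ when (β w) (E u (tip false w) * walk N (tip true w) (state (β AN.∖ w) 0)))
    forwards N β u w = when-cong (β w) (λ e → *-congˡ (through N false w β 0 e))

    visit-step : ∀ N v β → β v ≡ false → G ℕ.* 7 ≤ N → walk (3 ℕ.+ N) (tip true v) (state β 0) ≈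
      ∑ nodes (λ w → when (β w) (⟦ lab v w ⟧ * walk N (tip true w) (state (β AN.∖ w) 0))) + ⟦ fin v ⟧ * when (ok 0 β) 1#
    visit-step N v β βv le = begin
      walk (3 ℕ.+ N) (tip true v) α
        ≈⟨ trans (reflexive (walk-step _ (tip true v) α)) (+-zeroʳ (endV-0 (tip true v) α ⟦𝟘⟧)) ⟩
      ∑ vertices f
        ≈⟨ ∑-among f (sep zero ∷ tipsF) vertices-! (All.tabulate sep∉ ∷ tipsF-!) (λ {y} _ → ∈-vertices y) others ⟩
      f (sep zero) + ∑ tipsF f
        ≈⟨ +-cong (*-congˡ (ending β (2 ℕ.+ N) (ℕₚ.m≤n⇒m≤o+n 2 le)))
             (trans (reflexive (∑-map (tip false) nodes f)) (∑-cong nodes (forwards N β (tip true v)))) ⟩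
      ⟦ fin v ⟧ * when (ok 0 β) 1# + ∑ nodes (λ w → when (β w) (⟦ lab v w ⟧ * walk N (tip true w) (state (β AN.∖ w) 0)))
        ≈⟨ +-comm _ _ ⟩
      _ ∎
      where
      α = state β 0
      f : Vtx → Carrier
      f x = when (α x) (E (tip true v) x * walk (2 ℕ.+ N) x (α ∖ x))
      sep∉ : ∀ {x} → x ∈ tipsF → sep zero ≢ x
      sep∉ p ≡.refl with ∈-map⁻ (tip false) p
      ... | _ , _ , ()
      others : ∀ x → ¬ x ∈ (sep zero ∷ tipsF) → f x ≈ 0#
      others start x∉ = refl
      others (sep zero) x∉ = ⊥-elim (x∉ (here ≡.refl))
      others (sep (suc g)) x∉ = *-zeroˡ ⟦𝟘⟧
      others (mid w) x∉ = trans (when-cong (β w) (λ al → *-zeroˡ (trans (E-if1 _) (reflexive (≡.cong (λ b → when b 1#)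
        (AN.==-≢ {v} {w} (AN.alive-≢ β al βv ∘ ≡.sym))))))) (when-0 (β w) refl)
      others (tip false w) x∉ = ⊥-elim (x∉ (there (∈-map⁺ (tip false) (∈-nodes w))))
      others (tip true w) x∉ = when-0 (β w) (*-zeroˡ ⟦𝟘⟧)

    start-step : ∀ N β → walk (3 ℕ.+ N) start (state β 0) ≈
      ∑ nodes (λ w → when (β w) (⟦ λ₀ w ⟧ * walk N (tip true w) (state (β AN.∖ w) 0)))
    start-step N β = begin
      walk (3 ℕ.+ N) start α ≈⟨ trans (reflexive (walk-step _ start α)) (+-zeroʳ (endV-0 start α ⟦𝟘⟧)) ⟩
      ∑ vertices f ≈⟨ ∑-among f tipsF vertices-! tipsF-! (λ {y} _ → ∈-vertices y) others ⟩
      ∑ tipsF f ≈⟨ trans (reflexive (∑-map (tip false) nodes f)) (∑-cong nodes (forwards N β start)) ⟩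
      _ ∎
      where
      α = state β 0
      f : Vtx → Carrier
      f x = when (α x) (E start x * walk (2 ℕ.+ N) x (α ∖ x))
      others : ∀ x → ¬ x ∈ tipsF → f x ≈ 0#
      others start x∉ = refl
      others (sep i) x∉ = when-0 (α (sep i)) (*-zeroˡ ⟦𝟘⟧)
      others (mid w) x∉ = when-0 (β w) (*-zeroˡ ⟦𝟘⟧)
      others (tip false w) x∉ = ⊥-elim (x∉ (∈-map⁺ (tip false) (∈-nodes w)))
      others (tip true w) x∉ = when-0 (β w) (*-zeroˡ ⟦𝟘⟧)

    module N = Walk R _≟N_ nodes (λ u v → ⟦ lab u v ⟧) (λ u β → ⟦ fin u ⟧ * when (ok 0 β) 1#)

    -- The fuel pays three vertices for each node and at most seven for each group in the clean-up;
    -- the additional three cover the passage to `sep zero`.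
    simulate : ∀ n v β → β v ≡ false → AN.count β nodes ≤ n →
      walk (suc n ℕ.* 3 ℕ.+ G ℕ.* 7) (tip true v) (state β 0) ≈ N.walk n v β
    simulate zero v β βv c≤ = trans (visit-step (G ℕ.* 7) v β βv ℕₚ.≤-refl) (trans
      (+-zeroˡ (∑-0-∈ nodes (λ {w} w∈ → reflexive (≡.cong (λ b → when b (⟦ lab v w ⟧ * walk (G ℕ.* 7) (tip true w) (state (β AN.∖ w) 0)))
        (AN.count-dead {β} (ℕₚ.n≤0⇒n≡0 c≤) w∈)))))
      (sym (reflexive (N.walk-zero v β))))
    simulate (suc n) v β βv c≤ = trans
      (visit-step (suc n ℕ.* 3 ℕ.+ G ℕ.* 7) v β βv (ℕₚ.m≤n+m (G ℕ.* 7) (suc n ℕ.* 3)))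
      (trans (+-congʳ (∑-cong-∈ nodes (λ {w} w∈ → when-cong (β w) (λ e → *-congˡ
        (simulate n w (β AN.∖ w) (AN.∖-self β w) (ℕₚ.≤-pred (≡.subst (_≤ suc n) (AN.count-∖ {β} nodes-! w∈ e) c≤)))))))
      (sym (reflexive (N.walk-step n v β))))

    all-start : (allAlive ∖ start) ≗ state allAlive 0
    all-start start = AV.∖-self allAlive start
    all-start (sep i) = AV.∖-other allAlive (λ ())
    all-start (mid v) = AV.∖-other allAlive (λ ())
    all-start (tip d v) = AV.∖-other allAlive (λ ())

    ham-walk : ∀ n → length inner ≤ n → length nodes ≤ n →
      walk (length inner) start (allAlive ∖ start) ≈ ∑ nodes (λ w → ⟦ λ₀ w ⟧ * N.walk n w (allAlive AN.∖ w))
    ham-walk n inner≤ nodes≤ = begin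
      walk (length inner) start (allAlive ∖ start)
        ≈⟨ walk-fuel-≥ vertices-! _ _ start _ ct (ℕₚ.≤-trans ct (ℕₚ.≤-trans inner≤ n≤)) ⟩
      walk (3 ℕ.+ (suc n ℕ.* 3 ℕ.+ G ℕ.* 7)) start (allAlive ∖ start)
        ≈⟨ walk-≗ (3 ℕ.+ (suc n ℕ.* 3 ℕ.+ G ℕ.* 7)) start all-start ⟩
      walk (3 ℕ.+ (suc n ℕ.* 3 ℕ.+ G ℕ.* 7)) start (state allAlive 0) ≈⟨ start-step _ allAlive ⟩
      ∑ nodes (λ w → ⟦ λ₀ w ⟧ * walk (suc n ℕ.* 3 ℕ.+ G ℕ.* 7) (tip true w) (state (allAlive AN.∖ w) 0))
        ≈⟨ ∑-cong nodes (λ w → *-congˡ (simulate n w (allAlive AN.∖ w) (AN.∖-self allAlive w)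
             (ℕₚ.≤-trans (AN.count-≤-length _ nodes) nodes≤))) ⟩
      ∑ nodes (λ w → ⟦ λ₀ w ⟧ * N.walk n w (allAlive AN.∖ w)) ∎
      where
      ct : AV.count (allAlive ∖ start) vertices ≤ length inner
      ct = ℕₚ.≤-pred (≡.subst (_≤ suc (length inner)) (AV.count-∖ {allAlive} vertices-! (∈-vertices start) ≡.refl)
        (AV.count-≤-length allAlive vertices))
      n≤ : n ≤ 3 ℕ.+ (suc n ℕ.* 3 ℕ.+ G ℕ.* 7)
      n≤ = ℕₚ.≤-trans (ℕₚ.m≤m*n n 3) (ℕₚ.≤-trans (ℕₚ.m≤n+m (n ℕ.* 3) 6) (ℕₚ.m≤m+n (6 ℕ.+ n ℕ.* 3) (G ℕ.* 7)))

-- The program graph: guessing bits and walking through derivations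

module Program where
  -- A walk simulates the leftmost derivations, in a grammar in Chomsky normal form, of words occupying the positions
  -- p, …, D − 1. The node W p k q u expands the interval [p, q) by the rule u, split at k, and goes on with [p, k);
  -- after the letter at position k − 1 has been emitted (node Y), the node R p k q u resumes with [k, q).
  -- Visiting W and R is tied together by ρ, which plays the part of the stack. The bit b is guessed to be false
  -- by visiting the nodes Z (inj₁ b) p for all p, which by ρ excludes the nodes Y (inj₁ b) p.
  module Nodes (d m r : ℕ) where

    -- One more than the degree bound, so that there is at least one position: the detour that makes
    -- a bit false begins at `Z (inj₁ b) zero`.
    D : ℕ
    D = suc d

    -- A bit variable, or the variable read at the gate `u`. Naming variables by gates bounds the
    -- number of letters by the size of the circuit.
    Letter : Set
    Letter = Fin m ⊎ Fin r

    data Rule : Set where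
      mkRule : (p k q : Fin (suc D)) (u : Fin r) → Rule

    data Leaf : Set where
      mkLeaf : Letter → Fin D → Leaf

    data Group : Set where
      rule  : Rule → Group
      leaf  : Leaf → Group
      gate  : Fin (suc m) → Group
      launch : Fin D → Group

    data KNode : Set where
      node : Group → Bool → KNode

    -- In addition to the nodes described above, `Gt i` decides the bit number i, and `St p` chooses
    -- D - p as the length of the word. The nodes `Gt'` and `St'` complete their groups to pairs;
    -- they stay unvisited, which `ρ` permits there.
    pattern W p k q u = node (rule (mkRule p k q u)) false
    pattern R p k q u = node (rule (mkRule p k q u)) true
    pattern Y τ p = node (leaf (mkLeaf τ p)) false
    pattern Z τ p = node (leaf (mkLeaf τ p)) true
    pattern Gt i = node (gate i) false
    pattern Gt' i = node (gate i) true
    pattern St p = node (launch p) false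
    pattern St' p = node (launch p) true

    node' : Group × Bool → KNode
    node' (g , b) = node g b

    node'-injective : ∀ {x y} → node' x ≡ node' y → x ≡ y
    node'-injective ≡.refl = ≡.refl

    rule' : Fin (suc D) × Fin (suc D) × Fin (suc D) × Fin r → Rule
    rule' (p , k , q , u) = mkRule p k q u

    leaf' : Letter × Fin D → Leaf
    leaf' (τ , p) = mkLeaf τ p

    _≟L_ : DecidableEquality Letter
    _≟L_ = ⊎-≡-dec Finₚ._≟_ Finₚ._≟_

    _≟R_ : DecidableEquality Rule
    mkRule p k q u ≟R mkRule p' k' q' u' = map′ (≡.cong rule') (λ { ≡.refl → ≡.refl })
      (×-≡-dec Finₚ._≟_ (×-≡-dec Finₚ._≟_ (×-≡-dec Finₚ._≟_ Finₚ._≟_)) (p , k , q , u) (p' , k' , q' , u'))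

    _≟F_ : DecidableEquality Leaf
    mkLeaf τ p ≟F mkLeaf τ' p' = map′ (≡.cong leaf') (λ { ≡.refl → ≡.refl }) (×-≡-dec _≟L_ Finₚ._≟_ (τ , p) (τ' , p'))

    _≟G_ : DecidableEquality Group
    rule t ≟G rule t' = map′ (≡.cong rule) (λ { ≡.refl → ≡.refl }) (t ≟R t')
    rule t ≟G leaf t' = no λ ()
    rule t ≟G gate i = no λ ()
    rule t ≟G launch p = no λ ()
    leaf t ≟G rule t' = no λ ()
    leaf t ≟G leaf t' = map′ (≡.cong leaf) (λ { ≡.refl → ≡.refl }) (t ≟F t')
    leaf t ≟G gate i = no λ ()
    leaf t ≟G launch p = no λ ()
    gate i ≟G rule t' = no λ ()
    gate i ≟G leaf t' = no λ ()
    gate i ≟G gate j = map′ (≡.cong gate) (λ { ≡.refl → ≡.refl }) (i Finₚ.≟ j)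
    gate i ≟G launch p = no λ ()
    launch p ≟G rule t' = no λ ()
    launch p ≟G leaf t' = no λ ()
    launch p ≟G gate i = no λ ()
    launch p ≟G launch p' = map′ (≡.cong launch) (λ { ≡.refl → ≡.refl }) (p Finₚ.≟ p')

    opaque
      _≟K_ : DecidableEquality KNode
      node g b ≟K node g' b' = map′ (≡.cong node') (λ { ≡.refl → ≡.refl }) (×-≡-dec _≟G_ 𝔹ₚ._≟_ (g , b) (g' , b'))

    opaque
      letters : List Letter
      letters = map inj₁ (allFin m) ++ map inj₂ (allFin r)

      rules : List Rule
      rules = map rule' (cartesianProduct (allFin (suc D))
        (cartesianProduct (allFin (suc D)) (cartesianProduct (allFin (suc D)) (allFin r))))

      leaves : List Leaf
      leaves = map leaf' (cartesianProduct letters (allFin D))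

      gates : List (Fin (suc m))
      gates = allFin (suc m)

      launches : List (Fin D)
      launches = allFin D

      groups : List Group
      groups = map rule rules ++ (map leaf leaves ++ (map gate gates ++ map launch launches))

      nodesK : List KNode
      nodesK = map node' (cartesianProduct groups bools)

      letters-! : Unique letters
      letters-! = Uniqueₚ.++⁺ (Uniqueₚ.map⁺ inj₁-injective (Uniqueₚ.allFin⁺ m)) (Uniqueₚ.map⁺ inj₂-injective (Uniqueₚ.allFin⁺ r))
        λ (p , q) → disjoint p q
        where
        disjoint : ∀ {x} → x ∈ map inj₁ (allFin m) → ¬ x ∈ map inj₂ (allFin r)
        disjoint p q with ∈-map⁻ inj₁ p | ∈-map⁻ inj₂ q
        ... | _ , _ , ≡.refl | _ , _ , ()

      ∈-letters : ∀ τ → τ ∈ letters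
      ∈-letters (inj₁ b) = ∈-++⁺ˡ (∈-map⁺ inj₁ (∈-allFin b))
      ∈-letters (inj₂ u) = ∈-++⁺ʳ (map inj₁ (allFin m)) (∈-map⁺ inj₂ (∈-allFin u))

      rules-! : Unique rules
      rules-! = Uniqueₚ.map⁺ (λ { ≡.refl → ≡.refl }) (Uniqueₚ.cartesianProduct⁺ (Uniqueₚ.allFin⁺ _)
        (Uniqueₚ.cartesianProduct⁺ (Uniqueₚ.allFin⁺ _) (Uniqueₚ.cartesianProduct⁺ (Uniqueₚ.allFin⁺ _) (Uniqueₚ.allFin⁺ _))))

      ∈-rules : ∀ t → t ∈ rules
      ∈-rules (mkRule p k q u) = ∈-map⁺ rule' (∈-cartesianProduct⁺ (∈-allFin p) (∈-cartesianProduct⁺ (∈-allFin k)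
        (∈-cartesianProduct⁺ (∈-allFin q) (∈-allFin u))))

      leaves-! : Unique leaves
      leaves-! = Uniqueₚ.map⁺ (λ { ≡.refl → ≡.refl }) (Uniqueₚ.cartesianProduct⁺ letters-! (Uniqueₚ.allFin⁺ D))

      ∈-leaves : ∀ t → t ∈ leaves
      ∈-leaves (mkLeaf τ p) = ∈-map⁺ leaf' (∈-cartesianProduct⁺ (∈-letters τ) (∈-allFin p))

      gates-! : Unique gates
      gates-! = Uniqueₚ.allFin⁺ (suc m)

      ∈-gates : ∀ i → i ∈ gates
      ∈-gates = ∈-allFin

      length-groups : length groups ≡
        suc D ℕ.* (suc D ℕ.* (suc D ℕ.* r)) ℕ.+ ((m ℕ.+ r) ℕ.* D ℕ.+ (suc m ℕ.+ D))
      length-groups = part rule rules length-rules (part leaf leaves length-leaves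
        (part gate gates (length-allFin (suc m)) (≡.trans (Listₚ.length-map launch launches) (length-allFin D))))
        where
        part : ∀ {B : Set} (c : B → Group) (xs : List B) {ys : List Group} {a b} → length xs ≡ a → length ys ≡ b →
          length (map c xs ++ ys) ≡ a ℕ.+ b
        part c xs e e' = ≡.trans (Listₚ.length-++ (map c xs)) (≡.cong₂ ℕ._+_ (≡.trans (Listₚ.length-map c xs) e) e')
        product : ∀ {B E : Set} (xs : List B) (ys : List E) {a b} → length xs ≡ a → length ys ≡ b →
          length (cartesianProduct xs ys) ≡ a ℕ.* b
        product xs ys e e' = ≡.trans (length-cartesianProduct xs ys) (≡.cong₂ ℕ._*_ e e')
        product₄ : ∀ {B E : Set} (xs : List B) (ys : List E) {a b} → length xs ≡ a → length ys ≡ b →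
          length (cartesianProduct xs (cartesianProduct xs (cartesianProduct xs ys))) ≡ a ℕ.* (a ℕ.* (a ℕ.* b))
        product₄ xs ys e e' = product xs (cartesianProduct xs (cartesianProduct xs ys)) e
          (product xs (cartesianProduct xs ys) e (product xs ys e e'))
        length-letters : length letters ≡ m ℕ.+ r
        length-letters = ≡.trans (Listₚ.length-++ (map inj₁ (allFin m))) (≡.cong₂ ℕ._+_
          (≡.trans (Listₚ.length-map inj₁ (allFin m)) (length-allFin m)) (≡.trans (Listₚ.length-map inj₂ (allFin r)) (length-allFin r)))

        length-rules : length rules ≡ suc D ℕ.* (suc D ℕ.* (suc D ℕ.* r))
        length-rules = ≡.trans (Listₚ.length-map rule' (cartesianProduct (allFin (suc D)) (cartesianProduct (allFin (suc D)) (cartesianProduct (allFin (suc D)) (allFin r)))))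
          (product₄ (allFin (suc D)) (allFin r) (length-allFin (suc D)) (length-allFin r))
        length-leaves : length leaves ≡ (m ℕ.+ r) ℕ.* D
        length-leaves = ≡.trans (Listₚ.length-map leaf' (cartesianProduct letters (allFin D)))
          (product letters (allFin D) length-letters (length-allFin D))

      launches≡ : launches ≡ allFin D
      launches≡ = ≡.refl

      launches-! : Unique launches
      launches-! = Uniqueₚ.allFin⁺ D

      ∈-launches : ∀ p → p ∈ launches
      ∈-launches = ∈-allFin

      groups-! : Unique groups
      groups-! = Uniqueₚ.++⁺ (Uniqueₚ.map⁺ (λ { ≡.refl → ≡.refl }) rules-!)
        (Uniqueₚ.++⁺ (Uniqueₚ.map⁺ (λ { ≡.refl → ≡.refl }) leaves-!)
          (Uniqueₚ.++⁺ (Uniqueₚ.map⁺ (λ { ≡.refl → ≡.refl }) gates-!) (Uniqueₚ.map⁺ (λ { ≡.refl → ≡.refl }) launches-!)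
            (λ (p , q) → gb p q)) (λ (p , q) → lgb p q)) (λ (p , q) → rlgb p q)
        where
        gb : ∀ {x} → x ∈ map gate gates → ¬ x ∈ map launch launches
        gb p q with ∈-map⁻ gate p | ∈-map⁻ launch q
        ... | _ , _ , ≡.refl | _ , _ , ()
        lgb : ∀ {x} → x ∈ map leaf leaves → ¬ x ∈ (map gate gates ++ map launch launches)
        lgb p q with ∈-map⁻ leaf p | ∈-++⁻ (map gate gates) q
        ... | _ , _ , ≡.refl | inj₁ s with ∈-map⁻ gate s
        ...   | _ , _ , ()
        lgb p q | _ , _ , ≡.refl | inj₂ s with ∈-map⁻ launch s
        ...   | _ , _ , ()
        rlgb : ∀ {x} → x ∈ map rule rules → ¬ x ∈ (map leaf leaves ++ (map gate gates ++ map launch launches))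
        rlgb p q with ∈-map⁻ rule p | ∈-++⁻ (map leaf leaves) q
        ... | _ , _ , ≡.refl | inj₁ s with ∈-map⁻ leaf s
        ...   | _ , _ , ()
        rlgb p q | _ , _ , ≡.refl | inj₂ s with ∈-++⁻ (map gate gates) s
        ... | inj₁ t with ∈-map⁻ gate t
        ...   | _ , _ , ()
        rlgb p q | _ , _ , ≡.refl | inj₂ s | inj₂ t with ∈-map⁻ launch t
        ...   | _ , _ , ()

      ∈-groups : ∀ g → g ∈ groups
      ∈-groups (rule t) = ∈-++⁺ˡ (∈-map⁺ rule (∈-rules t))
      ∈-groups (leaf t) = ∈-++⁺ʳ (map rule rules) (∈-++⁺ˡ (∈-map⁺ leaf (∈-leaves t)))
      ∈-groups (gate i) = ∈-++⁺ʳ (map rule rules) (∈-++⁺ʳ (map leaf leaves) (∈-++⁺ˡ (∈-map⁺ gate (∈-gates i))))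
      ∈-groups (launch p) = ∈-++⁺ʳ (map rule rules) (∈-++⁺ʳ (map leaf leaves) (∈-++⁺ʳ (map gate gates) (∈-map⁺ launch (∈-launches p))))

      nodesK-! : Unique nodesK
      nodesK-! = Uniqueₚ.map⁺ node'-injective (Uniqueₚ.cartesianProduct⁺ groups-! bools-!)

      ∈-nodesK : ∀ v → v ∈ nodesK
      ∈-nodesK (node g b) = ∈-map⁺ node' (∈-cartesianProduct⁺ (∈-groups g) (∈-bools b))

    -- An argument `true` means unvisited. For a leaf, `a ∨ b` thus says that `Y` and `Z` are not
    -- both visited.
    ρ : Group → Bool → Bool → Bool
    ρ (rule _) a b = not (a xor b)
    ρ (leaf _) a b = a ∨ b
    ρ (gate _) a b = true
    ρ (launch _) a b = true

    opaque
      -- Running over the indices of `groups` makes this agree by definition with the test `ok 0` of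
      -- the gadget graph.
      okK : (KNode → Bool) → Bool
      okK α = allF (λ g → ρ (lookup groups g) (α (node (lookup groups g) false)) (α (node (lookup groups g) true)))

      okK⁺ : ∀ α → (∀ g → ρ g (α (node g false)) (α (node g true)) ≡ true) → okK α ≡ true
      okK⁺ α h = allF⁺ _ (λ i → h (lookup groups i))

      okK⁻ : ∀ α g → okK α ≡ true → ρ g (α (node g false)) (α (node g true)) ≡ true
      okK⁻ α g e = ≡.subst (λ g → ρ g (α (node g false)) (α (node g true)) ≡ true) (≡.sym (lookup-index (∈-groups g)))
        (allF⁻ _ e (Any.index (∈-groups g)))

    module Labels {a x : Level} {A : Set a} {X : Set x} (𝟘 𝟙 : A) (left right : Fin r → X) (wT : X → Letter → A)
      (wB : X → Fin r → A) (letter : Fin r → A) (root : X) (g0 : A) where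

      if1 : Bool → A
      if1 b = if b then 𝟙 else 𝟘

      ℓ : Letter → A
      ℓ (inj₁ b) = 𝟙
      ℓ (inj₂ u) = letter u

      splits : ℕ → ℕ → ℕ → ℕ → ℕ → Bool
      splits p q p' k q' = (p' ≡ᵇ p) ∧ ((q' ≡ᵇ q) ∧ ((p <ᵇ k) ∧ (k <ᵇ q)))

      -- The labels out of any node that is about to derive `x` on [p, q): a `W` for its left part,
      -- an `R` for its right part, or a launching node for the whole word.
      into : ℕ → X → ℕ → KNode → A
      into p x q (W p' k q' u) = if splits p q (toℕ p') (toℕ k) (toℕ q') then wB x u else 𝟘
      into p x q (Y τ p') = if (toℕ p' ≡ᵇ p) ∧ (q ≡ᵇ suc p) then wT x τ else 𝟘
      into p x q _ = 𝟘

      firstBlock : ℕ → Letter → ℕ → A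
      firstBlock i (inj₁ b) p = if1 ((toℕ b ≡ᵇ i) ∧ (p ≡ᵇ 0))
      firstBlock i (inj₂ u) p = 𝟘

      nextBlock : Letter → ℕ → Letter → ℕ → A
      nextBlock (inj₁ b) p (inj₁ b') p' = if1 ((toℕ b' ≡ᵇ toℕ b) ∧ (p' ≡ᵇ suc p))
      nextBlock _ _ _ _ = 𝟘

      lastBlock : Letter → ℕ → ℕ → A
      lastBlock (inj₁ b) p j = if1 ((suc p ≡ᵇ D) ∧ (j ≡ᵇ suc (toℕ b)))
      lastBlock (inj₂ u) p j = 𝟘

      -- The weight of a production is paid on entering `W` or `Y`, the letter on leaving `Y`,
      -- either here or in `fin`. A bit has label 1: if it is false, the derivations using it are
      -- already ruled out by the visited nodes `Z`.
      lab : KNode → KNode → A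
      lab (W p k q u) v = into (toℕ p) (left u) (toℕ k) v
      lab (R p k q u) v = into (toℕ k) (right u) (toℕ q) v
      lab (St p) v = into (toℕ p) root D v
      lab (Y τ p) (R p' k q u) = if (toℕ k ≡ᵇ suc (toℕ p)) ∧ (toℕ k <ᵇ toℕ q) then ℓ τ else 𝟘
      lab (Gt i) (Gt j) = if1 (toℕ j ≡ᵇ suc (toℕ i))
      lab (Gt i) (Z τ p) = firstBlock (toℕ i) τ (toℕ p)
      lab (Gt i) (St p) = if1 (toℕ i ≡ᵇ m)
      lab (Z τ p) (Z τ' p') = nextBlock τ (toℕ p) τ' (toℕ p')
      lab (Z τ p) (Gt j) = lastBlock τ (toℕ p) (toℕ j)
      lab _ _ = 𝟘

      fin : KNode → A
      fin (Y τ p) = if suc (toℕ p) ≡ᵇ D then ℓ τ else 𝟘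
      fin (Gt i) = if toℕ i ≡ᵇ m then g0 else 𝟘
      fin _ = 𝟘

      λ₀ : KNode → A
      λ₀ (Gt i) = if1 (toℕ i ≡ᵇ 0)
      λ₀ _ = 𝟘

      pos : KNode → ℕ
      pos (W p k q u) = toℕ p
      pos (R p k q u) = toℕ k
      pos (Y τ p) = toℕ p
      pos (St p) = toℕ p
      pos _ = 0

      splits⁻ : ∀ {p q p' k q'} → splits p q p' k q' ≡ true → p' ≡ p × q' ≡ q × p < k × k < q
      splits⁻ {p} {q} {p'} {k} {q'} e with ∧-true {p' ≡ᵇ p} e
      ... | a , e₁ with ∧-true {q' ≡ᵇ q} e₁
      ...   | b , e₂ with ∧-true {p <ᵇ k} e₂
      ...     | c , d = ≡ᵇ⇒≡ a , ≡ᵇ⇒≡ b , ℕₚ.<ᵇ⇒< p k (≡.subst T (≡.sym c) _) , ℕₚ.<ᵇ⇒< k q (≡.subst T (≡.sym d) _)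

      into-pos : ∀ p x q v → into p x q v ≡ 𝟘 ⊎ p ≡ pos v
      into-pos p x q (W p' k q' u) with splits p q (toℕ p') (toℕ k) (toℕ q') in e
      ... | true = inj₂ (≡.sym (proj₁ (splits⁻ {p} {q} {toℕ p'} {toℕ k} {toℕ q'} e)))
      ... | false = inj₁ ≡.refl
      into-pos p x q (Y τ p') with (toℕ p' ≡ᵇ p) in e
      ... | true = inj₂ (≡.sym (≡ᵇ⇒≡ e))
      ... | false = inj₁ ≡.refl
      into-pos p x q (R _ _ _ _) = inj₁ ≡.refl
      into-pos p x q (Z _ _) = inj₁ ≡.refl
      into-pos p x q (Gt _) = inj₁ ≡.refl
      into-pos p x q (Gt' _) = inj₁ ≡.refl
      into-pos p x q (St _) = inj₁ ≡.refl
      into-pos p x q (St' _) = inj₁ ≡.refl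

      -- Along nonzero labels the walk never goes back in the word. Combined with `lab-W`, a rule
      -- split at k can no longer be started once the position k has been reached. The guessing
      -- nodes have position 0.
      lab-pos : ∀ v w → lab v w ≡ 𝟘 ⊎ pos v ≤ pos w
      lab-pos v w = go v
        where
        weaken : ∀ {a b c} {B : Set c} → B ⊎ (a ≡ b) → B ⊎ (a ≤ b)
        weaken (inj₁ e) = inj₁ e
        weaken (inj₂ e) = inj₂ (ℕₚ.≤-reflexive e)
        fromY : ∀ τ p w → lab (Y τ p) w ≡ 𝟘 ⊎ toℕ p ≤ pos w
        fromY τ p (R p' k q u) with (toℕ k ≡ᵇ suc (toℕ p)) in e
        ... | true = inj₂ (ℕₚ.≤-trans (ℕₚ.n≤1+n _) (ℕₚ.≤-reflexive (≡.sym (≡ᵇ⇒≡ {toℕ k} e))))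
        ... | false = inj₁ ≡.refl
        fromY τ p (W _ _ _ _) = inj₁ ≡.refl
        fromY τ p (Y _ _) = inj₁ ≡.refl
        fromY τ p (Z _ _) = inj₁ ≡.refl
        fromY τ p (Gt _) = inj₁ ≡.refl
        fromY τ p (Gt' _) = inj₁ ≡.refl
        fromY τ p (St _) = inj₁ ≡.refl
        fromY τ p (St' _) = inj₁ ≡.refl
        go : ∀ v → lab v w ≡ 𝟘 ⊎ pos v ≤ pos w
        go (W p k q u) = weaken (into-pos (toℕ p) (left u) (toℕ k) w)
        go (R p k q u) = weaken (into-pos (toℕ k) (right u) (toℕ q) w)
        go (St p) = weaken (into-pos (toℕ p) root D w)
        go (Y τ p) = fromY τ p w
        go (Z _ _) = inj₂ z≤n
        go (Gt _) = inj₂ z≤n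
        go (Gt' _) = inj₂ z≤n
        go (St' _) = inj₂ z≤n

      lab-W : ∀ v p k q u → lab v (W p k q u) ≡ 𝟘 ⊎ pos v < toℕ k
      lab-W v p k q u = go v
        where
        intoW : ∀ p' x q' → into p' x q' (W p k q u) ≡ 𝟘 ⊎ p' < toℕ k
        intoW p' x q' with splits p' q' (toℕ p) (toℕ k) (toℕ q) in e
        ... | true = inj₂ (proj₁ (proj₂ (proj₂ (splits⁻ {p'} {q'} {toℕ p} {toℕ k} {toℕ q} e))))
        ... | false = inj₁ ≡.refl
        go : ∀ v → lab v (W p k q u) ≡ 𝟘 ⊎ pos v < toℕ k
        go (W p' k' q' u') = intoW (toℕ p') (left u') (toℕ k')
        go (R p' k' q' u') = intoW (toℕ k') (right u') (toℕ q')
        go (St p') = intoW (toℕ p') root D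
        go (Y τ p) = inj₁ ≡.refl
        go (Z _ _) = inj₁ ≡.refl
        go (Gt _) = inj₁ ≡.refl
        go (Gt' _) = inj₁ ≡.refl
        go (St' _) = inj₁ ≡.refl

open Program

-- Walks through the program graph compute derivations

module Derive {c ℓᵣ : Level} (𝓡 : Semiring c ℓᵣ) (d m r : ℕ)
  {a x : Level} {A : Set a} {X : Set x} (𝟘 𝟙 : A) (⟦_⟧ : A → Semiring.Carrier 𝓡)
  (⟦𝟘⟧ : Semiring._≈_ 𝓡 ⟦ 𝟘 ⟧ (Semiring.0# 𝓡)) (⟦𝟙⟧ : Semiring._≈_ 𝓡 ⟦ 𝟙 ⟧ (Semiring.1# 𝓡))
  (left right : Fin r → X) (wT : X → Nodes.Letter d m r → A) (wB : X → Fin r → A)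
  (letter : Fin r → A) (root : X) (g0 : A) where
  open Nodes d m r
  open Semiring 𝓡 hiding (zero)
  open Sums 𝓡
  open Labels 𝟘 𝟙 left right wT wB letter root g0
  open import Relation.Binary.Reasoning.Setoid setoid

  endK : KNode → (KNode → Bool) → Carrier
  endK u α = ⟦ fin u ⟧ * when (okK α) 1#

  open Alive _≟K_ hiding (bit)
  open Walk 𝓡 _≟K_ nodesK (λ u v → ⟦ lab u v ⟧) endK

  endK-cong : ∀ u {α β} → α ≗ β → endK u α ≈ endK u β
  endK-cong u {α} {β} e = *-congˡ (when-≡ (bool-≡
    (λ h → okK⁺ β (λ g → ≡.trans (≡.cong₂ (ρ g) (≡.sym (e _)) (≡.sym (e _))) (okK⁻ α g h)))
    (λ h → okK⁺ α (λ g → ≡.trans (≡.cong₂ (ρ g) (e _) (e _)) (okK⁻ β g h)))) refl)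

  walk-≗ : ∀ n u {α β} → α ≗ β → walk n u α ≈ walk n u β
  walk-≗ = walk-cong endK-cong

  endK-0 : ∀ u α → fin u ≡ 𝟘 → endK u α ≈ 0#
  endK-0 u α e = *-zeroˡ (trans (reflexive (≡.cong ⟦_⟧ e)) ⟦𝟘⟧)

  endK-bad : ∀ u α g → ρ g (α (node g false)) (α (node g true)) ≡ false → endK u α ≈ 0#
  endK-bad u α g e = *-zeroʳ (reflexive (≡.cong (λ b → when b 1#)
    (≢true (λ h → false≢true (≡.trans (≡.sym e) (okK⁻ α g h))))))

  ⟦⟧-0 : ∀ {z} → z ≡ 𝟘 → ⟦ z ⟧ ≈ 0#
  ⟦⟧-0 e = trans (reflexive (≡.cong ⟦_⟧ e)) ⟦𝟘⟧

  ⟦if1⟧ : ∀ b → ⟦ if1 b ⟧ ≈ when b 1#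
  ⟦if1⟧ true = ⟦𝟙⟧
  ⟦if1⟧ false = ⟦𝟘⟧

  opaque
    unfolding walk

    -- Visited nodes remain visited, so the violated constraint is still violated wherever the walk
    -- ends.
    blocked-leaf : ∀ n v α τ p → α (Y τ p) ≡ false → α (Z τ p) ≡ false → walk n v α ≈ 0#
    blocked-leaf n v α τ p y z = go n v α y z
      where
      bad : ∀ (α : KNode → Bool) → α (Y τ p) ≡ false → α (Z τ p) ≡ false → α (Y τ p) ∨ α (Z τ p) ≡ false
      bad α y z rewrite y = z
      go : ∀ n v (α : KNode → Bool) → α (Y τ p) ≡ false → α (Z τ p) ≡ false → walk n v α ≈ 0#
      go zero v α y z = endK-bad v α (leaf (mkLeaf τ p)) (bad α y z)
      go (suc n) v α y z = trans (+-zeroʳ (endK-bad v α (leaf (mkLeaf τ p)) (bad α y z)))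
        (∑-0 nodesK (λ w → when-0 (α w) (*-zeroʳ (go n w (α ∖ w) (∖-false α w y) (∖-false α w z)))))

    -- Only a later visit to `W` could restore the constraint, but `W` is out of reach from the
    -- position k on.
    blocked-rule : ∀ n v α p k q u → α (W p k q u) ≡ true → α (R p k q u) ≡ false → toℕ k ≤ pos v → walk n v α ≈ 0#
    blocked-rule n v α p k q u = go n v α
      where
      bad : ∀ (α : KNode → Bool) → α (W p k q u) ≡ true → α (R p k q u) ≡ false → not (α (W p k q u) xor α (R p k q u)) ≡ false
      bad α y z rewrite y | z = ≡.refl
      go : ∀ n v (α : KNode → Bool) → α (W p k q u) ≡ true → α (R p k q u) ≡ false → toℕ k ≤ pos v → walk n v α ≈ 0#
      go zero v α y z le = endK-bad v α (rule (mkRule p k q u)) (bad α y z)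
      go (suc n) v α y z le = trans (+-zeroʳ (endK-bad v α (rule (mkRule p k q u)) (bad α y z)))
        (∑-0 nodesK (λ w → when-0 (α w) (step w)))
        where
        step : ∀ w → ⟦ lab v w ⟧ * walk n w (α ∖ w) ≈ 0#
        step w with w ≟K (W p k q u)
        step w | yes ≡.refl with lab-W v p k q u
        ... | inj₁ e = *-zeroˡ (⟦⟧-0 e)
        ... | inj₂ lt = ⊥-elim (ℕₚ.<-irrefl ≡.refl (ℕₚ.<-≤-trans lt le))
        step w | no w≢ with lab-pos v w
        ... | inj₁ e = *-zeroˡ (⟦⟧-0 e)
        ... | inj₂ lt = *-zeroʳ (go n w (α ∖ w) (≡.trans (∖-other α (w≢ ∘ ≡.sym)) y) (∖-false α w z) (ℕₚ.≤-trans le lt))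

  opaque
    unfolding nodesK

    ∑-nodesK : ∀ (f : KNode → Carrier) → ∑ nodesK f ≈
      ∑ rules (λ t → f (node (rule t) false) + f (node (rule t) true)) +
      (∑ leaves (λ t → f (node (leaf t) false) + f (node (leaf t) true)) +
      (∑ gates (λ i → f (Gt i) + f (Gt' i)) + ∑ launches (λ p → f (St p) + f (St' p))))
    ∑-nodesK f = trans (reflexive (∑-map node' (cartesianProduct groups bools) f))
      (trans (∑-cartesianProduct groups bools (f ∘ node')) (trans (∑-cong groups (λ g → +-congˡ (+-identityʳ _)))
      (trans (part rule rules (map leaf leaves ++ (map gate gates ++ map launch launches))) (+-congˡ
      (trans (part leaf leaves (map gate gates ++ map launch launches)) (+-congˡ
      (trans (part gate gates (map launch launches)) (+-congˡ (reflexive (∑-map launch launches h))))))))))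
      where
      h : Group → Carrier
      h g = f (node g false) + f (node g true)
      part : ∀ {B : Set} (c : B → Group) (xs : List B) (ys : List Group) → ∑ (map c xs ++ ys) h ≈ ∑ xs (h ∘ c) + ∑ ys h
      part c xs ys = trans (∑-++ (map c xs) ys h) (+-congʳ (reflexive (∑-map c xs h)))

  module _ (e : Fin m → Bool) where

    ℓe : Letter → Carrier
    ℓe (inj₁ b) = when (e b) 1#
    ℓe (inj₂ u) = ⟦ letter u ⟧

    unblocked : Letter → Bool
    unblocked (inj₁ b) = e b
    unblocked (inj₂ u) = true

    ℓe-unblocked : ∀ τ → unblocked τ ≡ true → ⟦ ℓ τ ⟧ ≈ ℓe τ
    ℓe-unblocked (inj₁ b) h rewrite h = ⟦𝟙⟧
    ℓe-unblocked (inj₂ u) h = refl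

    ℓe-blocked : ∀ τ → unblocked τ ≡ false → ℓe τ ≈ 0#
    ℓe-blocked (inj₁ b) h rewrite h = refl

    -- The words that the nonterminal x derives at the positions p, …, q − 1
    val : ℕ → ℕ → X → ℕ → Carrier
    val zero p x q = 0#
    val (suc n) p x q =
      ∑ rules (λ { t@(mkRule p' k q' u) →
        ⟦ into p x q (node (rule t) false) ⟧ * (val n p (left u) (toℕ k) * val n (toℕ k) (right u) q) }) +
      ∑ leaves (λ { t@(mkLeaf τ p') → ⟦ into p x q (node (leaf t) false) ⟧ * ℓe τ })

    -- The invariant before a derivation on [p, q). Nothing is said about rules split at q or later:
    -- some of them are pending, with `W` visited and `R` not yet, and they form the stack.
    record Ready (p q : ℕ) (α : KNode → Bool) : Set where
      field
        closed : ∀ p' k q' u → toℕ k ≤ p → α (W p' k q' u) ≡ α (R p' k q' u)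
        openW : ∀ p' k q' u → p < toℕ k → toℕ k < q → α (W p' k q' u) ≡ true
        openR : ∀ p' k q' u → p < toℕ k → toℕ k < q → α (R p' k q' u) ≡ true
        past : ∀ τ p' → toℕ p' < p → α (Y τ p') ∨ α (Z τ p') ≡ true
        fresh : ∀ τ p' → p ≤ toℕ p' → toℕ p' < q → α (Y τ p') ≡ true
        bits : ∀ τ p' → α (Z τ p') ≡ unblocked τ

    -- α' arises from α by a derivation that ends at position q
    record Frame (q : ℕ) (α α' : KNode → Bool) : Set where
      field
        sameW : ∀ p' k q' u → q ≤ toℕ k → α' (W p' k q' u) ≡ α (W p' k q' u)
        sameR : ∀ p' k q' u → q ≤ toℕ k → α' (R p' k q' u) ≡ α (R p' k q' u)
        sameY : ∀ τ p' → q ≤ toℕ p' → α' (Y τ p') ≡ α (Y τ p')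
        sameZ : ∀ τ p' → α' (Z τ p') ≡ α (Z τ p')
        closed : ∀ p' k q' u → toℕ k < q → α' (W p' k q' u) ≡ α' (R p' k q' u)
        past : ∀ τ p' → toℕ p' < q → α' (Y τ p') ∨ α' (Z τ p') ≡ true

    -- A continuation: `C` is the value of everything after the position q. It has to be the same
    -- for every outcome `α'` of the derivation, and therefore can be factored out on the right of
    -- the sum over all derivations.
    Cont : ℕ → ℕ → (KNode → Bool) → Carrier → Set _
    Cont N q α C = ∀ α' τ p' → suc (toℕ p') ≡ q → Frame q α α' → walk N (Y τ p') α' ≈ ⟦ ℓ τ ⟧ * C

    state-step : ∀ M p x q v α → (∀ w → lab v w ≡ into p x q w) → fin v ≡ 𝟘 →
      walk (suc M) v α ≈
        ∑ rules (λ t → let w = node (rule t) false in when (α w) (⟦ into p x q w ⟧ * walk M w (α ∖ w))) +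
        ∑ leaves (λ t → let w = node (leaf t) false in when (α w) (⟦ into p x q w ⟧ * walk M w (α ∖ w)))
    state-step M p x q v α lv fv = trans (reflexive (walk-step M v α)) (trans (+-zeroʳ (endK-0 v α fv))
      (trans (∑-nodesK f) (+-cong
        (∑-cong rules (λ t → trans (+-zeroʳ (zz (node (rule t) true) (into-R t))) (eq (node (rule t) false))))
        (trans (+-zeroʳ (trans (+-zeroˡ (∑-0 gates (λ i → trans (+-zeroˡ (zz (Gt i) ≡.refl)) (zz (Gt' i) ≡.refl))))
            (∑-0 launches (λ i → trans (+-zeroˡ (zz (St i) ≡.refl)) (zz (St' i) ≡.refl)))))
          (∑-cong leaves (λ t → trans (+-zeroʳ (zz (node (leaf t) true) (into-Z t))) (eq (node (leaf t) false))))))))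
      where
      into-R : ∀ t → into p x q (node (rule t) true) ≡ 𝟘
      into-R (mkRule _ _ _ _) = ≡.refl
      into-Z : ∀ t → into p x q (node (leaf t) true) ≡ 𝟘
      into-Z (mkLeaf _ _) = ≡.refl
      f : KNode → Carrier
      f w = when (α w) (⟦ lab v w ⟧ * walk M w (α ∖ w))
      zz : ∀ w → into p x q w ≡ 𝟘 → f w ≈ 0#
      zz w h = when-0 (α w) (*-zeroˡ (⟦⟧-0 (≡.trans (lv w) h)))
      eq : ∀ w → f w ≈ when (α w) (⟦ into p x q w ⟧ * walk M w (α ∖ w))
      eq w = when-cong (α w) (λ _ → *-congʳ (reflexive (≡.cong ⟦_⟧ (lv w))))

    hub-step : ∀ M τ p α → walk (suc M) (Y τ p) α ≈
      ∑ rules (λ t → let w = node (rule t) true in when (α w) (⟦ lab (Y τ p) w ⟧ * walk M w (α ∖ w))) + endK (Y τ p) α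
    hub-step M τ p α = trans (reflexive (walk-step M v α)) (+-congʳ
      (trans (∑-nodesK f) (trans (+-zeroʳ
          (trans (+-zeroˡ (∑-0 leaves (λ t → trans (+-zeroˡ (zz (node (leaf t) false) (lab-leaf t false))) (zz (node (leaf t) true) (lab-leaf t true)))))
          (trans (+-zeroˡ (∑-0 gates (λ i → trans (+-zeroˡ (zz (Gt i) ≡.refl)) (zz (Gt' i) ≡.refl))))
            (∑-0 launches (λ i → trans (+-zeroˡ (zz (St i) ≡.refl)) (zz (St' i) ≡.refl))))))
        (∑-cong rules (λ t → +-zeroˡ (zz (node (rule t) false) (lab-W' t)))))))
      where
      v = Y τ p
      lab-leaf : ∀ t b → lab v (node (leaf t) b) ≡ 𝟘
      lab-leaf (mkLeaf _ _) false = ≡.refl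
      lab-leaf (mkLeaf _ _) true = ≡.refl
      lab-W' : ∀ t → lab v (node (rule t) false) ≡ 𝟘
      lab-W' (mkRule _ _ _ _) = ≡.refl
      f : KNode → Carrier
      f w = when (α w) (⟦ lab v w ⟧ * walk M w (α ∖ w))
      zz : ∀ w → lab v w ≡ 𝟘 → f w ≈ 0#
      zz w h = when-0 (α w) (*-zeroˡ (⟦⟧-0 h))

    module _ where
      open import Data.Nat using () renaming (_+_ to _+ⁿ_; _*_ to _*ⁿ_)

      fuel-split : ∀ j j' N → suc (j +ⁿ j') *ⁿ 3 +ⁿ N ≡ suc (j *ⁿ 3) +ⁿ suc (suc (j' *ⁿ 3) +ⁿ N)
      fuel-split = solve 3 (λ j j' N → (con 1 :+ (j :+ j')) :* con 3 :+ N :=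
          (con 1 :+ j :* con 3) :+ (con 1 :+ ((con 1 :+ j' :* con 3) :+ N))) ≡.refl
        where open Data.Nat.Solver.+-*-Solver

      split-lengths : ∀ p k q i → q ≡ p +ⁿ suc i → p < k → k < q →
        ∃ λ j → ∃ λ j' → k ≡ p +ⁿ suc j × q ≡ k +ⁿ suc j' × i ≡ suc (j +ⁿ j')
      split-lengths p k q i q≡ p<k k<q with ℕₚ.m≤n⇒∃[o]m+o≡n p<k | ℕₚ.m≤n⇒∃[o]m+o≡n k<q
      ... | j , ej | j' , ej' = j , j' , ≡.trans (≡.sym ej) (≡.sym (ℕₚ.+-suc p j)) , ≡.trans (≡.sym ej') (≡.sym (ℕₚ.+-suc k j')) ,
        ℕₚ.suc-injective (ℕₚ.+-cancelˡ-≡ p _ _ (≡.trans (≡.sym q≡) (≡.trans (≡.sym ej') (≡.trans (≡.cong (λ k → suc k +ⁿ j') (≡.sym ej))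
          (solve 3 (λ p j j' → (con 2 :+ (p :+ j)) :+ j' := p :+ (con 2 :+ (j :+ j'))) ≡.refl p j j')))))
        where open Data.Nat.Solver.+-*-Solver

    -- A binary tree with i + 1 leaves takes i + 1 visits to nodes `Y` and i visits each to nodes
    -- `W` and `R`, hence the fuel 3 i + 1. The node `v` enters only through its labels, which
    -- covers launching, left parts and right parts alike.
    derive : ∀ n i → i < n → ∀ p x q → q ≡ p ℕ.+ suc i → q ≤ D → ∀ N C v α →
      (∀ w → lab v w ≡ into p x q w) → fin v ≡ 𝟘 → Ready p q α → Cont N q α C →
      walk (suc (i ℕ.* 3) ℕ.+ N) v α ≈ val n p x q * C
    derive (suc n) i (s≤s i≤n) p x q q≡ q≤D N C v α lv fv ready cont = begin
      walk (suc (i ℕ.* 3) ℕ.+ N) v α ≈⟨ state-step (i ℕ.* 3 ℕ.+ N) p x q v α lv fv ⟩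
      _ ≈⟨ +-cong (∑-cong rules (λ { (mkRule p' k q' u) → rule-term p' k q' u }))
                  (∑-cong leaves (λ { (mkLeaf τ p') → leaf-term τ p' })) ⟩
      _ ≈⟨ +-cong (∑-*ʳ C rules _) (∑-*ʳ C leaves _) ⟨
      _ ≈⟨ distribʳ C _ _ ⟨
      val (suc n) p x q * C ∎
      where
      M = i ℕ.* 3 ℕ.+ N
      leaf-term : ∀ τ p' → when (α (Y τ p')) (⟦ into p x q (Y τ p') ⟧ * walk M (Y τ p') (α ∖ Y τ p')) ≈
        ⟦ into p x q (Y τ p') ⟧ * ℓe τ * C
      leaf-term τ p' with (toℕ p' ≡ᵇ p) in e₁ | q ≡ᵇ suc p in e₂
      ... | false | _ = trans (when-0 (α (Y τ p')) (*-zeroˡ ⟦𝟘⟧)) (sym (*-zeroˡ (*-zeroˡ ⟦𝟘⟧)))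
      ... | true | false = trans (when-0 (α (Y τ p')) (*-zeroˡ ⟦𝟘⟧)) (sym (*-zeroˡ (*-zeroˡ ⟦𝟘⟧)))
      ... | true | true = trans (when-true alive)
              (trans (*-congˡ emitted) (sym (*-assoc _ _ _)))
        where
        open Ready ready
        p'≡ : toℕ p' ≡ p
        p'≡ = ≡ᵇ⇒≡ e₁
        q≡' : q ≡ suc p
        q≡' = ≡ᵇ⇒≡ e₂
        p'<q : toℕ p' < q
        p'<q = ℕₚ.≤-reflexive (≡.trans (≡.cong suc p'≡) (≡.sym q≡'))
        alive : α (Y τ p') ≡ true
        alive = fresh τ p' (ℕₚ.≤-reflexive (≡.sym p'≡)) p'<q
        i≡0 : i ≡ 0
        i≡0 = ℕₚ.suc-injective (ℕₚ.+-cancelˡ-≡ p _ _ (≡.trans (≡.sym q≡) (≡.trans q≡' (ℕₚ.+-comm 1 p))))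
        fuel : M ≡ N
        fuel rewrite i≡0 = ≡.refl
        emitted : walk M (Y τ p') (α ∖ Y τ p') ≈ ℓe τ * C
        -- For a false bit the node `Z τ p'` was used up by the guess, so after visiting `Y τ p'`
        -- the leaf can never satisfy its constraint.
        emitted with unblocked τ in eu
        ... | false = trans (blocked-leaf M _ _ τ p' (∖-self α _) (≡.trans (∖-other α (λ ())) (≡.trans (bits τ p') eu)))
                (sym (*-zeroˡ (ℓe-blocked τ eu)))
        ... | true = trans (reflexive (≡.cong (λ k → walk k (Y τ p') (α ∖ Y τ p')) fuel))
                (trans (cont (α ∖ Y τ p') τ p' (≡.trans (≡.cong suc p'≡) (≡.sym q≡')) frame) (*-congʳ (ℓe-unblocked τ eu)))
          where
          zalive : ∀ p'' → (α ∖ Y τ p') (Z τ p'') ≡ true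
          zalive p'' = ≡.trans (∖-other α (λ ())) (≡.trans (bits τ p'') eu)
          below : ∀ {k} → k < q → k ≤ p
          below lt = ℕₚ.≤-pred (≡.subst (_ <_) q≡' lt)
          frame : Frame q α (α ∖ Y τ p')
          frame = record
            { sameW = λ _ _ _ _ _ → ∖-other α (λ ())
            ; sameR = λ _ _ _ _ _ → ∖-other α (λ ())
            ; sameY = λ τ' p'' le → ∖-other α (λ { ≡.refl → ℕₚ.<-irrefl ≡.refl (ℕₚ.<-≤-trans p'<q le) })
            ; sameZ = λ _ _ → ∖-other α (λ ())
            ; closed = λ a k b u lt → ≡.trans (∖-other α (λ ())) (≡.trans (closed a k b u (below lt)) (≡.sym (∖-other α (λ ()))))
            ; past = λ τ' p'' lt → pastY τ' p'' lt ((Y τ' p'') ≟K (Y τ p')) }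
            where
            pastY : ∀ τ' p'' → toℕ p'' < q → Dec ((KNode ∋ Y τ' p'') ≡ Y τ p') →
              (α ∖ Y τ p') (Y τ' p'') ∨ (α ∖ Y τ p') (Z τ' p'') ≡ true
            pastY τ' p'' lt (yes ≡.refl) = ≡.trans (≡.cong ((α ∖ Y τ p') (Y τ' p'') ∨_) (zalive p'')) (𝔹ₚ.∨-zeroʳ _)
            pastY τ' p'' lt (no ne) = ≡.trans (≡.cong₂ _∨_ (∖-other α ne) (∖-other α (λ ())))
              (old (ℕₚ.m≤n⇒m<n∨m≡n (below lt)))
              where
              old : toℕ p'' < p ⊎ toℕ p'' ≡ p → α (Y τ' p'') ∨ α (Z τ' p'') ≡ true
              old (inj₁ lt') = past τ' p'' lt'
              old (inj₂ eq) = ≡.cong (_∨ α (Z τ' p'')) (fresh τ' p'' (ℕₚ.≤-reflexive (≡.sym eq)) lt)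
      rule-term : ∀ p' k q' u → when (α (W p' k q' u)) (⟦ into p x q (W p' k q' u) ⟧ * walk M (W p' k q' u) (α ∖ W p' k q' u)) ≈
        ⟦ into p x q (W p' k q' u) ⟧ * (val n p (left u) (toℕ k) * val n (toℕ k) (right u) q) * C
      rule-term p' k q' u with splits p q (toℕ p') (toℕ k) (toℕ q') in e
      ... | false = trans (when-0 (α (W p' k q' u)) (*-zeroˡ ⟦𝟘⟧)) (sym (*-zeroˡ (*-zeroˡ ⟦𝟘⟧)))
      ... | true with splits⁻ {p} {q} {toℕ p'} {toℕ k} {toℕ q'} e
      ...   | ≡.refl , ≡.refl , p<k , k<q with split-lengths (toℕ p') (toℕ k) (toℕ q') i q≡ p<k k<q
      ...     | j , j' , k≡ , q≡' , ≡.refl = trans (when-true (openW p' k q' u p<k k<q))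
                (trans (*-congˡ expand) (sym (*-assoc _ _ _)))
        where
        open Ready ready
        Wκ = KNode ∋ W p' k q' u
        Rκ = KNode ∋ R p' k q' u
        α₁ = α ∖ Wκ
        N₁ = suc (suc (j' ℕ.* 3) ℕ.+ N)
        C₁ = val n (toℕ k) (right u) (toℕ q') * C
        j<n : j < n
        j<n = ℕₚ.≤-trans (s≤s (ℕₚ.m≤m+n j j')) i≤n
        j'<n : j' < n
        j'<n = ℕₚ.≤-trans (s≤s (ℕₚ.m≤n+m j' j)) i≤n
        ≢W : ∀ {a k' b u'} → toℕ k' ≢ toℕ k → (KNode ∋ W a k' b u') ≢ Wκ
        ≢W ne ≡.refl = ne ≡.refl
        ready₁ : Ready (toℕ p') (toℕ k) α₁
        ready₁ = record
          { closed = λ a k' b u' le → ≡.trans (∖-other α (≢W (λ eq → ℕₚ.<-irrefl eq (ℕₚ.≤-<-trans le p<k))))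
              (≡.trans (closed a k' b u' le) (≡.sym (∖-other α (λ ()))))
          ; openW = λ a k' b u' lt lt' → ≡.trans (∖-other α (≢W (λ eq → ℕₚ.<-irrefl eq lt')))
              (openW a k' b u' lt (ℕₚ.<-trans lt' k<q))
          ; openR = λ a k' b u' lt lt' → ≡.trans (∖-other α (λ ())) (openR a k' b u' lt (ℕₚ.<-trans lt' k<q))
          ; past = λ τ a lt → ≡.trans (≡.cong₂ _∨_ (∖-other α (λ ())) (∖-other α (λ ()))) (past τ a lt)
          ; fresh = λ τ a le lt → ≡.trans (∖-other α (λ ())) (fresh τ a le (ℕₚ.<-trans lt k<q))
          ; bits = λ τ a → ≡.trans (∖-other α (λ ())) (bits τ a) }
        -- Popping the stack: once the left part is finished, the rule started last is the one to be
        -- resumed, and the right part is derived with the original continuation.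
        cont₁ : Cont N₁ (toℕ k) α₁ C₁
        cont₁ α' τ p'' p''≡ frame = begin
          walk N₁ (Y τ p'') α' ≈⟨ hub-step M' τ p'' α' ⟩
          ∑ rules term + endK (Y τ p'') α' ≈⟨ +-zeroʳ (endK-0 (Y τ p'') α' not-last) ⟩
          ∑ rules term ≈⟨ ∑-single term rules-! (∈-rules κ) (λ {t} → wrong t) ⟩
          term κ ≈⟨ trans (when-true aliveR) (*-cong (reflexive (≡.cong ⟦_⟧ resume)) second) ⟩
          ⟦ ℓ τ ⟧ * C₁ ∎
          where
          module F = Frame frame
          M' = suc (j' ℕ.* 3) ℕ.+ N
          κ : Rule
          κ = mkRule p' k q' u
          term : Rule → Carrier
          term t = when (α' (node (rule t) true)) (⟦ lab (Y τ p'') (node (rule t) true) ⟧ * walk M' (node (rule t) true) (α' ∖ (node (rule t) true)))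
          not-last : fin (Y τ p'') ≡ 𝟘
          not-last = ≡.cong (λ b → if b then ℓ τ else 𝟘)
            (≡ᵇ-≢ (λ eq → ℕₚ.<-irrefl (≡.trans (≡.sym p''≡) eq) (ℕₚ.<-≤-trans k<q q≤D)))
          aliveR : α' Rκ ≡ true
          aliveR = ≡.trans (F.sameR p' k q' u ℕₚ.≤-refl) (≡.trans (∖-other α (λ ())) (openR p' k q' u p<k k<q))
          resume : lab (Y τ p'') Rκ ≡ ℓ τ
          resume = ≡.cong (λ b → if b then ℓ τ else 𝟘) (≡.cong₂ _∧_
            (≡.trans (≡.cong (toℕ k ≡ᵇ_) p''≡) (≡ᵇ-refl (toℕ k))) (<⇒<ᵇ≡true k<q))
          -- Any other rule split at k lies strictly inside the interval and was untouched at its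
          -- start, so its `W` is unvisited and already out of reach; resuming it is fatal.
          wrong : ∀ t → t ≢ κ → term t ≈ 0#
          wrong t@(mkRule a k' b u') t≢ with toℕ k' ≡ᵇ suc (toℕ p'') in e'
          ... | false = when-0 (α' (node (rule t) true)) (*-zeroˡ ⟦𝟘⟧)
          ... | true = when-0 (α' (node (rule t) true)) (*-zeroʳ (blocked-rule M' _ _ a k' b u'
                  (≡.trans (∖-other α' (λ ())) aliveW) (∖-self α' _) ℕₚ.≤-refl))
            where
            k'≡ : toℕ k' ≡ toℕ k
            k'≡ = ≡.trans (≡ᵇ⇒≡ {toℕ k'} e') p''≡
            aliveW : α' (W a k' b u') ≡ true
            aliveW = ≡.trans (F.sameW a k' b u' (ℕₚ.≤-reflexive (≡.sym k'≡)))
              (≡.trans (∖-other α (λ { ≡.refl → t≢ ≡.refl }))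
                (openW a k' b u' (≡.subst (toℕ p' <_) (≡.sym k'≡) p<k) (≡.subst (_< toℕ q') (≡.sym k'≡) k<q)))
          α₂ = α' ∖ Rκ
          ready₂ : Ready (toℕ k) (toℕ q') α₂
          ready₂ = record
            { closed = λ a k' b u' le → cl a k' b u' (ℕₚ.m≤n⇒m<n∨m≡n le) ((KNode ∋ R a k' b u') ≟K Rκ)
            ; openW = λ a k' b u' lt lt' → ≡.trans (∖-other α' (λ ())) (≡.trans (F.sameW a k' b u' (ℕₚ.<⇒≤ lt))
                (≡.trans (∖-other α (≢W (λ eq → ℕₚ.<-irrefl (≡.sym eq) lt))) (openW a k' b u' (ℕₚ.<-trans p<k lt) lt')))
            ; openR = λ a k' b u' lt lt' → ≡.trans (∖-other α' (λ { ≡.refl → ℕₚ.<-irrefl ≡.refl lt }))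
                (≡.trans (F.sameR a k' b u' (ℕₚ.<⇒≤ lt)) (≡.trans (∖-other α (λ ())) (openR a k' b u' (ℕₚ.<-trans p<k lt) lt')))
            ; past = λ τ a lt → ≡.trans (≡.cong₂ _∨_ (∖-other α' (λ ())) (∖-other α' (λ ()))) (F.past τ a lt)
            ; fresh = λ τ a le lt → ≡.trans (∖-other α' (λ ())) (≡.trans (F.sameY τ a le)
                (≡.trans (∖-other α (λ ())) (fresh τ a (ℕₚ.≤-trans (ℕₚ.<⇒≤ p<k) le) lt)))
            ; bits = λ τ a → ≡.trans (∖-other α' (λ ())) (≡.trans (F.sameZ τ a) (≡.trans (∖-other α (λ ())) (bits τ a))) }
            where
            -- Among the rules split at exactly k, only the resumed one has been used, at both of
            -- its nodes; for all the others both nodes are still alive.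
            cl : ∀ a k' b u' → toℕ k' < toℕ k ⊎ toℕ k' ≡ toℕ k → Dec ((KNode ∋ R a k' b u') ≡ Rκ) →
              α₂ (W a k' b u') ≡ α₂ (R a k' b u')
            cl a k' b u' _ (yes ≡.refl) = ≡.trans (∖-other α' (λ ()))
              (≡.trans (F.sameW a k' b u' ℕₚ.≤-refl) (≡.trans (∖-self α Wκ) (≡.sym (∖-self α' Rκ))))
            cl a k' b u' (inj₁ lt) (no ne) = ≡.trans (∖-other α' (λ ())) (≡.trans (F.closed a k' b u' lt) (≡.sym (∖-other α' ne)))
            cl a k' b u' (inj₂ eq) (no ne) = ≡.trans
              (≡.trans (∖-other α' (λ ())) (≡.trans (F.sameW a k' b u' k≤) (≡.trans (∖-other α (λ { ≡.refl → ne ≡.refl }))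
                (openW a k' b u' p<k' k'<q))))
              (≡.sym (≡.trans (∖-other α' ne) (≡.trans (F.sameR a k' b u' k≤) (≡.trans (∖-other α (λ ()))
                (openR a k' b u' p<k' k'<q)))))
              where
              k≤ = ℕₚ.≤-reflexive (≡.sym eq)
              p<k' = ≡.subst (toℕ p' <_) (≡.sym eq) p<k
              k'<q = ≡.subst (_< toℕ q') (≡.sym eq) k<q
          cont₂ : Cont N (toℕ q') α₂ C
          cont₂ α'' τ' a a≡ frame' = cont α'' τ' a a≡ (record
            { sameW = λ a k' b u' le → ≡.trans (F'.sameW a k' b u' le) (≡.trans (∖-other α' (λ ()))
                (≡.trans (F.sameW a k' b u' (k≤ le)) (∖-other α (≢W (λ eq → ℕₚ.<-irrefl (≡.sym eq) (ℕₚ.<-≤-trans k<q le))))))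
            ; sameR = λ a k' b u' le → ≡.trans (F'.sameR a k' b u' le)
                (≡.trans (∖-other α' (λ { ≡.refl → ℕₚ.<-irrefl ≡.refl (ℕₚ.<-≤-trans k<q le) }))
                (≡.trans (F.sameR a k' b u' (k≤ le)) (∖-other α (λ ()))))
            ; sameY = λ τ a le → ≡.trans (F'.sameY τ a le) (≡.trans (∖-other α' (λ ()))
                (≡.trans (F.sameY τ a (k≤ le)) (∖-other α (λ ()))))
            ; sameZ = λ τ a → ≡.trans (F'.sameZ τ a) (≡.trans (∖-other α' (λ ())) (≡.trans (F.sameZ τ a) (∖-other α (λ ()))))
            ; closed = F'.closed
            ; past = F'.past })
            where
            module F' = Frame frame'
            k≤ : ∀ {a} → toℕ q' ≤ a → toℕ k ≤ a
            k≤ le = ℕₚ.≤-trans (ℕₚ.<⇒≤ k<q) le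
          second : walk M' Rκ α₂ ≈ C₁
          second = derive n j' j'<n (toℕ k) (right u) (toℕ q') q≡' q≤D N C Rκ α₂ (λ w → ≡.refl) ≡.refl ready₂ cont₂
        expand : walk M Wκ α₁ ≈ val n (toℕ p') (left u) (toℕ k) * val n (toℕ k) (right u) (toℕ q') * C
        expand = trans (reflexive (≡.cong (λ f → walk f Wκ α₁) (fuel-split j j' N)))
          (trans (derive n j j<n (toℕ p') (left u) (toℕ k) k≡ (ℕₚ.≤-trans (ℕₚ.<⇒≤ k<q) q≤D) N₁ C₁ Wκ α₁ (λ w → ≡.refl) ≡.refl ready₁ cont₁)
            (sym (*-assoc _ _ _)))

-- Summation over the bits by the initial segment of the walk

module Guessing {c ℓᵣ : Level} (𝓡 : Semiring c ℓᵣ) (d m r : ℕ)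
  {a x : Level} {A : Set a} {X : Set x} (𝟘 𝟙 : A) (⟦_⟧ : A → Semiring.Carrier 𝓡)
  (⟦𝟘⟧ : Semiring._≈_ 𝓡 ⟦ 𝟘 ⟧ (Semiring.0# 𝓡)) (⟦𝟙⟧ : Semiring._≈_ 𝓡 ⟦ 𝟙 ⟧ (Semiring.1# 𝓡))
  (left right : Fin r → X) (wT : X → Nodes.Letter d m r → A) (wB : X → Fin r → A)
  (letter : Fin r → A) (root : X) (g0 : A) where
  open import Data.List using (_∷ʳ_)
  open Nodes d m r
  open Semiring 𝓡 hiding (zero)
  open Sums 𝓡
  open Labels 𝟘 𝟙 left right wT wB letter root g0
  open import Relation.Binary.Reasoning.Setoid setoid
  open Derive 𝓡 d m r 𝟘 𝟙 ⟦_⟧ ⟦𝟘⟧ ⟦𝟙⟧ left right wT wB letter root g0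
  open Alive _≟K_ hiding (bit; none)
  open Walk 𝓡 _≟K_ nodesK (λ u v → ⟦ lab u v ⟧) endK
  private module FA {n : ℕ} = Alive (Finₚ._≟_ {n})

  assignment : List Bool → Fin m → Bool
  assignment es b = nth es (toℕ b)

  -- The nodes still alive when the gate Gt (length bs) is reached after guessing the bits bs
  gateState : List Bool → KNode → Bool
  gateState bs (Gt j) = length bs <ᵇ toℕ j
  gateState bs (Z τ p) = unblocked (assignment bs) τ
  gateState bs _ = true

  gateState-ok : ∀ bs → okK (gateState bs) ≡ true
  gateState-ok bs = okK⁺ (gateState bs) good
    where
    good : ∀ g → ρ g (gateState bs (node g false)) (gateState bs (node g true)) ≡ true
    good (rule (mkRule _ _ _ _)) = ≡.refl
    good (leaf (mkLeaf _ _)) = ≡.refl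
    good (gate _) = ≡.refl
    good (launch _) = ≡.refl

  module _ (es : List Bool) where

    private
      e = assignment es

    launched : Fin D → KNode → Bool
    launched p = gateState es ∖ St p

    launch-ready : ∀ p → Ready e (toℕ p) D (launched p)
    launch-ready p = record
      { closed = λ _ _ _ _ _ → ≡.trans (∖-other _ (λ ())) (≡.sym (∖-other _ (λ ())))
      ; openW = λ _ _ _ _ _ _ → ∖-other _ (λ ())
      ; openR = λ _ _ _ _ _ _ → ∖-other _ (λ ())
      ; past = λ τ a lt → ≡.cong (_∨ launched p (Z τ a)) (∖-other (gateState es) (λ ()))
      ; fresh = λ _ _ _ _ → ∖-other _ (λ ())
      ; bits = λ { (inj₁ b) a → ∖-other _ (λ ()) ; (inj₂ u) a → ∖-other _ (λ ()) } }

    -- At the position D the walk must end: a rule to be resumed there would need D < q, whereas all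
    -- positions are at most D. The frame then shows that every constraint is met.
    launch-cont : ∀ N p → Cont e N D (launched p) 1#
    launch-cont N p α' τ p' p'≡ frame = go N
      where
      open Frame frame
      α = launched p
      ok : okK α' ≡ true
      ok = okK⁺ α' good
        where
        good : ∀ g → ρ g (α' (node g false)) (α' (node g true)) ≡ true
        good (rule (mkRule a k b u)) = ≡.trans (≡.cong (λ z → not (z xor α' (R a k b u))) (eq (ℕₚ.<-≤-connex (toℕ k) D)))
          (≡.cong not (𝔹ₚ.xor-same (α' (R a k b u))))
          where
          eq : toℕ k < D ⊎ D ≤ toℕ k → α' (W a k b u) ≡ α' (R a k b u)
          eq (inj₁ lt) = closed a k b u lt
          eq (inj₂ le) = ≡.trans (sameW a k b u le) (≡.trans (∖-other _ (λ ()))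
            (≡.sym (≡.trans (sameR a k b u le) (∖-other _ (λ ())))))
        good (leaf (mkLeaf τ a)) = past τ a (Finₚ.toℕ<n a)
        good (gate _) = ≡.refl
        good (launch _) = ≡.refl
      end : endK (Y τ p') α' ≈ ⟦ ℓ τ ⟧ * 1#
      end = *-cong (reflexive (≡.cong (λ b → ⟦ if b then ℓ τ else 𝟘 ⟧)
        (≡.trans (≡.cong (_≡ᵇ D) p'≡) (≡ᵇ-refl D)))) (when-true ok)
      go : ∀ N → walk N (Y τ p') α' ≈ ⟦ ℓ τ ⟧ * 1#
      go zero = trans (reflexive (walk-zero _ _)) end
      go (suc N) = trans (hub-step e N τ p' α') (trans (+-zeroˡ (∑-0 rules none)) end)
        where
        none : ∀ t → when (α' (node (rule t) true)) (⟦ lab (Y τ p') (node (rule t) true) ⟧ * walk N (node (rule t) true) (α' ∖ node (rule t) true)) ≈ 0#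
        none (mkRule a k b u) = when-0 (α' (R a k b u)) (*-zeroˡ (⟦⟧-0
          (≡.cong (λ z → if z then ℓ τ else 𝟘) (≢true no-resume))))
          where
          no-resume : ((toℕ k ≡ᵇ suc (toℕ p')) ∧ (toℕ k <ᵇ toℕ b)) ≢ true
          no-resume h with ∧-true {toℕ k ≡ᵇ suc (toℕ p')} h
          ... | h₁ , h₂ = ℕₚ.<-irrefl (≡.trans (≡ᵇ⇒≡ {toℕ k} h₁) p'≡)
            (ℕₚ.<-≤-trans (ℕₚ.<ᵇ⇒< (toℕ k) (toℕ b) (≡.subst T (≡.sym h₂) _)) (ℕₚ.≤-pred (Finₚ.toℕ<n b)))

    launch-val : ∀ N p → D ℕ.* 3 ≤ N → walk N (St p) (launched p) ≈ val e D (toℕ p) root D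
    launch-val N p le with ℕₚ.m≤n⇒∃[o]m+o≡n (Finₚ.toℕ<n p)
    ... | i , eq = trans (reflexive (≡.cong (λ k → walk k (St p) (launched p)) (≡.sym (ℕₚ.m+[n∸m]≡n fuel≤))))
        (trans (derive e D i i<D (toℕ p) root D (≡.trans (≡.sym eq) (≡.sym (ℕₚ.+-suc (toℕ p) i))) ℕₚ.≤-refl
            (N ℕ.∸ suc (i ℕ.* 3)) 1# (St p) (launched p) (λ w → ≡.refl) ≡.refl (launch-ready p) (launch-cont _ p))
          (*-identityʳ _))
      where
      i<D : i < D
      i<D = ≡.subst (i <_) eq (s≤s (ℕₚ.m≤n+m i (toℕ p)))
      fuel≤ : suc (i ℕ.* 3) ≤ N
      fuel≤ = ℕₚ.≤-trans (ℕₚ.≤-trans (s≤s (ℕₚ.m≤n+m (i ℕ.* 3) 2)) (ℕₚ.*-monoˡ-≤ 3 i<D)) le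

    value : Carrier
    value = ∑ launches (λ p → val e D (toℕ p) root D) + ⟦ g0 ⟧

    last-gate : ∀ N (i : Fin (suc m)) → toℕ i ≡ m → D ℕ.* 3 ≤ N → walk (suc N) (Gt i) (gateState es) ≈ value
    last-gate N i i≡ le = trans (reflexive (walk-step N (Gt i) (gateState es))) (+-cong
      (trans (∑-nodesK f) (trans (+-zeroˡ (∑-0 rules (λ { (mkRule _ _ _ _) → trans (+-zeroˡ (zz (W _ _ _ _) ⟦𝟘⟧)) (zz (R _ _ _ _) ⟦𝟘⟧) })))
        (trans (+-zeroˡ (∑-0 leaves (λ { (mkLeaf τ p) → trans (+-zeroˡ (zz (Y τ p) ⟦𝟘⟧)) (zz (Z τ p) (no-Z τ p)) })))
        (trans (+-zeroˡ (∑-0 gates (λ j → trans (+-zeroˡ (zz (Gt j) (no-Gt j))) (zz (Gt' j) ⟦𝟘⟧))))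
        (∑-cong launches (λ p → trans (+-zeroʳ (zz (St' p) ⟦𝟘⟧)) (trans (*-congʳ one) (trans (*-identityˡ _) (launch-val N p le)))))))))
      (trans (*-cong (reflexive (≡.cong (λ b → ⟦ if b then g0 else 𝟘 ⟧) i≡ᵇ)) (when-true (gateState-ok es))) (*-identityʳ _)))
      where
      f : KNode → Carrier
      f w = when (gateState es w) (⟦ lab (Gt i) w ⟧ * walk N w (gateState es ∖ w))
      zz : ∀ w → ⟦ lab (Gt i) w ⟧ ≈ 0# → f w ≈ 0#
      zz w h = when-0 (gateState es w) (*-zeroˡ h)
      i≡ᵇ : (toℕ i ≡ᵇ m) ≡ true
      i≡ᵇ = ≡.trans (≡.cong (_≡ᵇ m) i≡) (≡ᵇ-refl m)
      one : ⟦ if1 (toℕ i ≡ᵇ m) ⟧ ≈ 1#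
      one = trans (⟦if1⟧ _) (when-true i≡ᵇ)
      no-Z : ∀ τ p → ⟦ lab (Gt i) (Z τ p) ⟧ ≈ 0#
      no-Z (inj₁ b) p = trans (⟦if1⟧ _) (when-false (≡.cong (_∧ (toℕ p ≡ᵇ 0))
        (≡ᵇ-≢ (λ h → ℕₚ.<-irrefl (≡.trans h i≡) (Finₚ.toℕ<n b)))))
      no-Z (inj₂ u) p = ⟦𝟘⟧
      no-Gt : ∀ j → ⟦ lab (Gt i) (Gt j) ⟧ ≈ 0#
      no-Gt j = trans (⟦if1⟧ _) (when-false (≡ᵇ-≢ (λ h → ℕₚ.<-irrefl (≡.trans h (≡.cong suc i≡)) (Finₚ.toℕ<n j))))

  only-step : ∀ N v w α → fin v ≡ 𝟘 → α w ≡ true → ⟦ lab v w ⟧ ≈ 1# → (∀ x → x ≢ w → α x ≡ true → ⟦ lab v x ⟧ ≈ 0#) →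
    walk (suc N) v α ≈ walk N w (α ∖ w)
  only-step N v w α fv αw one others = trans (reflexive (walk-step N v α)) (trans (+-zeroʳ (endK-0 v α fv))
    (trans (∑-single f nodesK-! (∈-nodesK w) (λ {x} x≢ → trans (when-cong (α x) (λ αx → *-zeroˡ (others x x≢ αx))) (when-0 (α x) refl)))
      (trans (when-true αw) (trans (*-congʳ one) (*-identityˡ _)))))
    where
    f : KNode → Carrier
    f x = when (α x) (⟦ lab v x ⟧ * walk N x (α ∖ x))

  <ᵇ-step : ∀ n j → j ≢ suc n → (n <ᵇ j) ≡ (suc n <ᵇ j)
  <ᵇ-step n zero ne = ≡.refl
  <ᵇ-step zero (suc zero) ne = ⊥-elim (ne ≡.refl)
  <ᵇ-step zero (suc (suc j)) ne = ≡.refl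
  <ᵇ-step (suc n) (suc j) ne = <ᵇ-step n j (ne ∘ ≡.cong suc)

  module Guess (bs : List Bool) (b : Fin m) (b≡ : toℕ b ≡ length bs) where

    next : Fin (suc m)
    next = suc b

    length-∷ʳ : ∀ c → length (bs ∷ʳ c) ≡ suc (length bs)
    length-∷ʳ c = ≡.trans (Listₚ.length-++ bs) (ℕₚ.+-comm (length bs) 1)

    next-gates : ∀ c j → (gateState bs ∖ Gt next) (Gt j) ≡ gateState (bs ∷ʳ c) (Gt j)
    next-gates c j = go (j Finₚ.≟ next)
      where
      go : Dec (j ≡ next) → (gateState bs ∖ Gt next) (Gt j) ≡ (length (bs ∷ʳ c) <ᵇ toℕ j)
      go (yes ≡.refl) = ≡.trans (∖-self (gateState bs) (Gt next))
        (≡.sym (≡.trans (≡.cong₂ _<ᵇ_ (length-∷ʳ c) (≡.cong suc b≡)) (<ᵇ-irrefl (length bs))))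
      go (no j≢) = ≡.trans (∖-other (gateState bs) (λ { ≡.refl → j≢ ≡.refl }))
        (≡.trans (<ᵇ-step (length bs) (toℕ j) (λ h → j≢ (Finₚ.toℕ-injective (≡.trans h (≡.cong suc (≡.sym b≡))))))
          (≡.cong (_<ᵇ toℕ j) (≡.sym (length-∷ʳ c))))

    keep-state : (gateState bs ∖ Gt next) ≗ gateState (bs ∷ʳ true)
    keep-state (W _ _ _ _) = ∖-other _ (λ ())
    keep-state (R _ _ _ _) = ∖-other _ (λ ())
    keep-state (Y _ _) = ∖-other _ (λ ())
    keep-state (Z (inj₁ b') p) = ≡.trans (∖-other _ (λ ())) (≡.sym (nth-∷ʳ-true bs (toℕ b')))
    keep-state (Z (inj₂ u) p) = ∖-other _ (λ ())
    keep-state (Gt j) = next-gates true j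
    keep-state (Gt' _) = ∖-other _ (λ ())
    keep-state (St _) = ∖-other _ (λ ())
    keep-state (St' _) = ∖-other _ (λ ())

    -- After visiting Z (inj₁ b) p for all p < n
    blockZ : ℕ → Letter → Fin D → Bool
    blockZ n (inj₁ b') p = if does (b' Finₚ.≟ b) then n ≤ᵇ toℕ p else nth bs (toℕ b')
    blockZ n (inj₂ u) p = true

    blockState : ℕ → KNode → Bool
    blockState n (Z τ p) = blockZ n τ p
    blockState n v = gateState bs v

    nth-length : ∀ bs → nth bs (length bs) ≡ true
    nth-length [] = ≡.refl
    nth-length (_ ∷ bs) = nth-length bs

    block-0 : gateState bs ≗ blockState 0
    block-0 (W _ _ _ _) = ≡.refl
    block-0 (R _ _ _ _) = ≡.refl
    block-0 (Y _ _) = ≡.refl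
    block-0 (Z (inj₁ b') p) with b' Finₚ.≟ b
    ... | yes ≡.refl = ≡.trans (≡.cong (nth bs) b≡) (nth-length bs)
    ... | no _ = ≡.refl
    block-0 (Z (inj₂ u) p) = ≡.refl
    block-0 (Gt _) = ≡.refl
    block-0 (Gt' _) = ≡.refl
    block-0 (St _) = ≡.refl
    block-0 (St' _) = ≡.refl

    ≤ᵇ-step : ∀ n j → j ≢ n → (n ≤ᵇ j) ≡ (suc n ≤ᵇ j)
    ≤ᵇ-step zero zero ne = ⊥-elim (ne ≡.refl)
    ≤ᵇ-step zero (suc j) ne = ≡.refl
    ≤ᵇ-step (suc n) j ne = <ᵇ-step n j ne

    block-suc : ∀ p → (blockState (toℕ p) ∖ Z (inj₁ b) p) ≗ blockState (suc (toℕ p))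
    block-suc p (W _ _ _ _) = ∖-other _ (λ ())
    block-suc p (R _ _ _ _) = ∖-other _ (λ ())
    block-suc p (Y _ _) = ∖-other _ (λ ())
    block-suc p (Z (inj₂ u) _) = ∖-other _ (λ ())
    block-suc p (Gt _) = ∖-other _ (λ ())
    block-suc p (Gt' _) = ∖-other _ (λ ())
    block-suc p (St _) = ∖-other _ (λ ())
    block-suc p (St' _) = ∖-other _ (λ ())
    block-suc p (Z (inj₁ b') p') = go (b' Finₚ.≟ b) (p' Finₚ.≟ p)
      where
      go : Dec (b' ≡ b) → Dec (p' ≡ p) → (blockState (toℕ p) ∖ Z (inj₁ b) p) (Z (inj₁ b') p') ≡ blockZ (suc (toℕ p)) (inj₁ b') p'
      go (yes ≡.refl) (yes ≡.refl) = ≡.trans (∖-self (blockState (toℕ p)) (Z (inj₁ b) p)) (≡.sym eq)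
        where
        eq : blockZ (suc (toℕ p)) (inj₁ b) p ≡ false
        eq rewrite FA.==-refl b = <ᵇ-irrefl (toℕ p)
      go (yes ≡.refl) (no p'≢) = ≡.trans (∖-other (blockState (toℕ p)) (λ { ≡.refl → p'≢ ≡.refl })) eq
        where
        eq : blockZ (toℕ p) (inj₁ b) p' ≡ blockZ (suc (toℕ p)) (inj₁ b) p'
        eq rewrite FA.==-refl b = ≤ᵇ-step (toℕ p) (toℕ p') (p'≢ ∘ Finₚ.toℕ-injective)
      go (no b'≢) _ = ≡.trans (∖-other (blockState (toℕ p)) (λ { ≡.refl → b'≢ ≡.refl })) eq
        where
        eq : blockZ (toℕ p) (inj₁ b') p' ≡ blockZ (suc (toℕ p)) (inj₁ b') p'
        eq rewrite FA.==-≢ b'≢ = ≡.refl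

    block-D : (blockState D ∖ Gt next) ≗ gateState (bs ∷ʳ false)
    block-D (W _ _ _ _) = ∖-other _ (λ ())
    block-D (R _ _ _ _) = ∖-other _ (λ ())
    block-D (Y _ _) = ∖-other _ (λ ())
    block-D (Z (inj₂ u) _) = ∖-other _ (λ ())
    block-D (Gt j) = ≡.trans (≡.trans (∖-def (blockState D) (Gt next) (Gt j)) (≡.sym (∖-def (gateState bs) (Gt next) (Gt j))))
      (next-gates false j)
    block-D (Gt' _) = ∖-other _ (λ ())
    block-D (St _) = ∖-other _ (λ ())
    block-D (St' _) = ∖-other _ (λ ())
    block-D (Z (inj₁ b') p) = ≡.trans (∖-other (blockState D) (λ ())) (go (b' Finₚ.≟ b))
      where
      go : Dec (b' ≡ b) → blockZ D (inj₁ b') p ≡ nth (bs ∷ʳ false) (toℕ b')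
      go (yes ≡.refl) rewrite FA.==-refl b = ≡.trans
        (≢true (λ h → ℕₚ.<-irrefl ≡.refl (ℕₚ.<-≤-trans (Finₚ.toℕ<n p) (ℕₚ.≤ᵇ⇒≤ D (toℕ p) (≡.subst T (≡.sym h) _)))))
        (≡.sym (≡.trans (≡.cong (nth (bs ∷ʳ false)) b≡) (nth-∷ʳ-length bs false)))
      go (no b'≢) rewrite FA.==-≢ b'≢ = ≡.sym (nth-∷ʳ-≢ bs false (toℕ b')
        (λ h → b'≢ (Finₚ.toℕ-injective (≡.trans h (≡.sym b≡)))))

    block-chain : ∀ k p N → suc (toℕ p) ℕ.+ k ≡ D →
      walk (suc k ℕ.+ N) (Z (inj₁ b) p) (blockState (suc (toℕ p))) ≈ walk N (Gt next) (gateState (bs ∷ʳ false))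
    block-chain zero p N eq = trans (only-step N (Z (inj₁ b) p) (Gt next) (blockState (suc (toℕ p))) ≡.refl alive one others)
      (walk-≗ N (Gt next) (λ x → ≡.trans (≡.cong (λ n → (blockState n ∖ Gt next) x) p≡) (block-D x)))
      where
      p≡ : suc (toℕ p) ≡ D
      p≡ = ≡.trans (≡.sym (ℕₚ.+-identityʳ _)) eq
      alive : (length bs <ᵇ suc (toℕ b)) ≡ true
      alive = <⇒<ᵇ≡true (ℕₚ.≤-reflexive (≡.cong suc (≡.sym b≡)))
      lastᵇ : (suc (toℕ p) ≡ᵇ D) ≡ true
      lastᵇ = ≡.trans (≡.cong (_≡ᵇ D) p≡) (≡ᵇ-refl D)
      one : ⟦ lab (Z (inj₁ b) p) (Gt next) ⟧ ≈ 1#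
      one = trans (⟦if1⟧ _) (when-true (≡.cong₂ _∧_ lastᵇ (≡ᵇ-refl (toℕ b))))
      others : ∀ x → x ≢ Gt next → blockState (suc (toℕ p)) x ≡ true → ⟦ lab (Z (inj₁ b) p) x ⟧ ≈ 0#
      others (Gt j) ne _ = trans (⟦if1⟧ _) (when-false (≡.trans
        (≡.cong ((suc (toℕ p) ≡ᵇ D) ∧_) (≡ᵇ-≢ (λ h → ne (≡.cong (λ j → Gt j) (Finₚ.toℕ-injective h))))) (𝔹ₚ.∧-zeroʳ _)))
      others (Z (inj₁ b') p') ne _ = trans (⟦if1⟧ _) (when-false (≡.trans
        (≡.cong ((toℕ b' ≡ᵇ toℕ b) ∧_) (≡ᵇ-≢ (λ h → ℕₚ.<-irrefl (≡.trans h p≡) (Finₚ.toℕ<n p')))) (𝔹ₚ.∧-zeroʳ _)))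
      others (Z (inj₂ u) p') ne _ = ⟦𝟘⟧
      others (W _ _ _ _) ne _ = ⟦𝟘⟧
      others (R _ _ _ _) ne _ = ⟦𝟘⟧
      others (Y _ _) ne _ = ⟦𝟘⟧
      others (Gt' _) ne _ = ⟦𝟘⟧
      others (St _) ne _ = ⟦𝟘⟧
      others (St' _) ne _ = ⟦𝟘⟧
    block-chain (suc k) p N eq = trans
      (only-step (suc k ℕ.+ N) (Z (inj₁ b) p) (Z (inj₁ b) p⁺) (blockState (suc (toℕ p))) ≡.refl alive one others)
      (trans (walk-≗ (suc k ℕ.+ N) (Z (inj₁ b) p⁺) (λ x → ≡.trans (≡.cong (λ n → (blockState n ∖ Z (inj₁ b) p⁺) x) (≡.sym p⁺≡)) (block-suc p⁺ x)))
        (block-chain k p⁺ N (≡.trans (≡.cong (λ n → suc n ℕ.+ k) p⁺≡) (≡.trans (≡.sym (ℕₚ.+-suc (suc (toℕ p)) k)) eq))))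
      where
      p<D : suc (toℕ p) < D
      p<D = ≡.subst (suc (toℕ p) <_) eq (ℕₚ.m<m+n (suc (toℕ p)) (s≤s z≤n))
      p⁺ : Fin D
      p⁺ = Fin.fromℕ< p<D
      p⁺≡ : toℕ p⁺ ≡ suc (toℕ p)
      p⁺≡ = Finₚ.toℕ-fromℕ< p<D
      alive : blockZ (suc (toℕ p)) (inj₁ b) p⁺ ≡ true
      alive rewrite FA.==-refl b = <⇒<ᵇ≡true (ℕₚ.≤-reflexive (≡.sym p⁺≡))
      one : ⟦ lab (Z (inj₁ b) p) (Z (inj₁ b) p⁺) ⟧ ≈ 1#
      one = trans (⟦if1⟧ _) (when-true (≡.cong₂ _∧_ (≡ᵇ-refl (toℕ b)) (≡.trans (≡.cong (_≡ᵇ suc (toℕ p)) p⁺≡) (≡ᵇ-refl (suc (toℕ p))))))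
      others : ∀ x → x ≢ Z (inj₁ b) p⁺ → blockState (suc (toℕ p)) x ≡ true → ⟦ lab (Z (inj₁ b) p) x ⟧ ≈ 0#
      others (Gt j) ne _ = trans (⟦if1⟧ _) (when-false (≡.cong (_∧ (toℕ j ≡ᵇ suc (toℕ b))) (≡ᵇ-≢ (ℕₚ.<⇒≢ p<D))))
      others (Z (inj₁ b') p') ne _ = trans (⟦if1⟧ _) (when-false (≢true λ h →
        ne (≡.cong₂ (λ b p → Z (inj₁ b) p) (Finₚ.toℕ-injective (≡ᵇ⇒≡ (proj₁ (∧-true {toℕ b' ≡ᵇ toℕ b} h))))
          (Finₚ.toℕ-injective (≡.trans (≡ᵇ⇒≡ {toℕ p'} (proj₂ (∧-true {toℕ b' ≡ᵇ toℕ b} h))) (≡.sym p⁺≡))))))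
      others (Z (inj₂ u) p') ne _ = ⟦𝟘⟧
      others (W _ _ _ _) ne _ = ⟦𝟘⟧
      others (R _ _ _ _) ne _ = ⟦𝟘⟧
      others (Y _ _) ne _ = ⟦𝟘⟧
      others (Gt' _) ne _ = ⟦𝟘⟧
      others (St _) ne _ = ⟦𝟘⟧
      others (St' _) ne _ = ⟦𝟘⟧

    -- Going straight to the next gate keeps the bit true; the detour through all nodes
    -- `Z (inj₁ b) p` uses them up and makes it false.
    guess-step : ∀ N (i : Fin (suc m)) → toℕ i ≡ length bs →
      walk (suc (D ℕ.+ N)) (Gt i) (gateState bs) ≈
        walk N (Gt next) (gateState (bs ∷ʳ false)) + walk (D ℕ.+ N) (Gt next) (gateState (bs ∷ʳ true))
    guess-step N i i≡ = begin
      walk (suc (D ℕ.+ N)) (Gt i) α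
        ≈⟨ trans (reflexive (walk-step (D ℕ.+ N) (Gt i) α)) (+-zeroʳ (endK-0 (Gt i) α not-last)) ⟩
      ∑ nodesK f
        ≈⟨ ∑-among f (Z (inj₁ b) zero ∷ Gt next ∷ []) nodesK-! (((λ ()) ∷ []) AllPairs.∷ ([] AllPairs.∷ AllPairs.[])) (λ {y} _ → ∈-nodesK y) others ⟩
      f (Z (inj₁ b) zero) + (f (Gt next) + 0#) ≈⟨ +-cong left' (trans (+-identityʳ _) right') ⟩
      walk N (Gt next) (gateState (bs ∷ʳ false)) + walk (D ℕ.+ N) (Gt next) (gateState (bs ∷ʳ true)) ∎
      where
      α = gateState bs
      f : KNode → Carrier
      f w = when (α w) (⟦ lab (Gt i) w ⟧ * walk (D ℕ.+ N) w (α ∖ w))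
      i≡b : toℕ i ≡ toℕ b
      i≡b = ≡.trans i≡ (≡.sym b≡)
      i<m : toℕ i < m
      i<m = ≡.subst (_< m) (≡.sym i≡b) (Finₚ.toℕ<n b)
      not-last : fin (Gt i) ≡ 𝟘
      not-last = ≡.cong (λ z → if z then g0 else 𝟘) (≡ᵇ-≢ (ℕₚ.<⇒≢ i<m))
      left' : f (Z (inj₁ b) zero) ≈ walk N (Gt next) (gateState (bs ∷ʳ false))
      left' = trans (when-true (≡.trans (≡.cong (nth bs) b≡) (nth-length bs))) (trans
        (*-cong (trans (⟦if1⟧ _) (when-true (≡.cong (_∧ true) (≡.trans (≡.cong (_≡ᵇ toℕ i) (≡.sym i≡b)) (≡ᵇ-refl (toℕ i))))))
          (trans (walk-≗ (D ℕ.+ N) (Z (inj₁ b) zero) (λ x → ≡.trans (∖-cong (Z (inj₁ b) zero) block-0 x) (block-suc zero x)))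
            (block-chain d zero N ≡.refl)))
        (*-identityˡ _))
      right' : f (Gt next) ≈ walk (D ℕ.+ N) (Gt next) (gateState (bs ∷ʳ true))
      right' = trans (when-true (<⇒<ᵇ≡true (ℕₚ.≤-reflexive (≡.cong suc (≡.sym b≡))))) (trans
        (*-cong (trans (⟦if1⟧ _) (when-true (≡.trans (≡.cong (toℕ b ≡ᵇ_) i≡b) (≡ᵇ-refl (toℕ b)))))
          (walk-≗ (D ℕ.+ N) (Gt next) keep-state)) (*-identityˡ _))
      others : ∀ x → ¬ x ∈ (Z (inj₁ b) zero ∷ Gt next ∷ []) → f x ≈ 0#
      others x@(Gt j) x∉ = when-0 (α x) (*-zeroˡ (trans (⟦if1⟧ _) (when-false (≡ᵇ-≢
        (λ h → x∉ (there (here (≡.cong (λ j → Gt j) (Finₚ.toℕ-injective (≡.trans h (≡.cong suc i≡b)))))))))))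
      others x@(Z (inj₁ b') p) x∉ = when-0 (α x) (*-zeroˡ (trans (⟦if1⟧ _) (when-false (≢true λ h → x∉ (here
        (≡.cong₂ (λ b p → Z (inj₁ b) p) (Finₚ.toℕ-injective (≡.trans (≡ᵇ⇒≡ (proj₁ (∧-true {toℕ b' ≡ᵇ toℕ i} h))) i≡b))
          (Finₚ.toℕ-injective (≡ᵇ⇒≡ {toℕ p} {0} (proj₂ (∧-true {toℕ b' ≡ᵇ toℕ i} h))))))))))
      others x@(St p) x∉ = when-0 (α x) (*-zeroˡ (trans (⟦if1⟧ _) (when-false (≡ᵇ-≢ (ℕₚ.<⇒≢ i<m)))))
      others x@(Z (inj₂ u) p) x∉ = when-0 (α x) (*-zeroˡ ⟦𝟘⟧)
      others x@(W _ _ _ _) x∉ = when-0 (α x) (*-zeroˡ ⟦𝟘⟧)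
      others x@(R _ _ _ _) x∉ = when-0 (α x) (*-zeroˡ ⟦𝟘⟧)
      others x@(Y _ _) x∉ = when-0 (α x) (*-zeroˡ ⟦𝟘⟧)
      others x@(Gt' _) x∉ = when-0 (α x) (*-zeroˡ ⟦𝟘⟧)
      others x@(St' _) x∉ = when-0 (α x) (*-zeroˡ ⟦𝟘⟧)

  -- A false bit costs D + 1 steps and a true one a single step, so the branches continue with
  -- different fuel; hence only a lower bound on the fuel is required. The final D · 3 + 1 pays for
  -- the derivation.
  guess-bits : ∀ k bs (i : Fin (suc m)) N → toℕ i ≡ length bs → length bs ℕ.+ k ≡ m → k ℕ.* suc D ℕ.+ suc (D ℕ.* 3) ≤ N →
    walk N (Gt i) (gateState bs) ≈ ∑ (bitStrings k) (λ es → value (bs ++ es))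
  guess-bits zero bs i (suc N) i≡ eq (s≤s le) = trans
    (last-gate bs N i (≡.trans i≡ (≡.trans (≡.sym (ℕₚ.+-identityʳ _)) eq)) le)
    (trans (reflexive (≡.cong value (≡.sym (Listₚ.++-identityʳ bs)))) (sym (+-identityʳ _)))
  guess-bits (suc k) bs i N₀ i≡ eq le with ℕₚ.m≤n⇒∃[o]m+o≡n le
  ... | o , ≡.refl = begin
    walk (suc k ℕ.* suc D ℕ.+ suc (D ℕ.* 3) ℕ.+ o) (Gt i) (gateState bs)
      ≈⟨ reflexive (≡.cong (λ n → walk n (Gt i) (gateState bs)) (regroup D (k ℕ.* suc D) (suc (D ℕ.* 3)) o)) ⟩
    walk (suc (D ℕ.+ N)) (Gt i) (gateState bs) ≈⟨ guess-step N i i≡ ⟩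
    walk N (Gt next) (gateState (bs ∷ʳ false)) + walk (D ℕ.+ N) (Gt next) (gateState (bs ∷ʳ true))
      ≈⟨ +-cong (guess-bits k (bs ∷ʳ false) next N (len false) (len' false) (ℕₚ.m≤m+n _ o))
                (guess-bits k (bs ∷ʳ true) next (D ℕ.+ N) (len true) (len' true) (ℕₚ.≤-trans (ℕₚ.m≤m+n _ o) (ℕₚ.m≤n+m N D))) ⟩
    ∑ (bitStrings k) (λ es → value ((bs ∷ʳ false) ++ es)) + ∑ (bitStrings k) (λ es → value ((bs ∷ʳ true) ++ es))
      ≈⟨ +-cong (merge false) (merge true) ⟩
    ∑ (map (false ∷_) (bitStrings k)) (λ es → value (bs ++ es)) + ∑ (map (true ∷_) (bitStrings k)) (λ es → value (bs ++ es))
      ≈⟨ ∑-++ (map (false ∷_) (bitStrings k)) (map (true ∷_) (bitStrings k)) _ ⟨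
    ∑ (bitStrings (suc k)) (λ es → value (bs ++ es)) ∎
    where
    b<m : length bs < m
    b<m = ≡.subst (length bs <_) eq (ℕₚ.m<m+n (length bs) (s≤s z≤n))
    b : Fin m
    b = Fin.fromℕ< b<m
    open Guess bs b (Finₚ.toℕ-fromℕ< b<m)
    N = k ℕ.* suc D ℕ.+ suc (D ℕ.* 3) ℕ.+ o
    regroup : ∀ D x y o → suc D ℕ.+ x ℕ.+ y ℕ.+ o ≡ suc (D ℕ.+ (x ℕ.+ y ℕ.+ o))
    regroup = solve 4 (λ D x y o → con 1 :+ D :+ x :+ y :+ o := con 1 :+ (D :+ (x :+ y :+ o))) ≡.refl
      where open Data.Nat.Solver.+-*-Solver
    len : ∀ c → toℕ next ≡ length (bs ∷ʳ c)
    len c = ≡.trans (≡.cong suc (Finₚ.toℕ-fromℕ< b<m)) (≡.sym (length-∷ʳ c))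
    len' : ∀ c → length (bs ∷ʳ c) ℕ.+ k ≡ m
    len' c = ≡.trans (≡.cong (ℕ._+ k) (length-∷ʳ c)) (≡.trans (≡.sym (ℕₚ.+-suc (length bs) k)) eq)
    merge : ∀ c → ∑ (bitStrings k) (λ es → value ((bs ∷ʳ c) ++ es)) ≈ ∑ (map (c ∷_) (bitStrings k)) (λ es → value (bs ++ es))
    merge c = trans (∑-cong (bitStrings k) (λ es → reflexive (≡.cong value (Listₚ.++-assoc bs (c ∷ []) es))))
      (reflexive (≡.sym (∑-map (c ∷_) (bitStrings k) (λ es → value (bs ++ es)))))

  program : ∀ N → m ℕ.* suc D ℕ.+ suc (D ℕ.* 3) ≤ N →
    ∑ nodesK (λ w → ⟦ λ₀ w ⟧ * walk N w (allAlive ∖ w)) ≈ ∑ (bitStrings m) value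
  program N le = trans
    (∑-single _ nodesK-! (∈-nodesK (Gt zero)) (λ {x} → others x))
    (trans (*-congʳ ⟦𝟙⟧) (trans (*-identityˡ _) (trans (walk-≗ N (Gt zero) initial) (guess-bits m [] zero N ≡.refl ≡.refl le))))
    where
    initial : (allAlive ∖ Gt zero) ≗ gateState []
    initial (W _ _ _ _) = ∖-other _ (λ ())
    initial (R _ _ _ _) = ∖-other _ (λ ())
    initial (Y _ _) = ∖-other _ (λ ())
    initial (Z (inj₁ b) _) = ∖-other _ (λ ())
    initial (Z (inj₂ u) _) = ∖-other _ (λ ())
    initial (Gt zero) = ∖-self _ (Gt zero)
    initial (Gt (suc j)) = ∖-other _ (λ ())
    initial (Gt' _) = ∖-other _ (λ ())
    initial (St _) = ∖-other _ (λ ())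
    initial (St' _) = ∖-other _ (λ ())
    others : ∀ x → x ≢ Gt zero → ⟦ λ₀ x ⟧ * walk N x (allAlive ∖ x) ≈ 0#
    others (Gt zero) ne = ⊥-elim (ne ≡.refl)
    others (Gt (suc j)) ne = *-zeroˡ ⟦𝟘⟧
    others (W _ _ _ _) ne = *-zeroˡ ⟦𝟘⟧
    others (R _ _ _ _) ne = *-zeroˡ ⟦𝟘⟧
    others (Y _ _) ne = *-zeroˡ ⟦𝟘⟧
    others (Z _ _) ne = *-zeroˡ ⟦𝟘⟧
    others (Gt' _) ne = *-zeroˡ ⟦𝟘⟧
    others (St _) ne = *-zeroˡ ⟦𝟘⟧
    others (St' _) ne = *-zeroˡ ⟦𝟘⟧

-- The recursion characterising the values of the grammar

module Values {c ℓᵣ : Level} (𝓡 : Semiring c ℓᵣ) (d m r : ℕ)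
  {a x : Level} {A : Set a} {X : Set x} (𝟘 𝟙 : A) (⟦_⟧ : A → Semiring.Carrier 𝓡)
  (⟦𝟘⟧ : Semiring._≈_ 𝓡 ⟦ 𝟘 ⟧ (Semiring.0# 𝓡)) (⟦𝟙⟧ : Semiring._≈_ 𝓡 ⟦ 𝟙 ⟧ (Semiring.1# 𝓡))
  (left right : Fin r → X) (wT : X → Nodes.Letter d m r → A) (wB : X → Fin r → A)
  (letter : Fin r → A) (root : X) (g0 : A) where
  open Nodes d m r
  open Semiring 𝓡 hiding (zero)
  open Sums 𝓡
  open Labels 𝟘 𝟙 left right wT wB letter root g0
  open import Relation.Binary.Reasoning.Setoid setoid
  open Derive 𝓡 d m r 𝟘 𝟙 ⟦_⟧ ⟦𝟘⟧ ⟦𝟙⟧ left right wT wB letter root g0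

  opaque
    Ps : List (Fin (suc D))
    Ps = allFin (suc D)

    Ps≡ : Ps ≡ allFin (suc D)
    Ps≡ = ≡.refl

    ∑-Ps : ∀ p (p≤D : p ≤ D) (f : Fin (suc D) → Carrier) → ∑ Ps (λ i → when (toℕ i ≡ᵇ p) (f i)) ≈ f (Fin.fromℕ< (s≤s p≤D))
    ∑-Ps p p≤D = ∑-toℕ (suc D) p (s≤s p≤D)

  ∑-product₄ : ∀ {A B C E : Set} (as : List A) (bs : List B) (cs : List C) (es : List E) (f : A × B × C × E → Carrier) →
    ∑ (cartesianProduct as (cartesianProduct bs (cartesianProduct cs es))) f ≈
    ∑ as (λ x → ∑ bs (λ y → ∑ cs (λ z → ∑ es (λ w → f (x , y , z , w)))))
  ∑-product₄ as bs cs es f = trans (∑-cartesianProduct as (cartesianProduct bs (cartesianProduct cs es)) f)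
    (∑-cong as (λ x → trans (∑-cartesianProduct bs (cartesianProduct cs es) (λ t → f (x , t)))
      (∑-cong bs (λ y → ∑-cartesianProduct cs es (λ t → f (x , y , t))))))

  opaque
    unfolding rules Ps

    ∑-rules : ∀ (f : Rule → Carrier) → ∑ rules f ≈ ∑ Ps (λ p → ∑ Ps (λ k → ∑ Ps (λ q → ∑ (allFin r) (λ u → f (mkRule p k q u)))))
    ∑-rules f = trans (reflexive (∑-map rule' (cartesianProduct Ps (cartesianProduct Ps (cartesianProduct Ps (allFin r)))) f))
      (∑-product₄ Ps Ps Ps (allFin r) (f ∘ rule'))

    ∑-leaves : ∀ (f : Leaf → Carrier) → ∑ leaves f ≈ ∑ letters (λ τ → ∑ (allFin D) (λ p → f (mkLeaf τ p)))
    ∑-leaves f = trans (reflexive (∑-map leaf' (cartesianProduct letters (allFin D)) f))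
      (∑-cartesianProduct letters (allFin D) (f ∘ leaf'))

  inside : ℕ → ℕ → Fin (suc D) → Bool
  inside p q k = (p <ᵇ toℕ k) ∧ (toℕ k <ᵇ q)

  ⟦if⟧ : ∀ b z → ⟦ if b then z else 𝟘 ⟧ ≈ when b ⟦ z ⟧
  ⟦if⟧ true z = refl
  ⟦if⟧ false z = ⟦𝟘⟧

  module _ (e : Fin m → Bool) where

    combination : (ℕ → ℕ → X → Carrier) → ℕ → ℕ → X → Carrier
    combination h p q x =
      ∑ letters (λ τ → ⟦ wT x τ ⟧ * when (q ≡ᵇ suc p) (ℓe e τ)) +
      ∑ (allFin r) (λ u → ⟦ wB x u ⟧ * ∑ Ps (λ k → when (inside p q k) (h p (toℕ k) (left u) * h (toℕ k) q (right u))))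

    -- The indicators in `into` fix the end points, so the sum over all placed rules collapses to
    -- one over the gate `u` and the split k.
    val-step : ∀ n p q x → p < q → q ≤ D → val e (suc n) p x q ≈ combination (λ p q x → val e n p x q) p q x
    val-step n p q x p<q q≤D = trans (+-comm _ _) (+-cong leaf-part rule-part)
      where
      p<D : p < D
      p<D = ℕₚ.<-≤-trans p<q q≤D
      leaf-part : ∑ leaves _ ≈ ∑ letters (λ τ → ⟦ wT x τ ⟧ * when (q ≡ᵇ suc p) (ℓe e τ))
      leaf-part = trans (∑-leaves _) (∑-cong letters (λ τ → trans
        (∑-cong (allFin D) (λ p' → trans (*-congʳ (⟦if⟧ _ _)) (trans (when-*ʳ _ _ _) (trans
          (reflexive (when-∧ (toℕ p' ≡ᵇ p) (q ≡ᵇ suc p) _)) (when-cong (toℕ p' ≡ᵇ p) (λ _ → sym (when-*ˡ _ _ _)))))))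
        (∑-toℕ D p p<D _)))
      rule-part : ∑ rules _ ≈ ∑ (allFin r) (λ u → ⟦ wB x u ⟧ * ∑ Ps (λ k → when (inside p q k) (val e n p (left u) (toℕ k) * val e n (toℕ k) (right u) q)))
      rule-part = begin
        ∑ rules _ ≈⟨ ∑-rules _ ⟩
        ∑ Ps (λ p' → ∑ Ps (λ k → ∑ Ps (λ q' → ∑ (allFin r) (λ u → ⟦ into p x q (W p' k q' u) ⟧ * V k u))))
          ≈⟨ ∑-cong Ps (λ p' → ∑-cong Ps (λ k → trans (∑-cong Ps (λ q' → trans (∑-cong (allFin r) (term p' k q'))
               (trans (sym (∑-when (toℕ p' ≡ᵇ p) (allFin r) _)) (when-cong (toℕ p' ≡ᵇ p) (λ _ → sym (∑-when (toℕ q' ≡ᵇ q) (allFin r) _))))))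
               (trans (sym (∑-when (toℕ p' ≡ᵇ p) Ps _)) (when-cong (toℕ p' ≡ᵇ p) (λ _ → ∑-Ps q q≤D _))))) ⟩
        ∑ Ps (λ p' → ∑ Ps (λ k → when (toℕ p' ≡ᵇ p) (∑ (allFin r) (tm k))))
          ≈⟨ ∑-cong Ps (λ p' → sym (∑-when (toℕ p' ≡ᵇ p) Ps _)) ⟩
        ∑ Ps (λ p' → when (toℕ p' ≡ᵇ p) (∑ Ps (λ k → ∑ (allFin r) (tm k)))) ≈⟨ ∑-Ps p (ℕₚ.<⇒≤ p<D) _ ⟩
        ∑ Ps (λ k → ∑ (allFin r) (tm k)) ≈⟨ ∑-swap Ps (allFin r) tm ⟩
        ∑ (allFin r) (λ u → ∑ Ps (λ k → tm k u)) ≈⟨ ∑-cong (allFin r) (λ u → sym (∑-*ˡ ⟦ wB x u ⟧ Ps _)) ⟩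
        _ ∎
        where
        V : Fin (suc D) → Fin r → Carrier
        V k u = val e n p (left u) (toℕ k) * val e n (toℕ k) (right u) q
        tm : Fin (suc D) → Fin r → Carrier
        tm k u = ⟦ wB x u ⟧ * when (inside p q k) (V k u)
        term : ∀ p' k q' u → ⟦ into p x q (W p' k q' u) ⟧ * V k u ≈ when (toℕ p' ≡ᵇ p) (when (toℕ q' ≡ᵇ q) (tm k u))
        term p' k q' u = trans (*-congʳ (⟦if⟧ (splits p q (toℕ p') (toℕ k) (toℕ q')) _)) (trans (when-*ʳ _ _ _)
          (trans (reflexive (when-∧ (toℕ p' ≡ᵇ p) _ _)) (when-cong (toℕ p' ≡ᵇ p) (λ _ →
          trans (reflexive (when-∧ (toℕ q' ≡ᵇ q) _ _)) (when-cong (toℕ q' ≡ᵇ q) (λ _ → sym (when-*ˡ _ _ _)))))))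

    -- The recursion refers to strictly shorter intervals only, so it has one solution; the depth n
    -- must be at least q - p. It identifies derivations with the homogeneous components of gates.
    val-unique : ∀ (h : ℕ → ℕ → X → Carrier) → (∀ p q x → p < q → q ≤ D → h p q x ≈ combination h p q x) →
      ∀ n p q x → p < q → q ≤ D → q ≤ n ℕ.+ p → h p q x ≈ val e n p x q
    val-unique h eq zero p q x p<q q≤D q≤ = ⊥-elim (ℕₚ.<-irrefl ≡.refl (ℕₚ.<-≤-trans p<q q≤))
    val-unique h eq (suc n) p q x p<q q≤D q≤ = trans (eq p q x p<q q≤D) (trans
      (+-congˡ (∑-cong (allFin r) (λ u → *-congˡ (∑-cong Ps (λ k → when-cong (inside p q k) (λ c → both k u c))))))
      (sym (val-step n p q x p<q q≤D)))
      where
      both : ∀ k u → inside p q k ≡ true →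
        h p (toℕ k) (left u) * h (toℕ k) q (right u) ≈ val e n p (left u) (toℕ k) * val e n (toℕ k) (right u) q
      both k u c = *-cong
        (val-unique h eq n p (toℕ k) (left u) p<k (ℕₚ.≤-trans (ℕₚ.<⇒≤ k<q) q≤D) (ℕₚ.≤-pred (ℕₚ.<-≤-trans k<q q≤)))
        (val-unique h eq n (toℕ k) q (right u) k<q q≤D (ℕₚ.≤-trans q≤ (ℕₚ.≤-trans (ℕₚ.≤-reflexive (≡.sym (ℕₚ.+-suc n p))) (ℕₚ.+-monoʳ-≤ n p<k))))
        where
        p<k : p < toℕ k
        p<k = ℕₚ.<ᵇ⇒< p (toℕ k) (≡.subst T (≡.sym (proj₁ (∧-true {p <ᵇ toℕ k} c))) _)
        k<q : toℕ k < q
        k<q = ℕₚ.<ᵇ⇒< (toℕ k) q (≡.subst T (≡.sym (proj₂ (∧-true {p <ᵇ toℕ k} c))) _)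

-- The Hamiltonian cycle graph of a grammar

module Reduction {c ℓᵣ : Level} (𝓡 : Semiring c ℓᵣ) (d m r : ℕ)
  {a x : Level} {A : Set a} {X : Set x} (𝟘 𝟙 : A) (⟦_⟧ : A → Semiring.Carrier 𝓡)
  (⟦𝟘⟧ : Semiring._≈_ 𝓡 ⟦ 𝟘 ⟧ (Semiring.0# 𝓡)) (⟦𝟙⟧ : Semiring._≈_ 𝓡 ⟦ 𝟙 ⟧ (Semiring.1# 𝓡))
  (left right : Fin r → X) (wT : X → Nodes.Letter d m r → A) (wB : X → Fin r → A)
  (letter : Fin r → A) (root : X) (g0 : A) where
  open Nodes d m r
  open Semiring 𝓡 hiding (zero)
  open Sums 𝓡
  open import Relation.Binary.Reasoning.Setoid setoid hiding (start)

  lookup-injective : ∀ {A : Set} {xs : List A} → Unique xs → ∀ {i j} → lookup xs i ≡ lookup xs j → i ≡ j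
  lookup-injective (px ∷ uq) {zero} {zero} e = ≡.refl
  lookup-injective {xs = x ∷ xs} (px ∷ uq) {zero} {suc j} e = ⊥-elim (All.lookup px (∈-lookup j) e)
  lookup-injective {xs = x ∷ xs} (px ∷ uq) {suc i} {zero} e = ⊥-elim (All.lookup px (∈-lookup i) (≡.sym e))
  lookup-injective (px ∷ uq) {suc i} {suc j} e = ≡.cong suc (lookup-injective uq e)

  map-lookup : ∀ {A : Set} (xs : List A) → map (lookup xs) (allFin (length xs)) ≡ xs
  map-lookup xs = ≡.trans (Listₚ.map-tabulate (λ i → i) (lookup xs)) (Listₚ.tabulate-lookup xs)

  none-map : ∀ {V V' : Set} (_≟_ : (x y : V) → Dec (x ≡ y)) (_≟'_ : (x y : V') → Dec (x ≡ y)) (φ : V → V') α xs →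
    Alive.none _≟_ (α ∘ φ) xs ≡ Alive.none _≟'_ α (map φ xs)
  none-map _≟_ _≟'_ φ α [] = ≡.refl
  none-map _≟_ _≟'_ φ α (x ∷ xs) = ≡.cong (not (α (φ x)) ∧_) (none-map _≟_ _≟'_ φ α xs)

  private
    G = length groups
    open Gadget.Vertices G
    open Labels 𝟘 𝟙 left right wT wB letter root g0

    φ : Node → KNode
    φ (g , b) = node (lookup groups g) b

    φ-injective : ∀ {v w} → φ v ≡ φ w → v ≡ w
    φ-injective {v} {w} e with node'-injective {lookup groups (proj₁ v) , proj₂ v} {lookup groups (proj₁ w) , proj₂ w} e
    ... | e' = ≡.cong₂ _,_ (lookup-injective groups-! (≡.cong proj₁ e')) (≡.cong proj₂ e')

    map-cartesianProduct : ∀ {A B C : Set} (f : A → B) (xs : List A) (ys : List C) →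
      map (λ (x , y) → f x , y) (cartesianProduct xs ys) ≡ cartesianProduct (map f xs) ys
    map-cartesianProduct f [] ys = ≡.refl
    map-cartesianProduct f (x ∷ xs) ys = ≡.trans (Listₚ.map-++ _ (map (x ,_) ys) (cartesianProduct xs ys))
      (≡.cong₂ _++_ (≡.sym (Listₚ.map-∘ ys)) (map-cartesianProduct f xs ys))

    opaque
      unfolding nodesK
      map-φ : map φ nodes ≡ nodesK
      map-φ = ≡.trans (Listₚ.map-∘ nodes) (≡.cong (map node')
        (≡.trans (map-cartesianProduct (lookup groups) (allFin G) bools) (≡.cong (λ gs → cartesianProduct gs bools) (map-lookup groups))))

    module S = Gadget.Simulation 𝓡 G 𝟘 𝟙 ⟦_⟧ ⟦𝟘⟧ ⟦𝟙⟧
      (λ v → λ₀ (φ v)) (λ v w → lab (φ v) (φ w)) (λ v → fin (φ v)) (λ g → ρ (lookup groups g))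
    module Dr = Derive 𝓡 d m r 𝟘 𝟙 ⟦_⟧ ⟦𝟘⟧ ⟦𝟙⟧ left right wT wB letter root g0
    module Gs = Guessing 𝓡 d m r 𝟘 𝟙 ⟦_⟧ ⟦𝟘⟧ ⟦𝟙⟧ left right wT wB letter root g0

    open Gadget.Vertices.Edges G 𝟘 𝟙 (λ v → λ₀ (φ v)) (λ v w → lab (φ v) (φ w)) (λ v → fin (φ v))
      (λ g → ρ (lookup groups g)) using (edge)

  size : ℕ
  size = length inner

  private
    N : ℕ
    N = suc size

    vtx : Fin N → Vtx
    vtx = lookup vertices

  label : Fin N → Fin N → A
  label i j = edge (vtx i) (vtx j)

  private

    endF : Fin N → (Fin N → Bool) → Carrier
    endF u α = when (Alive.none Finₚ._≟_ α (allFin N)) (S.E (vtx u) start)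

    module WM = WalkMap 𝓡 Finₚ._≟_ (allFin N) _≟V_ vtx (lookup-injective vertices-!) S.E endF S.endV
      (λ u e → when-≡ (Alive.none-cong Finₚ._≟_ (allFin N) e) refl)
      (λ u α → when-≡ (≡.trans (none-map Finₚ._≟_ _≟V_ vtx α (allFin N)) (≡.cong (Alive.none _≟V_ α) (map-lookup vertices))) refl)

    ok-cong : ∀ {α β} → α ≗ β → S.ok 0 α ≡ S.ok 0 β
    ok-cong e = allF-cong (λ g → ≡.cong₂ (ρ (lookup groups g)) (e _) (e _))

    opaque
      unfolding okK
      ok-okK : ∀ α → S.ok 0 (α ∘ φ) ≡ okK α
      ok-okK α = ≡.refl

    module WK = WalkMap 𝓡 _≟N_ nodes _≟K_ φ φ-injective (λ u v → ⟦ lab u v ⟧)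
      (λ u β → ⟦ fin (φ u) ⟧ * when (S.ok 0 β) 1#) Dr.endK
      (λ u {α} {β} e → *-congˡ (when-≡ (ok-cong e) refl))
      (λ u α → *-congˡ (when-≡ (ok-okK α) refl))

  reduction : Walk.walk 𝓡 Finₚ._≟_ (allFin (suc size)) (λ i j → ⟦ label i j ⟧)
      (λ u α → when (Alive.none Finₚ._≟_ α (allFin (suc size))) ⟦ label u zero ⟧) size zero (Alive._∖_ Finₚ._≟_ allAlive zero)
    ≈ ∑ (bitStrings m) Gs.value
  reduction = begin
    WM.W.walk (length inner) zero (AF._∖_ allAlive zero)
      ≈⟨ WM.W.walk-cong (λ u e → when-≡ (Alive.none-cong Finₚ._≟_ (allFin N) e) refl) (length inner) zero (WM.∖-φ allAlive zero) ⟨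
    WM.W.walk (length inner) zero (AV._∖_ allAlive start ∘ vtx) ≈⟨ WM.walk-map (length inner) zero (AV._∖_ allAlive start) ⟩
    WM.W'.walk (length inner) start (AV._∖_ allAlive start)
      ≈⟨ reflexive (≡.cong (λ vs → Walk.walk 𝓡 _≟V_ vs S.E S.endV (length inner) start (AV._∖_ allAlive start)) (map-lookup vertices)) ⟩
    Walk.walk 𝓡 _≟V_ vertices S.E S.endV (length inner) start (AV._∖_ allAlive start)
      ≈⟨ S.ham-walk fuel (ℕₚ.≤-trans (ℕₚ.m≤m+n (length inner) (length nodes)) (ℕₚ.m≤m+n (length inner ℕ.+ length nodes) bound)) (ℕₚ.≤-trans (ℕₚ.m≤n+m (length nodes) (length inner)) (ℕₚ.m≤m+n (length inner ℕ.+ length nodes) bound)) ⟩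
    ∑ nodes (λ w → ⟦ λ₀ (φ w) ⟧ * S.N.walk fuel w (AN._∖_ allAlive w))
      ≈⟨ ∑-cong nodes (λ w → *-congˡ (trans (sym (WK.W.walk-cong ends fuel w (WK.∖-φ allAlive w))) (WK.walk-map fuel w (AK._∖_ allAlive (φ w))))) ⟩
    ∑ nodes (λ w → ⟦ λ₀ (φ w) ⟧ * WK.W'.walk fuel (φ w) (AK._∖_ allAlive (φ w)))
      ≈⟨ reflexive (≡.sym (∑-map φ nodes (λ w → ⟦ λ₀ w ⟧ * WK.W'.walk fuel w (AK._∖_ allAlive w)))) ⟩
    ∑ (map φ nodes) (λ w → ⟦ λ₀ w ⟧ * WK.W'.walk fuel w (AK._∖_ allAlive w))
      ≈⟨ reflexive (≡.cong (λ vs → ∑ vs (λ w → ⟦ λ₀ w ⟧ * Walk.walk 𝓡 _≟K_ vs (λ u v → ⟦ lab u v ⟧) Dr.endK fuel w (AK._∖_ allAlive w))) map-φ) ⟩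
    ∑ nodesK (λ w → ⟦ λ₀ w ⟧ * Walk.walk 𝓡 _≟K_ nodesK (λ u v → ⟦ lab u v ⟧) Dr.endK fuel w (AK._∖_ allAlive w))
      ≈⟨ Gs.program fuel (ℕₚ.m≤n+m bound (length inner ℕ.+ length nodes)) ⟩
    ∑ (bitStrings m) Gs.value ∎
    where
    module AF = Alive (Finₚ._≟_ {N})
    module AK = Alive _≟K_
    bound = m ℕ.* suc D ℕ.+ suc (D ℕ.* 3)
    -- Adding the bounds makes one amount of fuel sufficient both for the gadget graph and for the
    -- program.
    fuel = (length inner ℕ.+ length nodes) ℕ.+ bound
    ends : ∀ u {α β} → α ≗ β → (⟦ fin (φ u) ⟧ * when (S.ok 0 α) 1#) ≈ (⟦ fin (φ u) ⟧ * when (S.ok 0 β) 1#)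
    ends u e = *-congˡ (when-≡ (ok-cong e) refl)

module Projection {c ℓ : Level} (F : CommutativeRing c ℓ) where
  open NC F
  open PolyAlg F
  open Semiring polySemiring hiding (zero)
  open Sums polySemiring
  open HamSum F using (subst-HC)
  open import Relation.Binary.Reasoning.Setoid setoid

  𝟘S 𝟙S : Subst
  𝟘S = const (CommutativeRing.0# F)
  𝟙S = const (CommutativeRing.1# F)

  -- The numbering i · n + j of the edges is inverted by division with remainder.
  edgeSubst : ∀ n → (Fin n → Fin n → Subst) → ℕ → Subst
  edgeSubst n f k with k ℕ.<? n ℕ.* n
  ... | yes k< = let (i , j) = Fin.remQuot n (Fin.fromℕ< k<) in f i j
  ... | no _ = var 0

  edgeSubst-xIdx : ∀ n f (i j : Fin n) → edgeSubst n f (xIdx i j) ≡ f i j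
  edgeSubst-xIdx n f i j with xIdx i j ℕ.<? n ℕ.* n
  ... | yes k< = ≡.cong (λ (i , j) → f i j) (≡.trans (≡.cong (Fin.remQuot n) combined) (Finₚ.remQuot-combine i j))
    where
    combined : Fin.fromℕ< k< ≡ Fin.combine i j
    combined = Finₚ.toℕ-injective (≡.trans (Finₚ.toℕ-fromℕ< k<)
      (≡.sym (≡.trans (Finₚ.toℕ-combine i j) (≡.cong (ℕ._+ toℕ j) (ℕₚ.*-comm n (toℕ i))))))
  ... | no k≮ = ⊥-elim (k≮ (≡.subst (_< n ℕ.* n)
    (≡.trans (Finₚ.toℕ-combine i j) (≡.cong (ℕ._+ toℕ j) (ℕₚ.*-comm n (toℕ i)))) (Finₚ.toℕ<n (Fin.combine i j))))

-- Circuits and homogeneous components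

module Circuits {c ℓ : Level} (F : CommutativeRing c ℓ) where
  open import Data.Vec using ([]; _∷_; _∷ʳ_)
  open NC F
  open PolyAlg F
  private module 𝔽 = CommutativeRing F
  private module 𝔽S = Sums 𝔽.semiring
  open Semiring polySemiring hiding (zero)
  open Sums polySemiring
  open import Relation.Binary.Reasoning.Setoid setoid

  -- References are plain numbers, so the codes of all gates share one type and keep their meaning
  -- when gates are appended.
  data Code : Set c where
    code-input : ℕ → Code
    code-const : 𝔽.Carrier → Code
    code-add code-mul : ℕ → ℕ → Code

  code : ∀ {k} → Gate k → Code
  code (input i) = code-input i
  code (cnst a) = code-const a
  code (add i j) = code-add (toℕ i) (toℕ j)
  code (mul i j) = code-mul (toℕ i) (toℕ j)

  apply : (ℕ → Poly) → Code → Poly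
  apply f (code-input i) = varP i
  apply f (code-const a) = constP a
  apply f (code-add i j) = f i +P f j
  apply f (code-mul i j) = f i *P f j

  codeAt : ∀ {k} → Circuit k → ℕ → Code
  codeAt [] x = code-const 𝔽.0#
  codeAt (_▷_ {k} C g) x = if x ≡ᵇ k then code g else codeAt C x

  valueAt : ∀ {k} → Circuit k → ℕ → Poly
  valueAt [] x = 0P
  valueAt (_▷_ {k} C g) x = if x ≡ᵇ k then apply (valueAt C) (code g) else valueAt C x

  lookup-∷ʳ : ∀ {a} {A : Set a} {k} (vs : Vec A k) v (i : Fin (suc k)) →
    (toℕ i ≡ k × Vec.lookup (vs ∷ʳ v) i ≡ v) ⊎ (∃ λ j → toℕ i ≡ toℕ j × Vec.lookup (vs ∷ʳ v) i ≡ Vec.lookup vs j)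
  lookup-∷ʳ [] v zero = inj₁ (≡.refl , ≡.refl)
  lookup-∷ʳ (w ∷ vs) v zero = inj₂ (zero , ≡.refl , ≡.refl)
  lookup-∷ʳ (w ∷ vs) v (suc i) with lookup-∷ʳ vs v i
  ... | inj₁ (e , e') = inj₁ (≡.cong suc e , e')
  ... | inj₂ (j , e , e') = inj₂ (suc j , ≡.cong suc e , e')

  valueAt-last : ∀ {k} (C : Circuit k) g → valueAt (C ▷ g) k ≡ apply (valueAt C) (code g)
  valueAt-last {k} C g rewrite ≡ᵇ-refl k = ≡.refl

  valueAt-old : ∀ {k} (C : Circuit k) g {x} → x < k → valueAt (C ▷ g) x ≡ valueAt C x
  valueAt-old C g lt rewrite ≡ᵇ-≢ (ℕₚ.<⇒≢ lt) = ≡.refl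

  evalAll-valueAt : ∀ {k} (C : Circuit k) i → Vec.lookup (evalAll C) i ≡ valueAt C (toℕ i)
  last-valueAt : ∀ {k} (C : Circuit (suc k)) → Vec.last (evalAll C) ≡ valueAt C k
  gate-value : ∀ {k} (C : Circuit k) (g : Gate k) → Vec.last (evalAll (C ▷ g)) ≡ apply (valueAt C) (code g)
  gate-value C (input i) = Vecₚ.last-∷ʳ _ (evalAll C)
  gate-value C (cnst a) = Vecₚ.last-∷ʳ _ (evalAll C)
  gate-value C (add i j) = ≡.trans (Vecₚ.last-∷ʳ _ (evalAll C)) (≡.cong₂ _+P_ (evalAll-valueAt C i) (evalAll-valueAt C j))
  gate-value C (mul i j) = ≡.trans (Vecₚ.last-∷ʳ _ (evalAll C)) (≡.cong₂ _*P_ (evalAll-valueAt C i) (evalAll-valueAt C j))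
  last-valueAt (C ▷ g) = ≡.trans (gate-value C g) (≡.sym (valueAt-last C g))
  evalAll-valueAt {suc k} (C ▷ g) i with lookup-∷ʳ (evalAll C) _ i
  ... | inj₁ (e , e') = ≡.trans e' (≡.trans (≡.sym (Vecₚ.last-∷ʳ _ (evalAll C)))
          (≡.trans (last-valueAt (C ▷ g)) (≡.cong (valueAt (C ▷ g)) (≡.sym e))))
  ... | inj₂ (j , e , e') = ≡.trans e' (≡.trans (evalAll-valueAt C j)
          (≡.trans (≡.sym (valueAt-old C g (Finₚ.toℕ<n j))) (≡.cong (valueAt (C ▷ g)) (≡.sym e))))

  RefsBelow : ℕ → Code → Set
  RefsBelow n (code-add i j) = i < n × j < n
  RefsBelow n (code-mul i j) = i < n × j < n
  RefsBelow n _ = n ≡ n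

  code-refs : ∀ {k} (g : Gate k) → RefsBelow k (code g)
  code-refs (input i) = ≡.refl
  code-refs (cnst a) = ≡.refl
  code-refs (add i j) = Finₚ.toℕ<n i , Finₚ.toℕ<n j
  code-refs (mul i j) = Finₚ.toℕ<n i , Finₚ.toℕ<n j

  apply-cong : ∀ {n f h} g → RefsBelow n g → (∀ {y} → y < n → f y ≡ h y) → apply f g ≡ apply h g
  apply-cong (code-input i) _ e = ≡.refl
  apply-cong (code-const a) _ e = ≡.refl
  apply-cong (code-add i j) (p , q) e = ≡.cong₂ _+P_ (e p) (e q)
  apply-cong (code-mul i j) (p , q) e = ≡.cong₂ _*P_ (e p) (e q)

  codeAt-correct : ∀ {k} (C : Circuit k) x → x < k →
    RefsBelow x (codeAt C x) × valueAt C x ≡ apply (valueAt C) (codeAt C x)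
  codeAt-correct {suc k} (C ▷ g) x x<1+k with x ℕ.≟ k
  ... | yes ≡.refl rewrite ≡ᵇ-refl x = code-refs g , apply-cong (code g) (code-refs g) (λ lt → ≡.sym (valueAt-old C g lt))
  ... | no x≢k rewrite ≡ᵇ-≢ x≢k with codeAt-correct C x (ℕₚ.≤∧≢⇒< (ℕₚ.≤-pred x<1+k) x≢k)
  ...   | refs , e = refs , ≡.trans e (apply-cong (codeAt C x) refs
            (λ lt → ≡.sym (valueAt-old C g (ℕₚ.<-trans lt (ℕₚ.≤∧≢⇒< (ℕₚ.≤-pred x<1+k) x≢k)))))

  -- Homogeneous components

  sized : ℕ → ℕ → Word → Bool
  sized p q w = length w ℕ.+ p ≡ᵇ q

  -- The component of degree q − p, thought of as occupying the positions from p to q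
  hom : ℕ → ℕ → Poly → Poly
  hom p q = filterᵇ (λ t → sized p q (proj₂ t))

  ext-hom : ∀ φ p q P → ext φ (hom p q P) 𝔽.≈ ext (λ w → 𝔽S.when (sized p q w) (φ w)) P
  ext-hom φ p q P = 𝔽.trans (𝔽S.∑-filter _ P _) (𝔽S.∑-cong P (λ t → 𝔽.sym (𝔽S.when-*ˡ (sized p q (proj₂ t)) _ _)))

  hom-+ : ∀ p q P Q → hom p q (P +P Q) ≈ hom p q P + hom p q Q
  hom-+ p q P Q = ≡⇒≋ (≡.trans (filterᵇ-++ P) (≡.sym (⊕-def _ _)))
    where
    filterᵇ-++ : ∀ P → filterᵇ (λ t → sized p q (proj₂ t)) (P ++ Q) ≡ hom p q P ++ hom p q Q
    filterᵇ-++ [] = ≡.refl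
    filterᵇ-++ (t ∷ P) with sized p q (proj₂ t)
    ... | true = ≡.cong (t ∷_) (filterᵇ-++ P)
    ... | false = filterᵇ-++ P

  ≡ᵇ-sym : ∀ m n → (m ≡ᵇ n) ≡ (n ≡ᵇ m)
  ≡ᵇ-sym zero zero = ≡.refl
  ≡ᵇ-sym zero (suc n) = ≡.refl
  ≡ᵇ-sym (suc m) zero = ≡.refl
  ≡ᵇ-sym (suc m) (suc n) = ≡ᵇ-sym m n

  hom-var : ∀ p q i → hom p q (varP i) ≈ when (q ≡ᵇ suc p) (varP i)
  hom-var p q i rewrite ≡ᵇ-sym q (suc p) with suc p ≡ᵇ q
  ... | true = refl
  ... | false = refl

  hom-const : ∀ p q a → hom p q (constP a) ≈ when (p ≡ᵇ q) (constP a)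
  hom-const p q a with p ≡ᵇ q
  ... | true = refl
  ... | false = refl

  opaque
    unfolding _⊕_

    ext-⊗ : ∀ φ P Q → ext φ (P * Q) 𝔽.≈ ext (λ u → ext (λ v → φ (u ++ v)) Q) P
    ext-⊗ = ext-*

  -- A product of words u and v placed from p on is cut at exactly one point k = p + length u; q ≤ D
  -- keeps the relevant cuts within `Fin (suc D)`.
  hom-* : ∀ D p q P Q → q ≤ D →
    hom p q (P * Q) ≈ ∑ (allFin (suc D)) (λ k → hom p (toℕ k) P * hom (toℕ k) q Q)
  hom-* D p q P Q q≤D = ≋-ext λ φ → 𝔽.trans (ext-hom φ p q (P * Q)) (𝔽.trans (ext-⊗ _ P Q) (𝔽.trans
    (ext-cong-φ P (λ u → pointwise φ u))
    (𝔽.trans (ext-φ-∑ Ks (λ k u → 𝔽S.when (sized p (toℕ k) u) (inner φ u k)) P)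
    (𝔽.trans (𝔽S.∑-cong Ks (λ k → 𝔽.trans (𝔽.sym (ext-hom _ p (toℕ k) P)) (𝔽.trans
        (ext-cong-φ (hom p (toℕ k) P) (λ u → 𝔽.sym (ext-hom _ (toℕ k) q Q))) (𝔽.sym (ext-⊗ φ (hom p (toℕ k) P) (hom (toℕ k) q Q))))))
      (𝔽.sym (ext-∑ φ Ks _))))))
    where
    Ks = allFin (suc D)
    inner : (Word → 𝔽.Carrier) → Word → Fin (suc D) → 𝔽.Carrier
    inner φ u k = ext (λ v → 𝔽S.when (sized (toℕ k) q v) (φ (u ++ v))) Q
    lengths : ∀ u v → length (u ++ v) ℕ.+ p ≡ length v ℕ.+ (length u ℕ.+ p)
    lengths u v = ≡.trans (≡.cong (ℕ._+ p) (≡.trans (Listₚ.length-++ u) (ℕₚ.+-comm (length u) (length v)))) (ℕₚ.+-assoc (length v) (length u) p)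
    pointwise : ∀ φ u → ext (λ v → 𝔽S.when (sized p q (u ++ v)) (φ (u ++ v))) Q 𝔽.≈
      𝔽S.∑ Ks (λ k → 𝔽S.when (sized p (toℕ k) u) (inner φ u k))
    pointwise φ u with ℕₚ.≤-<-connex (length u ℕ.+ p) D
    ... | inj₁ ≤D = 𝔽.sym (𝔽.trans (𝔽S.∑-cong Ks (λ k → 𝔽S.when-≡ (≡ᵇ-sym (length u ℕ.+ p) (toℕ k)) 𝔽.refl))
            (𝔽.trans (𝔽S.∑-toℕ (suc D) (length u ℕ.+ p) (s≤s ≤D) (inner φ u))
              (ext-cong-φ Q (λ v → 𝔽S.when-≡ (≡.cong (_≡ᵇ q) (≡.trans (≡.cong (length v ℕ.+_) (Finₚ.toℕ-fromℕ< (s≤s ≤D))) (≡.sym (lengths u v)))) 𝔽.refl))))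
    ... | inj₂ D< = 𝔽.trans
            (ext-φ-0 Q (λ v → 𝔽S.when-false (≡ᵇ-≢ (λ e → ℕₚ.<-irrefl (≡.sym e) (ℕₚ.<-≤-trans (ℕₚ.≤-<-trans q≤D D<)
              (ℕₚ.≤-trans (ℕₚ.m≤n+m _ (length v)) (ℕₚ.≤-reflexive (≡.sym (lengths u v)))))))))
            (𝔽.sym (𝔽S.∑-0 Ks (λ k → 𝔽S.when-false (≡ᵇ-≢ (λ e → ℕₚ.<-irrefl (≡.sym e) (ℕₚ.≤-<-trans (ℕₚ.≤-pred (Finₚ.toℕ<n k)) D<))))))

  hom-> : ∀ p q P → q < p → hom p q P ≈ 0#
  hom-> p q P q<p = ≋-ext λ φ → 𝔽.trans (ext-hom φ p q P)
    (ext-φ-0 P (λ w → 𝔽S.when-false (≡ᵇ-≢ (λ e → ℕₚ.<-irrefl (≡.sym e) (ℕₚ.<-≤-trans q<p (ℕₚ.m≤n+m p (length w)))))))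

  coeff-hom : ∀ p q P w → coeff (hom p q P) w 𝔽.≈ 𝔽S.when (sized p q w) (coeff P w)
  coeff-hom p q P w = 𝔽.trans (coeff-ext (hom p q P) w) (𝔽.trans (ext-hom (δ w) p q P) (𝔽.trans
    (ext-cong-φ P same) (𝔽.trans (ext-φ-when (sized p q w) (δ w) P) (𝔽S.when-cong (sized p q w) (λ _ → 𝔽.sym (coeff-ext P w))))))
    where
    same : ∀ u → 𝔽S.when (sized p q u) (δ w u) 𝔽.≈ 𝔽S.when (sized p q w) (δ w u)
    same u with u ≟ʷ w
    ... | yes ≡.refl = 𝔽.refl
    ... | no _ = 𝔽.trans (𝔽S.when-0 (sized p q u) 𝔽.refl) (𝔽.sym (𝔽S.when-0 (sized p q w) 𝔽.refl))

  -- Words are aligned to the right end D, so the starting positions p < D enumerate the positive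
  -- degrees and p = D gives the constant term.
  hom-sum : ∀ D P → DegreeAtMost D P → P ≈ ∑ (allFin D) (λ p → hom (toℕ p) D P) + hom D D P
  hom-sum D P deg = mk≋ λ w → 𝔽.sym (𝔽.trans
      (𝔽.trans (𝔽.reflexive (≡.cong (λ Q → coeff Q w) (⊕-def parts (hom D D P)))) (coeff-+ parts (hom D D P) w))
    (𝔽.trans (𝔽.+-cong (𝔽.trans (coeff-∑ (allFin D) (λ p → hom (toℕ p) D P) w) (𝔽S.∑-cong (allFin D) (λ p → coeff-hom (toℕ p) D P w))) (coeff-hom D D P w)) (cases w)))
    where
    parts : Poly
    parts = ∑ (allFin D) (λ p → hom (toℕ p) D P)
    cases : ∀ w → 𝔽S.∑ (allFin D) (λ p → 𝔽S.when (sized (toℕ p) D w) (coeff P w)) 𝔽.+ 𝔽S.when (sized D D w) (coeff P w) 𝔽.≈ coeff P w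
    cases [] = 𝔽.trans (𝔽S.+-zeroˡ (𝔽S.∑-0 (allFin D) (λ p → 𝔽S.when-false (≡ᵇ-≢ (ℕₚ.<⇒≢ (Finₚ.toℕ<n p))))))
      (𝔽S.when-true (≡ᵇ-refl D))
    cases w@(_ ∷ w') = 𝔽.trans
      (𝔽S.+-zeroʳ (𝔽S.when-false (≡ᵇ-≢ (λ e → ℕₚ.<-irrefl (≡.sym e) (s≤s (ℕₚ.m≤n+m D (length w')))))))
      (go (ℕₚ.≤-<-connex (length w) D))
      where
      go : length w ≤ D ⊎ D < length w → 𝔽S.∑ (allFin D) (λ p → 𝔽S.when (sized (toℕ p) D w) (coeff P w)) 𝔽.≈ coeff P w
      go (inj₂ lt) = 𝔽.trans (𝔽S.∑-0 (allFin D) (λ p → 𝔽S.when-0 (sized (toℕ p) D w) (deg w lt))) (𝔽.sym (deg w lt))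
      go (inj₁ le) = 𝔽.trans (𝔽S.∑-cong (allFin D) (λ p → 𝔽S.when-≡ (flip (toℕ p)) 𝔽.refl))
        (𝔽S.∑-toℕ D (D ℕ.∸ length w) (ℕₚ.∸-monoʳ-< {D} {length w} {0} (s≤s z≤n) le) (λ _ → coeff P w))
        where
        flip : ∀ p → (length w ℕ.+ p ≡ᵇ D) ≡ (p ≡ᵇ D ℕ.∸ length w)
        flip p = bool-≡
          (λ e → ≡.trans (≡.cong (p ≡ᵇ_) (≡.trans (≡.cong (ℕ._∸ length w) (≡.sym (≡ᵇ⇒≡ {length w ℕ.+ p} {D} e))) (ℕₚ.m+n∸m≡n (length w) p))) (≡ᵇ-refl p))
          (λ e → ≡.trans (≡.cong (_≡ᵇ D) (≡.trans (≡.cong (length w ℕ.+_) (≡ᵇ⇒≡ {p} e)) (ℕₚ.m+[n∸m]≡n le))) (≡ᵇ-refl D))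

-- The weighted grammar of a circuit

module CircuitGrammar {c ℓ : Level} (F : CommutativeRing c ℓ) (d m : ℕ) {r : ℕ} (C : NC.Circuit F r) where
  open Nodes d m r
  open NC F
  open PolyAlg F
  open Circuits F
  private module 𝔽 = CommutativeRing F
  private module 𝔽S = Sums 𝔽.semiring
  open Semiring polySemiring hiding (zero)
  open Sums polySemiring
  open import Relation.Binary.Reasoning.Setoid setoid

  -- The default 0 at gates of another kind is harmless, because `basis` and the rules of the
  -- grammar read the same references.
  leftRef rightRef inputRef : Code → ℕ
  leftRef (code-mul i j) = i
  leftRef _ = 0
  rightRef (code-mul i j) = j
  rightRef _ = 0
  inputRef (code-input i) = i
  inputRef _ = 0

  left right : Fin r → ℕ
  left u = leftRef (codeAt C (toℕ u))
  right u = rightRef (codeAt C (toℕ u))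

  -- The variables below m stand for the bits; inputs that read them are never used through inj₂.
  letterVar : Letter → ℕ
  letterVar (inj₁ b) = toℕ b
  letterVar (inj₂ u) = m ℕ.+ (inputRef (codeAt C (toℕ u)) ℕ.∸ m)

  Index : Set
  Index = Letter ⊎ Fin r

  _≟I_ : DecidableEquality Index
  _≟I_ = ⊎-≡-dec _≟L_ Finₚ._≟_

  indices : List Index
  indices = map inj₁ letters ++ map inj₂ (allFin r)

  indices-! : Unique indices
  indices-! = Uniqueₚ.++⁺ (Uniqueₚ.map⁺ inj₁-injective letters-!) (Uniqueₚ.map⁺ inj₂-injective (Uniqueₚ.allFin⁺ r))
    λ (p , q) → disjoint p q
    where
    disjoint : ∀ {x} → x ∈ map inj₁ letters → ¬ x ∈ map inj₂ (allFin r)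
    disjoint p q with ∈-map⁻ inj₁ p | ∈-map⁻ inj₂ q
    ... | _ , _ , ≡.refl | _ , _ , ()

  ∈-indices : ∀ i → i ∈ indices
  ∈-indices (inj₁ τ) = ∈-++⁺ˡ (∈-map⁺ inj₁ (∈-letters τ))
  ∈-indices (inj₂ u) = ∈-++⁺ʳ (map inj₁ letters) (∈-map⁺ inj₂ (∈-allFin u))

  within : ℕ → ℕ → Fin (suc D) → Bool
  within p q k = (p <ᵇ toℕ k) ∧ (toℕ k <ᵇ q)

  -- Only inner splits p < k < q are taken, so that both factors have positive degree, as a binary
  -- rule of a Chomsky normal form requires.
  products : Poly → Poly → ℕ → ℕ → Poly
  products P Q p q = ∑ (allFin (suc D)) (λ k → when (within p q k) (hom p (toℕ k) P * hom (toℕ k) q Q))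

  basis : Index → ℕ → ℕ → Poly
  basis (inj₁ τ) p q = when (q ≡ᵇ suc p) (varP (letterVar τ))
  basis (inj₂ u) p q = products (valueAt C (left u)) (valueAt C (right u)) p q

  lin : (Index → 𝔽.Carrier) → ℕ → ℕ → Poly
  lin co p q = ∑ indices (λ i → constP (co i) * basis i p q)

  lin-+ : ∀ co co' p q → lin co p q + lin co' p q ≈ lin (λ i → co i 𝔽.+ co' i) p q
  lin-+ co co' p q = trans (sym (∑-+ indices _ _)) (∑-cong indices (λ i →
    trans (sym (distribʳ (basis i p q) (constP (co i)) (constP (co' i)))) (*-congʳ (sym (constP-+ (co i) (co' i))))))

  lin-* : ∀ a co p q → constP a * lin co p q ≈ lin (λ i → a 𝔽.* co i) p q
  lin-* a co p q = trans (∑-*ˡ (constP a) indices _) (∑-cong indices (λ i →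
    trans (sym (*-assoc (constP a) (constP (co i)) (basis i p q))) (*-congʳ (sym (constP-* a (co i))))))

  lin-0 : ∀ p q → lin (λ _ → 𝔽.0#) p q ≈ 0#
  lin-0 p q = ∑-0 indices (λ i → *-zeroˡ constP-0)

  δI : Index → Index → 𝔽.Carrier
  δI j i = 𝔽S.when (does (i ≟I j)) 𝔽.1#

  lin-δ : ∀ j p q → lin (δI j) p q ≈ basis j p q
  lin-δ j p q = trans
    (∑-single _ indices-! (∈-indices j) (λ {i} i≢ → *-zeroˡ (trans (constP-cong (𝔽S.when-false (dec-false (i ≟I j) i≢))) constP-0)))
    (trans (*-congʳ (constP-cong (𝔽S.when-true (dec-true (j ≟I j) ≡.refl)))) (*-identityˡ _))

  -- The components of P in terms of the grammar: those of degree 0 are a constant, the others are linear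
  -- combinations of the letters and the products taken at the multiplication gates.
  record Rep (P : Poly) : Set (c Level.⊔ ℓ) where
    field
      constant : 𝔽.Carrier
      weight : Index → 𝔽.Carrier
      hom-constant : ∀ p → p ≤ D → hom p p P ≈ constP constant
      hom-weight : ∀ p q → p < q → q ≤ D → hom p q P ≈ lin weight p q

  rep-≡ : ∀ {P Q} → P ≡ Q → Rep P → Rep Q
  rep-≡ ≡.refl RP = RP

  rep-const : ∀ a → Rep (constP a)
  rep-const a = record
    { constant = a
    ; weight = λ _ → 𝔽.0#
    ; hom-constant = λ p _ → trans (hom-const p p a) (when-true (≡ᵇ-refl p))
    ; hom-weight = λ p q p<q _ → trans (trans (hom-const p q a) (when-false (≡ᵇ-≢ (ℕₚ.<⇒≢ p<q)))) (sym (lin-0 p q)) }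

  rep-0 : Rep 0P
  rep-0 = record
    { constant = 𝔽.0#
    ; weight = λ _ → 𝔽.0#
    ; hom-constant = λ p _ → sym constP-0
    ; hom-weight = λ p q p<q _ → sym (lin-0 p q) }

  rep-letter : ∀ τ → Rep (varP (letterVar τ))
  rep-letter τ = record
    { constant = 𝔽.0#
    ; weight = δI (inj₁ τ)
    ; hom-constant = λ p _ → trans (hom-var p p _) (trans (when-false (≡ᵇ-≢ (ℕₚ.<⇒≢ (ℕₚ.n<1+n p)))) (sym constP-0))
    ; hom-weight = λ p q p<q _ → trans (hom-var p q _) (sym (lin-δ (inj₁ τ) p q)) }

  rep-+ : ∀ {P Q} → Rep P → Rep Q → Rep (P +P Q)
  rep-+ {P} {Q} RP RQ = record
    { constant = P'.constant 𝔽.+ Q'.constant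
    ; weight = λ i → P'.weight i 𝔽.+ Q'.weight i
    ; hom-constant = λ p le → trans (hom-+ p p P Q) (trans (+-cong (P'.hom-constant p le) (Q'.hom-constant p le)) (sym (constP-+ _ _)))
    ; hom-weight = λ p q lt le → trans (hom-+ p q P Q) (trans (+-cong (P'.hom-weight p q lt le) (Q'.hom-weight p q lt le)) (lin-+ _ _ p q)) }
    where
    module P' = Rep RP
    module Q' = Rep RQ

  -- The two extreme splittings of a product contribute the constant terms of the factors.
  hom-product : ∀ {P Q} → (RP : Rep P) (RQ : Rep Q) → ∀ p q → p < q → q ≤ D →
    hom p q (P * Q) ≈ constP (Rep.constant RP) * hom p q Q + (hom p q P * constP (Rep.constant RQ) + products P Q p q)
  hom-product {P} {Q} RP RQ p q p<q q≤D = begin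
    hom p q (P * Q) ≈⟨ hom-* D p q P Q q≤D ⟩
    ∑ Ks (λ k → hom p (toℕ k) P * hom (toℕ k) q Q) ≈⟨ ∑-cong Ks split ⟩
    ∑ Ks (λ k → when (toℕ k ≡ᵇ p) (lo k) + (when (toℕ k ≡ᵇ q) (hi k) + when (within p q k) (hom p (toℕ k) P * hom (toℕ k) q Q)))
      ≈⟨ trans (∑-+ Ks _ _) (+-congˡ (∑-+ Ks _ _)) ⟩
    ∑ Ks (λ k → when (toℕ k ≡ᵇ p) (lo k)) + (∑ Ks (λ k → when (toℕ k ≡ᵇ q) (hi k)) + products P Q p q)
      ≈⟨ +-cong (∑-toℕ (suc D) p (s≤s (ℕₚ.≤-trans (ℕₚ.<⇒≤ p<q) q≤D)) lo) (+-congʳ (∑-toℕ (suc D) q (s≤s q≤D) hi)) ⟩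
    constP cP * hom p q Q + (hom p q P * constP cQ + products P Q p q) ∎
    where
    Ks = allFin (suc D)
    module P' = Rep RP
    module Q' = Rep RQ
    cP = P'.constant
    cQ = Q'.constant
    lo hi : Fin (suc D) → Poly
    lo k = constP cP * hom p q Q
    hi k = hom p q P * constP cQ
    not-within : ∀ k → ¬ (p < toℕ k × toℕ k < q) → within p q k ≡ false
    not-within k h = ≢true λ e → h
      ( ℕₚ.<ᵇ⇒< p (toℕ k) (≡.subst T (≡.sym (proj₁ (∧-true {p <ᵇ toℕ k} e))) _)
      , ℕₚ.<ᵇ⇒< (toℕ k) q (≡.subst T (≡.sym (proj₂ (∧-true {p <ᵇ toℕ k} e))) _))
    split : ∀ k → hom p (toℕ k) P * hom (toℕ k) q Q ≈
      when (toℕ k ≡ᵇ p) (lo k) + (when (toℕ k ≡ᵇ q) (hi k) + when (within p q k) (hom p (toℕ k) P * hom (toℕ k) q Q))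
    split k with ℕₚ.<-cmp (toℕ k) p | ℕₚ.<-cmp (toℕ k) q
    ... | tri< k<p k≢p _ | tri≈ _ k≡q _ = ⊥-elim (ℕₚ.<-asym p<q (≡.subst (_< p) k≡q k<p))
    ... | tri< k<p k≢p _ | tri> _ _ q<k = ⊥-elim (ℕₚ.<-asym p<q (ℕₚ.<-trans q<k k<p))
    ... | tri< k<p k≢p _ | tri< k<q k≢q _ = trans (*-zeroˡ (hom-> p (toℕ k) P k<p)) (sym (trans
            (+-zeroˡ (when-false (≡ᵇ-≢ k≢p))) (trans (+-zeroˡ (when-false (≡ᵇ-≢ k≢q)))
            (when-false (not-within k (λ (a , _) → ℕₚ.<-asym a k<p))))))
    ... | tri≈ _ k≡p _ | tri≈ _ k≡q _ = ⊥-elim (ℕₚ.<⇒≢ p<q (≡.trans (≡.sym k≡p) k≡q))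
    ... | tri≈ _ k≡p _ | tri> _ _ q<k = ⊥-elim (ℕₚ.<-asym p<q (≡.subst (q <_) k≡p q<k))
    ... | tri≈ _ k≡p _ | tri< k<q k≢q _ = trans
            (*-cong (trans (reflexive (≡.cong (λ k → hom p k P) k≡p)) (P'.hom-constant p (ℕₚ.≤-trans (ℕₚ.<⇒≤ p<q) q≤D)))
                    (reflexive (≡.cong (λ k → hom k q Q) k≡p)))
            (sym (trans (+-zeroʳ (trans (+-zeroˡ (when-false (≡ᵇ-≢ k≢q))) (when-false (not-within k (λ (a , _) → ℕₚ.<⇒≢ a (≡.sym k≡p))))))
              (when-true (≡.trans (≡.cong (_≡ᵇ p) k≡p) (≡ᵇ-refl p)))))
    ... | tri> _ k≢p p<k | tri≈ _ k≡q _ = trans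
            (*-cong (reflexive (≡.cong (λ k → hom p k P) k≡q)) (trans (reflexive (≡.cong (λ k → hom k q Q) k≡q)) (Q'.hom-constant q q≤D)))
            (sym (trans (+-zeroˡ (when-false (≡ᵇ-≢ k≢p))) (trans (+-zeroʳ (when-false (not-within k (λ (_ , b) → ℕₚ.<⇒≢ b k≡q))))
              (when-true (≡.trans (≡.cong (_≡ᵇ q) k≡q) (≡ᵇ-refl q))))))
    ... | tri> _ k≢p p<k | tri> _ k≢q q<k = trans (*-zeroʳ (hom-> (toℕ k) q Q q<k)) (sym (trans
            (+-zeroˡ (when-false (≡ᵇ-≢ k≢p))) (trans (+-zeroˡ (when-false (≡ᵇ-≢ k≢q)))
            (when-false (not-within k (λ (_ , b) → ℕₚ.<-asym b q<k))))))
    ... | tri> _ k≢p p<k | tri< k<q k≢q _ = sym (trans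
            (+-zeroˡ (when-false (≡ᵇ-≢ k≢p))) (trans (+-zeroˡ (when-false (≡ᵇ-≢ k≢q)))
            (when-true (≡.cong₂ _∧_ (<⇒<ᵇ≡true p<k) (<⇒<ᵇ≡true k<q)))))

  hom-product-constant : ∀ {P Q} → (RP : Rep P) (RQ : Rep Q) → ∀ p → p ≤ D →
    hom p p (P * Q) ≈ constP (Rep.constant RP 𝔽.* Rep.constant RQ)
  hom-product-constant {P} {Q} RP RQ p p≤D = trans (hom-* D p p P Q p≤D) (trans
    (∑-cong (allFin (suc D)) single) (trans (∑-toℕ (suc D) p (s≤s p≤D) (λ _ → constP cP * constP cQ)) (sym (constP-* cP cQ))))
    where
    cP = Rep.constant RP
    cQ = Rep.constant RQ
    single : ∀ k → hom p (toℕ k) P * hom (toℕ k) p Q ≈ when (toℕ k ≡ᵇ p) (constP cP * constP cQ)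
    single k with ℕₚ.<-cmp (toℕ k) p
    ... | tri< k<p k≢p _ = trans (*-zeroˡ (hom-> p (toℕ k) P k<p)) (sym (when-false (≡ᵇ-≢ k≢p)))
    ... | tri> _ k≢p p<k = trans (*-zeroʳ (hom-> (toℕ k) p Q p<k)) (sym (when-false (≡ᵇ-≢ k≢p)))
    ... | tri≈ _ k≡p _ = trans
            (*-cong (trans (reflexive (≡.cong (λ k → hom p k P) k≡p)) (Rep.hom-constant RP p p≤D))
                    (trans (reflexive (≡.cong (λ k → hom k p Q) k≡p)) (Rep.hom-constant RQ p p≤D)))
            (sym (when-true (≡.trans (≡.cong (_≡ᵇ p) k≡p) (≡ᵇ-refl p))))

  -- The extreme splittings are scalar multiples of components of the factors; they are absorbed
  -- into the weights, which eliminates unit rules and empty words. The new generator `inj₂ u`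
  -- accounts for the inner splittings.
  rep-* : ∀ u → Rep (valueAt C (left u)) → Rep (valueAt C (right u)) → Rep (valueAt C (left u) *P valueAt C (right u))
  rep-* u RP RQ = rep-≡ (⊗-def P Q) (record
    { constant = cP 𝔽.* cQ
    ; weight = λ i → cP 𝔽.* Q'.weight i 𝔽.+ (cQ 𝔽.* P'.weight i 𝔽.+ δI (inj₂ u) i)
    ; hom-constant = hom-product-constant RP RQ
    ; hom-weight = λ p q lt le → trans (hom-product RP RQ p q lt le) (trans
        (+-cong (trans (*-congˡ (Q'.hom-weight p q lt le)) (lin-* cP Q'.weight p q))
          (trans (+-cong (trans (sym (constP-central cQ (hom p q P))) (trans (*-congˡ (P'.hom-weight p q lt le)) (lin-* cQ P'.weight p q)))
                   (sym (lin-δ (inj₂ u) p q)))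
            (lin-+ _ _ p q)))
        (lin-+ _ _ p q)) })
    where
    P = valueAt C (left u)
    Q = valueAt C (right u)
    module P' = Rep RP
    module Q' = Rep RQ
    cP = P'.constant
    cQ = Q'.constant

  rep-input : ∀ u i → codeAt C (toℕ u) ≡ code-input i → Rep (varP i)
  rep-input u i e with i ℕ.<? m
  ... | yes i<m = rep-≡ (≡.cong varP (Finₚ.toℕ-fromℕ< i<m)) (rep-letter (inj₁ (Fin.fromℕ< i<m)))
  ... | no i≮m = rep-≡ (≡.cong varP (≡.trans (≡.cong (λ g → m ℕ.+ (inputRef g ℕ.∸ m)) e) (ℕₚ.m+[n∸m]≡n (ℕₚ.≮⇒≥ i≮m))))
                   (rep-letter (inj₂ u))

  valueAt-≥ : ∀ {k} (C : Circuit k) x → k ≤ x → valueAt C x ≡ 0P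
  valueAt-≥ [] x le = ≡.refl
  valueAt-≥ (_▷_ {k} C g) x lt rewrite ≡ᵇ-≢ (ℕₚ.<⇒≢ lt ∘ ≡.sym) = valueAt-≥ C x (ℕₚ.<⇒≤ lt)

  -- Recursion along the references of the gates, made structural by the bound `n`.
  rep-bounded : ∀ n x → x < n → Rep (valueAt C x)
  rep-bounded (suc n) x (s≤s x≤n) with x ℕ.<? r
  ... | no x≮r = rep-≡ (≡.sym (valueAt-≥ C x (ℕₚ.≮⇒≥ x≮r))) rep-0
  ... | yes x<r with codeAt C x in eq | codeAt-correct C x x<r
  ...   | code-input i | _ , e = rep-≡ (≡.sym e) (rep-input (Fin.fromℕ< x<r) i (≡.trans (≡.cong (codeAt C) (Finₚ.toℕ-fromℕ< x<r)) eq))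
  ...   | code-const a | _ , e = rep-≡ (≡.sym e) (rep-const a)
  ...   | code-add i j | (i< , j<) , e = rep-≡ (≡.sym e) (rep-+ (rep-bounded n i (ℕₚ.<-≤-trans i< x≤n)) (rep-bounded n j (ℕₚ.<-≤-trans j< x≤n)))
  ...   | code-mul i j | (i< , j<) , e = rep-≡ (≡.trans (≡.cong₂ _*P_ (≡.cong (valueAt C) l≡) (≡.cong (valueAt C) r≡)) (≡.sym e))
          (rep-* u (rep-≡ (≡.cong (valueAt C) (≡.sym l≡)) (rep-bounded n i (ℕₚ.<-≤-trans i< x≤n)))
                   (rep-≡ (≡.cong (valueAt C) (≡.sym r≡)) (rep-bounded n j (ℕₚ.<-≤-trans j< x≤n))))
          where
          u : Fin r
          u = Fin.fromℕ< x<r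
          code≡ : codeAt C (toℕ u) ≡ code-mul i j
          code≡ = ≡.trans (≡.cong (codeAt C) (Finₚ.toℕ-fromℕ< x<r)) eq
          l≡ : left u ≡ i
          l≡ = ≡.cong leftRef code≡
          r≡ : right u ≡ j
          r≡ = ≡.cong rightRef code≡

  rep : ∀ x → Rep (valueAt C x)
  rep x = rep-bounded (suc x) x (ℕₚ.n<1+n x)

-- Substituting bits

module Cube {c ℓ : Level} (F : CommutativeRing c ℓ) where
  open NC F
  open PolyAlg F
  open Semiring polySemiring hiding (zero)
  open Sums polySemiring

  subst-⊕ : ∀ σ P Q → subst σ (P + Q) ≈ subst σ P + subst σ Q
  subst-⊕ σ P Q = ≡⇒≋ (≡.trans (≡.cong (subst σ) (⊕-def P Q)) (≡.trans (subst-+ σ P Q) (≡.sym (⊕-def _ _))))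

  subst-⊗ : ∀ σ P Q → subst σ (P * Q) ≈ subst σ P * subst σ Q
  subst-⊗ σ P Q = trans (reflexive (≡.cong (subst σ) (⊗-def P Q))) (subst-* σ P Q)

  allBits-length : ∀ m {es} → es ∈ allBits m → length es ≡ m
  allBits-length zero (here ≡.refl) = ≡.refl
  allBits-length (suc m) p with ∈-++⁻ (map (false ∷_) (allBits m)) p
  ... | inj₁ q with ∈-map⁻ (false ∷_) q
  ...   | _ , q' , ≡.refl = ≡.cong suc (allBits-length m q')
  allBits-length (suc m) p | inj₂ q with ∈-map⁻ (true ∷_) q
  ...   | _ , q' , ≡.refl = ≡.cong suc (allBits-length m q')

  plugBits-bit : ∀ m es i → i < m → plugBits m es i ≡ const (bitAt es i)
  plugBits-bit m es i i<m rewrite <⇒<ᵇ≡true i<m = ≡.refl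

  plugBits-var : ∀ m es i → plugBits m es (m ℕ.+ i) ≡ var i
  plugBits-var m es i rewrite ≢true {m ℕ.+ i <ᵇ m} (λ e → ℕₚ.<-irrefl ≡.refl (ℕₚ.<-≤-trans (ℕₚ.<ᵇ⇒< (m ℕ.+ i) m (≡.subst T (≡.sym e) _)) (ℕₚ.m≤m+n m i))) =
    ≡.cong var (ℕₚ.m+n∸m≡n m i)

  -- Beyond the end of the list the two defaults differ, zero for `bitAt` and `true` for `nth`;
  -- hence the bound on `i`.
  bitAt-nth : ∀ es i → i < length es → constP (bitAt es i) ≈ when (nth es i) 1#
  bitAt-nth (true ∷ es) zero lt = refl
  bitAt-nth (false ∷ es) zero lt = constP-0
  bitAt-nth (b ∷ es) (suc i) (s≤s lt) = bitAt-nth es i lt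

  bitStrings≡ : ∀ k → allBits k ≡ bitStrings k
  bitStrings≡ zero = ≡.refl
  bitStrings≡ (suc k) = ≡.cong (λ bs → map (false ∷_) bs ++ map (true ∷_) bs) (bitStrings≡ k)

-- Hardness

module Hardness {c ℓ : Level} (F : CommutativeRing c ℓ) where
  open NC F
  open PolyAlg F
  open Cube F
  open Circuits F
  open HamSum F using (subst-HC)
  open Projection F
  private module 𝔽 = CommutativeRing F
  open Semiring polySemiring hiding (zero)
  open Sums polySemiring
  open import Relation.Binary.Reasoning.Setoid setoid

  module Instance (d m s : ℕ) (C : Circuit (suc s)) where
    r = suc s
    open Nodes d m r
    open CircuitGrammar F d m C

    wT : ℕ → Letter → Subst
    wT x τ = const (Rep.weight (rep x) (inj₁ τ))

    wB : ℕ → Fin r → Subst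
    wB x u = const (Rep.weight (rep x) (inj₂ u))

    -- The projection emits variables of f, and the variable m + j of the circuit plays the part of
    -- the variable j there.
    letter : Fin r → Subst
    letter u = var (inputRef (codeAt C (toℕ u)) ℕ.∸ m)

    g0 : Subst
    g0 = const (Rep.constant (rep s))

    private
      module Rd = Reduction polySemiring d m r 𝟘S 𝟙S atom constP-0 refl left right wT wB letter s g0
      module Dr = Derive polySemiring d m r 𝟘S 𝟙S atom constP-0 refl left right wT wB letter s g0
      module Gs = Guessing polySemiring d m r 𝟘S 𝟙S atom constP-0 refl left right wT wB letter s g0
      module Vs = Values polySemiring d m r 𝟘S 𝟙S atom constP-0 refl left right wT wB letter s g0

    size : ℕ
    size = suc Rd.size

    σ : ℕ → Subst
    σ = edgeSubst (suc Rd.size) Rd.label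

    HC-value : subst σ (HC size) ≈ ∑ (bitStrings m) Gs.value
    HC-value = trans (subst-HC Rd.size σ) (trans
      (WalkLabels.walk-labels polySemiring Finₚ._≟_ (allFin (suc Rd.size)) lab≈
        (λ u α → when-cong (Alive.none Finₚ._≟_ α (allFin (suc Rd.size))) (λ _ → lab≈ u zero)) Rd.size zero _)
      Rd.reduction)
      where
      lab≈ : ∀ i j → atom (σ (xIdx i j)) ≈ atom (Rd.label i j)
      lab≈ i j = reflexive (≡.cong atom (edgeSubst-xIdx (suc Rd.size) Rd.label i j))

    module _ (es : List Bool) (len : length es ≡ m) where

      τes = plugBits m es
      e = Gs.assignment es

      letter-value : ∀ τ → subst τes (varP (letterVar τ)) ≈ Dr.ℓe e τ
      letter-value (inj₁ b) = trans (subst-var τes (toℕ b)) (trans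
        (reflexive (≡.cong atom (plugBits-bit m es (toℕ b) (Finₚ.toℕ<n b))))
        (bitAt-nth es (toℕ b) (≡.subst (toℕ b <_) (≡.sym len) (Finₚ.toℕ<n b))))
      letter-value (inj₂ u) = trans (subst-var τes _) (reflexive (≡.cong atom (plugBits-var m es _)))

      -- First the component, then the substitution: the bits have to be counted in the degree for
      -- the components to follow the grammar. `h-combination` turns the representation `Rep` of
      -- each gate into the recursion solved by `val`.
      h : ℕ → ℕ → ℕ → Poly
      h p q x = subst τes (hom p q (valueAt C x))

      h-combination : ∀ p q x → p < q → q ≤ D → h p q x ≈ Vs.combination e h p q x
      h-combination p q x p<q q≤D = begin
        subst τes (hom p q (valueAt C x)) ≈⟨ subst-cong τes (Rep.hom-weight (rep x) p q p<q q≤D) ⟩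
        subst τes (lin w p q) ≈⟨ reflexive (subst-∑ τes indices (λ i → constP (w i) * basis i p q)) ⟩
        ∑ indices (λ i → subst τes (constP (w i) * basis i p q))
          ≈⟨ ∑-cong indices (λ i → trans (subst-⊗ τes (constP (w i)) (basis i p q)) (*-congʳ (subst-const τes (w i)))) ⟩
        ∑ indices (λ i → constP (w i) * subst τes (basis i p q))
          ≈⟨ trans (∑-++ (map inj₁ letters) (map inj₂ (allFin r)) term) (+-cong (reflexive (∑-map inj₁ letters term)) (reflexive (∑-map inj₂ (allFin r) term))) ⟩
        ∑ letters (λ τ → constP (w (inj₁ τ)) * subst τes (basis (inj₁ τ) p q)) +
        ∑ (allFin r) (λ u → constP (w (inj₂ u)) * subst τes (basis (inj₂ u) p q))
          ≈⟨ +-cong (∑-cong letters (λ τ → *-congˡ (letter-part τ))) (∑-cong (allFin r) (λ u → *-congˡ (product-part u))) ⟩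
        Vs.combination e h p q x ∎
        where
        w = Rep.weight (rep x)
        term : Index → Poly
        term i = constP (w i) * subst τes (basis i p q)
        letter-part : ∀ τ → subst τes (basis (inj₁ τ) p q) ≈ when (q ≡ᵇ suc p) (Dr.ℓe e τ)
        letter-part τ = trans (reflexive (subst-when τes (q ≡ᵇ suc p) _)) (when-cong (q ≡ᵇ suc p) (λ _ → letter-value τ))
        product-part : ∀ u → subst τes (basis (inj₂ u) p q) ≈
          ∑ Vs.Ps (λ k → when (Vs.inside p q k) (h p (toℕ k) (left u) * h (toℕ k) q (right u)))
        product-part u = trans (reflexive (subst-∑ τes (allFin (suc D)) _)) (trans
          (∑-cong (allFin (suc D)) (λ k → trans (reflexive (subst-when τes (within p q k) _))
            (when-cong (within p q k) (λ _ → subst-⊗ τes _ _))))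
          (reflexive (≡.cong (λ ks → ∑ ks (λ k → when (Vs.inside p q k) (h p (toℕ k) (left u) * h (toℕ k) q (right u)))) (≡.sym Vs.Ps≡))))

      instance-value : ∀ P → P ≈ valueAt C s → DegreeAtMost d P → subst τes P ≈ Gs.value es
      instance-value P P≈ deg = begin
        subst τes P ≈⟨ subst-cong τes P≈ ⟩
        subst τes Q ≈⟨ subst-cong τes (hom-sum D Q deg') ⟩
        subst τes (∑ (allFin D) (λ p → hom (toℕ p) D Q) + hom D D Q) ≈⟨ subst-⊕ τes (∑ (allFin D) (λ p → hom (toℕ p) D Q)) (hom D D Q) ⟩
        subst τes (∑ (allFin D) (λ p → hom (toℕ p) D Q)) + subst τes (hom D D Q)
          ≈⟨ +-cong (trans (reflexive (subst-∑ τes (allFin D) (λ p → hom (toℕ p) D Q)))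
               (∑-cong (allFin D) (λ p → Vs.val-unique e h h-combination D (toℕ p) D s (Finₚ.toℕ<n p) ℕₚ.≤-refl (ℕₚ.m≤m+n D (toℕ p)))))
               (trans (subst-cong τes (Rep.hom-constant (rep s) D ℕₚ.≤-refl)) (subst-const τes _)) ⟩
        ∑ (allFin D) (λ p → Dr.val e D (toℕ p) s D) + atom g0
          ≈⟨ +-congʳ (reflexive (≡.cong (λ ps → ∑ ps (λ p → Dr.val e D (toℕ p) s D)) (≡.sym launches≡))) ⟩
        Gs.value es ∎
        where
        Q = valueAt C s
        deg' : DegreeAtMost D Q
        deg' w lt = 𝔽.trans (𝔽.sym (coeffs P≈ w)) (deg w (ℕₚ.<-trans (ℕₚ.n<1+n d) lt))

    cube-projection : ∀ g → DegreeAtMost d g → Computes C g → sumOverCube m g ≈ subst σ (HC size)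
    cube-projection g deg comp = sym (trans HC-value (trans
      (reflexive (≡.cong (λ bs → ∑ bs Gs.value) (≡.sym (bitStrings≡ m))))
      (trans (sym (∑-cong-∈ (allBits m) (λ {es} es∈ → instance-value es (allBits-length m es∈) g
          (sym (trans (reflexive (≡.sym (last-valueAt C))) (mk≋ comp))) deg)))
        (reflexive (≡.sym (sumP-map (λ es → subst (plugBits m es) g) (allBits m)))))))

    -- The number of groups: rules, leaves, gates and launching positions, in this order.
    G = suc D ℕ.* (suc D ℕ.* (suc D ℕ.* r)) ℕ.+ ((m ℕ.+ r) ℕ.* D ℕ.+ (suc m ℕ.+ D))

    size≡ : size ≡ 1 ℕ.+ (1 ℕ.+ G ℕ.+ (G ℕ.* 2 ℕ.+ (G ℕ.* 2 ℕ.+ G ℕ.* 2)))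
    size≡ = ≡.cong suc (≡.trans (Gadget.Vertices.length-inner (length groups))
      (≡.cong (λ G → suc G ℕ.+ (G ℕ.* 2 ℕ.+ (G ℕ.* 2 ℕ.+ G ℕ.* 2))) length-groups))

  VNP-hard : ∀ f → InVNP f → PProjection f HC
  VNP-hard f (m , g , bm , (nv , deg , size , bnv , bdeg , bsize , hyp) , eq) = t , bt , λ n → Instance.σ (deg n) (m n) (s n) (C n) , λ w →
    𝔽.trans (eq n w) (coeffs (Instance.cube-projection (deg n) (m n) (s n) (C n) (g n) (proj₁ (proj₂ (hyp n))) (computes n)) w)
    where
    s : ℕ → ℕ
    s n = proj₁ (proj₂ (proj₂ (hyp n)))
    s≤ : ∀ n → s n ≤ size n
    s≤ n = proj₁ (proj₂ (proj₂ (proj₂ (hyp n))))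
    C : ∀ n → Circuit (suc (s n))
    C n = proj₁ (proj₂ (proj₂ (proj₂ (proj₂ (hyp n)))))
    computes : ∀ n → Computes (C n) (g n)
    computes n = proj₂ (proj₂ (proj₂ (proj₂ (proj₂ (hyp n)))))
    t : ℕ → ℕ
    t n = Instance.size (deg n) (m n) (s n) (C n)
    G : ℕ → ℕ
    G n = Instance.G (deg n) (m n) (s n) (C n)
    one = bounded-const 1
    bS : Bounded (λ n → suc (suc (deg n)))
    bS = bounded-const 2 ⊞ bdeg
    br : Bounded (λ n → suc (s n))
    br = one ⊞ bounded-≤ s≤ bsize
    bG : Bounded G
    bG = (bS ⊠ (bS ⊠ (bS ⊠ br))) ⊞ (((bm ⊞ br) ⊠ (one ⊞ bdeg)) ⊞ ((one ⊞ bm) ⊞ (one ⊞ bdeg)))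
    b2G : Bounded (λ n → G n ℕ.* 2)
    b2G = bG ⊠ bounded-const 2
    bt : Bounded t
    bt = bounded-≤ (λ n → ℕₚ.≤-reflexive (Instance.size≡ (deg n) (m n) (s n) (C n))) (one ⊞ ((one ⊞ bG) ⊞ (b2G ⊞ (b2G ⊞ b2G))))

-- Inclusion-exclusion over the allowed vertices

module Ryser {c ℓ : Level} (R : Semiring c ℓ) (ν : Semiring.Carrier R)
  (1+ν : Semiring._≈_ R (Semiring._+_ R (Semiring.1# R) ν) (Semiring.0# R)) where
  open Semiring R hiding (zero)
  open Sums R
  open import Relation.Binary.Reasoning.Setoid setoid

  prodF : ∀ {n} → (Fin n → Carrier) → Carrier
  prodF {zero} f = 1#
  prodF {suc n} f = f zero * prodF (f ∘ suc)

  -- The value of 2 e - 1. Since a semiring has no negation, -1 is supplied as an element `ν` with 1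
  -- + ν = 0.
  sign : Bool → Carrier
  sign b = if b then 1# else ν

  signs : ∀ n → List Bool → Carrier
  signs n es = prodF {n} (λ v → sign (nth es (toℕ v)))

  -- The vertices outside `α` are those already visited, and each of them must be allowed by `es`.
  covers : ∀ {n} → (Fin n → Bool) → List Bool → Bool
  covers α es = allF (λ v → α v ∨ nth es (toℕ v))

  noneF : ∀ {n} → (Fin n → Bool) → Bool
  noneF α = allF (λ v → not (α v))

  -- A visited vertex has its bit forced to true and contributes the factor 1; an unvisited one may
  -- have either bit and contributes 1 + ν = 0.
  ∑-signs : ∀ {n} (α : Fin n → Bool) → ∑ (bitStrings n) (λ es → when (covers α es) (signs n es)) ≈ when (noneF α) 1#
  ∑-signs {zero} α = +-identityʳ 1#
  ∑-signs {suc n} α = begin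
    ∑ (bitStrings (suc n)) f ≈⟨ ∑-++ (map (false ∷_) (bitStrings n)) (map (true ∷_) (bitStrings n)) f ⟩
    ∑ (map (false ∷_) (bitStrings n)) f + ∑ (map (true ∷_) (bitStrings n)) f
      ≈⟨ +-cong (reflexive (∑-map (false ∷_) (bitStrings n) f)) (reflexive (∑-map (true ∷_) (bitStrings n) f)) ⟩
    ∑ (bitStrings n) (λ es → f (false ∷ es)) + ∑ (bitStrings n) (λ es → f (true ∷ es)) ≈⟨ cases ⟩
    when (noneF α) 1# ∎
    where
    f : List Bool → Carrier
    f es = when (covers α es) (signs (suc n) es)
    ih = ∑-signs (α ∘ suc)
    T' = ∑ (bitStrings n) (λ es → when (covers (α ∘ suc) es) (signs n es))
    scaled : ∀ y → ∑ (bitStrings n) (λ es → when (covers (α ∘ suc) es) (y * signs n es)) ≈ y * T'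
    scaled y = trans (∑-cong (bitStrings n) (λ es → sym (when-*ˡ (covers (α ∘ suc) es) y _))) (sym (∑-*ˡ y (bitStrings n) _))
    cases : ∑ (bitStrings n) (λ es → f (false ∷ es)) + ∑ (bitStrings n) (λ es → f (true ∷ es)) ≈ when (noneF α) 1#
    cases with α zero
    ... | false = trans (+-cong (∑-0 (bitStrings n) (λ _ → refl)) (trans (scaled 1#) (trans (*-identityˡ _) ih))) (+-identityˡ _)
    ... | true = trans (+-cong (scaled ν) (scaled 1#)) (trans (sym (distribʳ T' ν 1#)) (*-zeroˡ (trans (+-comm ν 1#) 1+ν)))

  module _ {n : ℕ} (L : Fin (suc n) → Fin (suc n) → Carrier) where

    open Alive (Finₚ._≟_ {suc n})
    open Walk R Finₚ._≟_ (allFin (suc n)) L (λ u α → when (none α (allFin (suc n))) (L u zero)) using (walk; walk-zero; walk-step)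

    private
      N = suc n
      vs = allFin N

    signedWalk : List Bool → ℕ → Fin N → Carrier
    signedWalk es zero u = L u zero * signs N es
    signedWalk es (suc k) u = ∑ vs (λ v → when (nth es (toℕ v)) 1# * L u v * signedWalk es k v)

    weighted : ℕ → Fin N → (Fin N → Bool) → Carrier
    weighted k u α = ∑ (bitStrings N) (λ es → when (covers α es) (signedWalk es k u))

    covers-∖ : ∀ α v es → (covers α es ∧ nth es (toℕ v)) ≡ covers (α ∖ v) es
    covers-∖ α v es = bool-≡ to from
      where
      to : covers α es ∧ nth es (toℕ v) ≡ true → covers (α ∖ v) es ≡ true
      to e = allF⁺ _ go
        where
        go : ∀ x → ((α ∖ v) x ∨ nth es (toℕ x)) ≡ true
        go x with x Finₚ.≟ v
        ... | yes ≡.refl = ≡.trans (≡.cong ((α ∖ x) x ∨_) (proj₂ (∧-true {covers α es} e))) (𝔹ₚ.∨-zeroʳ _)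
        ... | no x≢v = ≡.trans (≡.cong (_∨ nth es (toℕ x)) (∖-other α x≢v)) (allF⁻ (λ v → α v ∨ nth es (toℕ v)) (proj₁ (∧-true e)) x)
      from : covers (α ∖ v) es ≡ true → covers α es ∧ nth es (toℕ v) ≡ true
      from e = ≡.cong₂ _∧_ (allF⁺ _ go) (≡.trans (≡.sym (≡.cong (_∨ nth es (toℕ v)) (∖-self α v))) (val v))
        where
        val : ∀ x → ((α ∖ v) x ∨ nth es (toℕ x)) ≡ true
        val = allF⁻ (λ x → (α ∖ v) x ∨ nth es (toℕ x)) e
        go : ∀ x → (α x ∨ nth es (toℕ x)) ≡ true
        go x with α x in αx
        ... | true = ≡.refl
        ... | false = ≡.trans (≡.sym (≡.cong (_∨ nth es (toℕ x)) (∖-false α v αx))) (val x)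

    weighted-step : ∀ k u α → weighted (suc k) u α ≈ ∑ vs (λ v → L u v * weighted k v (α ∖ v))
    weighted-step k u α = begin
      ∑ (bitStrings N) (λ es → when (covers α es) (∑ vs (λ v → when (nth es (toℕ v)) 1# * L u v * signedWalk es k v)))
        ≈⟨ ∑-cong (bitStrings N) (λ es → trans (∑-when (covers α es) vs _) (∑-cong vs (λ v → term es v))) ⟩
      ∑ (bitStrings N) (λ es → ∑ vs (λ v → L u v * when (covers (α ∖ v) es) (signedWalk es k v)))
        ≈⟨ ∑-swap (bitStrings N) vs _ ⟩
      ∑ vs (λ v → ∑ (bitStrings N) (λ es → L u v * when (covers (α ∖ v) es) (signedWalk es k v)))
        ≈⟨ ∑-cong vs (λ v → sym (∑-*ˡ (L u v) (bitStrings N) _)) ⟩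
      ∑ vs (λ v → L u v * weighted k v (α ∖ v)) ∎
      where
      term : ∀ es v → when (covers α es) (when (nth es (toℕ v)) 1# * L u v * signedWalk es k v) ≈
        L u v * when (covers (α ∖ v) es) (signedWalk es k v)
      term es v = trans (when-cong (covers α es) (λ _ → trans (*-congʳ (trans (when-*ʳ (nth es (toℕ v)) _ _) (when-cong (nth es (toℕ v)) (λ _ → *-identityˡ _))))
          (when-*ʳ (nth es (toℕ v)) _ _)))
        (trans (reflexive (≡.sym (when-∧ (covers α es) (nth es (toℕ v)) _)))
        (trans (when-≡ (covers-∖ α v es) refl) (sym (when-*ˡ (covers (α ∖ v) es) _ _))))

    weighted-0 : ∀ u α → weighted 0 u α ≈ L u zero * when (noneF α) 1#
    weighted-0 u α = trans (∑-cong (bitStrings N) (λ es → sym (when-*ˡ (covers α es) _ _)))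
      (trans (sym (∑-*ˡ (L u zero) (bitStrings N) _)) (*-congˡ (∑-signs α)))

    count-pos : ∀ (α : Fin N → Bool) {k} → k < count α vs → noneF α ≡ false
    count-pos α lt = ≢true λ e → ℕₚ.<-irrefl (≡.sym (zero-count vs (λ v → 𝔹ₚ.not-injective (allF⁻ (λ v → not (α v)) e v)))) (ℕₚ.<-≤-trans (s≤s z≤n) lt)
      where
      zero-count : ∀ xs → (∀ v → α v ≡ false) → count α xs ≡ 0
      zero-count [] h = ≡.refl
      zero-count (x ∷ xs) h rewrite h x = zero-count xs h

    dead-∖ : ∀ α v → α v ≡ false → (α ∖ v) ≗ α
    dead-∖ α v e x with x Finₚ.≟ v
    ... | yes ≡.refl = ≡.trans (∖-self α x) (≡.sym e)
    ... | no x≢v = ∖-other α x≢v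

    count-alive : ∀ α v → α v ≡ true → count α vs ≡ suc (count (α ∖ v) vs)
    count-alive α v e = count-∖ {α} (Uniqueₚ.allFin⁺ N) (∈-allFin v) e

    -- With fewer steps left than unvisited vertices, some vertex is never visited, and its two
    -- signs cancel.
    weighted-excess : ∀ k u α → k < count α vs → weighted k u α ≈ 0#
    weighted-excess zero u α lt = trans (weighted-0 u α) (*-zeroʳ (when-false (count-pos α lt)))
    weighted-excess (suc k) u α lt = trans (weighted-step k u α) (∑-0 vs (λ v → *-zeroʳ (weighted-excess k v (α ∖ v) (smaller v))))
      where
      smaller : ∀ v → k < count (α ∖ v) vs
      smaller v with α v in αv
      ... | true = ℕₚ.≤-pred (≡.subst (suc (suc k) ≤_) (count-alive α v αv) lt)
      ... | false = ≡.subst (k <_) (≡.sym (count-cong vs (λ {x} _ → dead-∖ α v αv x))) (ℕₚ.<-trans (ℕₚ.n<1+n k) lt)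

    -- Here the steps are just enough. Repeating a vertex wastes one and leads to `weighted-excess`,
    -- so only the walks without repetition survive.
    weighted-walk : ∀ k u α → count α vs ≡ k → weighted k u α ≈ walk k u α
    weighted-walk zero u α ct = trans (weighted-0 u α) (trans (*-congˡ (when-true (allF⁺ _ (λ v → ≡.cong not (dead v)))))
      (trans (*-identityʳ _) (sym (trans (reflexive (walk-zero u α)) (when-true (count-none {α} vs ct))))))
      where
      dead : ∀ v → α v ≡ false
      dead v = count-dead {α} ct (∈-allFin v)
    weighted-walk (suc k) u α ct = trans (weighted-step k u α) (sym (trans (reflexive (walk-step k u α))
      (trans (+-zeroʳ (when-false (some-alive vs ct))) (∑-cong vs term))))
      where
      some-alive : ∀ xs → count α xs ≡ suc k → none α xs ≡ false
      some-alive (x ∷ xs) e with α x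
      ... | true = ≡.refl
      ... | false = some-alive xs e
      term : ∀ v → when (α v) (L u v * walk k v (α ∖ v)) ≈ L u v * weighted k v (α ∖ v)
      term v with α v in αv
      ... | true = *-congˡ (sym (weighted-walk k v (α ∖ v) (ℕₚ.suc-injective (≡.trans (≡.sym (count-alive α v αv)) ct))))
      ... | false = sym (*-zeroʳ (weighted-excess k v (α ∖ v)
              (≡.subst (k <_) (≡.sym (≡.trans (count-cong vs (λ {x} _ → dead-∖ α v αv x)) ct)) (ℕₚ.n<1+n k))))

-- Membership: circuits for the signed walks

module Membership {c ℓ : Level} (F : CommutativeRing c ℓ) where
  open NC F
  open PolyAlg F
  open Cube F
  open Circuits F
  open HamSum F using (subst-HC)
  private module 𝔽 = CommutativeRing F
  open Semiring polySemiring hiding (zero)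
  open Sums polySemiring
  open import Relation.Binary.Reasoning.Setoid setoid

  -- Straight-line programs built from expressions over polynomials that are already available

  Avail : ∀ {k} → Circuit k → Poly → Set ℓ
  Avail {k} C p = ∃ λ x → x < k × valueAt C x ≈ p

  -- References name polynomials instead of gates, so an expression stays meaningful while the
  -- circuit grows.
  data Exp (Γ : List Poly) : Set c where
    ref : ∀ {p} → p ∈ Γ → Exp Γ
    var : ℕ → Exp Γ
    const : 𝔽.Carrier → Exp Γ
    add mul : Exp Γ → Exp Γ → Exp Γ

  module _ {Γ : List Poly} where

    ⟦_⟧ : Exp Γ → Poly
    ⟦ ref {p} _ ⟧ = p
    ⟦ var i ⟧ = varP i
    ⟦ const a ⟧ = constP a
    ⟦ add a b ⟧ = ⟦ a ⟧ + ⟦ b ⟧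
    ⟦ mul a b ⟧ = ⟦ a ⟧ * ⟦ b ⟧

    cost : Exp Γ → ℕ
    cost (ref _) = 0
    cost (var _) = 1
    cost (const _) = 1
    cost (add a b) = suc (cost b ℕ.+ cost a)
    cost (mul a b) = suc (cost b ℕ.+ cost a)

  record Extension {k} (C : Circuit k) (b : ℕ) (Δ : List Poly) : Set (c Level.⊔ ℓ) where
    field
      {gates} : ℕ
      gates≤ : gates ≤ b ℕ.+ k
      circuit : Circuit gates
      keeps : ∀ {p} → Avail C p → Avail circuit p
      has : All (Avail circuit) Δ
  open Extension

  extend-gate : ∀ {k} (C : Circuit k) g p → apply (valueAt C) (code g) ≈ p → Extension C 1 (p ∷ [])
  extend-gate {k} C g p e = record
    { gates≤ = ℕₚ.≤-refl
    ; circuit = C ▷ g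
    ; keeps = λ (x , x<k , e) → x , ℕₚ.m≤n⇒m≤1+n x<k , trans (reflexive (valueAt-old C g x<k)) e
    ; has = (k , ℕₚ.n<1+n k , trans (reflexive (valueAt-last C g)) e) ∷ [] }

  extend-then : ∀ {k a b Δ Θ} {C : Circuit k} (E : Extension C a Δ) → Extension (circuit E) b Θ → Extension C (b ℕ.+ a) (Θ ++ Δ)
  extend-then {k} {a} {b} E E' = record
    { gates≤ = ℕₚ.≤-trans (gates≤ E') (ℕₚ.≤-trans (ℕₚ.+-monoʳ-≤ b (gates≤ E)) (ℕₚ.≤-reflexive (≡.sym (ℕₚ.+-assoc b a k))))
    ; circuit = circuit E'
    ; keeps = λ p → keeps E' (keeps E p)
    ; has = Allₚ.++⁺ (has E') (All.map (keeps E') (has E)) }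

  extend-weaken : ∀ {k a b Δ Θ} {C : Circuit k} → (E : Extension C a Δ) → a ≤ b →
    (All (Avail (circuit E)) Δ → All (Avail (circuit E)) Θ) → Extension C b Θ
  extend-weaken {k} E a≤b f = record
    { gates≤ = ℕₚ.≤-trans (gates≤ E) (ℕₚ.+-monoˡ-≤ k a≤b) ; circuit = circuit E ; keeps = keeps E ; has = f (has E) }

  private
    binary : ∀ {k n p q s} {C : Circuit k} (E : Extension C n (p ∷ q ∷ [])) (op : ∀ k → Fin k → Fin k → Gate k) →
      (∀ k (C : Circuit k) i j → valueAt C (toℕ i) ≈ q → valueAt C (toℕ j) ≈ p → apply (valueAt C) (code (op k i j)) ≈ s) →
      Extension C (suc n) (s ∷ [])
    binary {n = n} E op sound with has E
    ... | (x , x< , ex) ∷ (y , y< , ey) ∷ [] = extend-weaken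
      (extend-then E (extend-gate (circuit E) (op (gates E) (Fin.fromℕ< y<) (Fin.fromℕ< x<)) _
        (sound (gates E) (circuit E) (Fin.fromℕ< y<) (Fin.fromℕ< x<)
          (trans (reflexive (≡.cong (valueAt (circuit E)) (Finₚ.toℕ-fromℕ< y<))) ey)
          (trans (reflexive (≡.cong (valueAt (circuit E)) (Finₚ.toℕ-fromℕ< x<))) ex))))
      ℕₚ.≤-refl (λ { (z ∷ _) → z ∷ [] })

  compile : ∀ {Γ k} (E : Exp Γ) (C : Circuit k) → All (Avail C) Γ → Extension C (cost E) (⟦ E ⟧ ∷ [])
  compile (ref p∈) C av = record { gates≤ = ℕₚ.≤-refl ; circuit = C ; keeps = λ p → p ; has = All.lookup av p∈ ∷ [] }
  compile (var i) C av = extend-gate C (input i) _ refl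
  compile (const a) C av = extend-gate C (cnst a) _ refl
  compile (add a b) C av = binary (extend-then Ea (compile b (circuit Ea) (All.map (keeps Ea) av))) (λ _ → add)
    (λ _ C i j ei ej → trans (reflexive (≡.sym (⊕-def _ _))) (+-cong ei ej))
    where Ea = compile a C av
  compile (mul a b) C av = binary (extend-then Ea (compile b (circuit Ea) (All.map (keeps Ea) av))) (λ _ → mul)
    (λ _ C i j ei ej → trans (reflexive (≡.sym (⊗-def _ _))) (*-cong ei ej))
    where Ea = compile a C av

  compile-all : ∀ {a} {A : Set a} {Γ k} (xs : List A) (E : A → Exp Γ) (f : A → Poly) n → (∀ x → cost (E x) ≤ n) → (∀ x → ⟦ E x ⟧ ≈ f x) →
    (C : Circuit k) → All (Avail C) Γ → Extension C (length xs ℕ.* n) (map f xs)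
  compile-all [] E f n c≤ e C av = record { gates≤ = ℕₚ.≤-refl ; circuit = C ; keeps = λ p → p ; has = [] }
  compile-all (x ∷ xs) E f n c≤ e C av = extend-weaken (extend-then Es (compile (E x) (circuit Es) (All.map (keeps Es) av)))
    (ℕₚ.+-monoˡ-≤ (length xs ℕ.* n) (c≤ x))
    (λ { ((y , y< , ey) ∷ ps) → (y , y< , trans ey (e x)) ∷ ps })
    where Es = compile-all xs E f n c≤ e C av

  extend-≤ : ∀ {k a b Δ} {C : Circuit k} → a ≤ b → Extension C a Δ → Extension C b Δ
  extend-≤ a≤b E = extend-weaken E a≤b (λ p → p)

  extend-map : ∀ {a} {A : Set a} {k b Δ} {C : Circuit k} → Extension C b Δ → (xs : List A) (E : A → Exp Δ) (f : A → Poly) (n : ℕ) →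
    (∀ x → cost (E x) ≤ n) → (∀ x → ⟦ E x ⟧ ≈ f x) → Extension C (length xs ℕ.* n ℕ.+ b) (map f xs)
  extend-map B xs E f n c≤ e = extend-weaken (extend-then B (compile-all xs E f n c≤ e (circuit B) (has B)))
    ℕₚ.≤-refl (λ p → Allₚ.++⁻ˡ (map f xs) p)

  sumExp : ∀ {a} {A : Set a} {Γ} → List A → (A → Exp Γ) → Exp Γ
  sumExp [] E = const 𝔽.0#
  sumExp (x ∷ xs) E = add (E x) (sumExp xs E)

  ⟦sumExp⟧ : ∀ {a} {A : Set a} {Γ} (xs : List A) (E : A → Exp Γ) → ⟦ sumExp xs E ⟧ ≈ ∑ xs (λ x → ⟦ E x ⟧)
  ⟦sumExp⟧ [] E = constP-0
  ⟦sumExp⟧ (x ∷ xs) E = +-congˡ (⟦sumExp⟧ xs E)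

  cost-sumExp : ∀ {a} {A : Set a} {Γ} (xs : List A) (E : A → Exp Γ) n → (∀ x → cost (E x) ≤ n) →
    cost (sumExp xs E) ≤ suc (length xs ℕ.* suc n)
  cost-sumExp [] E n c≤ = ℕₚ.≤-refl
  cost-sumExp (x ∷ xs) E n c≤ = s≤s (ℕₚ.≤-trans (ℕₚ.+-mono-≤ (cost-sumExp xs E n c≤) (c≤ x))
    (ℕₚ.≤-reflexive (≡.cong suc (ℕₚ.+-comm (length xs ℕ.* suc n) n))))

  -- Polynomials with few variables and small degree

  Good : ℕ → ℕ → Poly → Set c
  Good v a p = All (λ t → All (_< v) (proj₂ t) × length (proj₂ t) ≤ a) p

  coeff-missing : ∀ p w → All (λ t → proj₂ t ≢ w) p → coeff p w 𝔽.≈ 𝔽.0#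
  coeff-missing [] w [] = 𝔽.refl
  coeff-missing ((a , u) ∷ p) w (u≢ ∷ ps) with u ≟ʷ w
  ... | yes e = ⊥-elim (u≢ e)
  ... | no _ = coeff-missing p w ps

  good-vars : ∀ {v a p} → Good v a p → VarsBelow v p
  good-vars {p = p} G w bad = coeff-missing p w (All.map (λ { (vs , _) ≡.refl → bad vs }) G)

  good-degree : ∀ {v a p} → Good v a p → DegreeAtMost a p
  good-degree {p = p} G w lt = coeff-missing p w (All.map (λ { (_ , le) ≡.refl → ℕₚ.<-irrefl ≡.refl (ℕₚ.<-≤-trans lt le) }) G)

  good-≤ : ∀ {v a b p} → a ≤ b → Good v a p → Good v b p
  good-≤ a≤b = All.map (λ (vs , le) → vs , ℕₚ.≤-trans le a≤b)

  good-var : ∀ {v i} → i < v → Good v 1 (varP i)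
  good-var i<v = ((i<v ∷ []) , ℕₚ.≤-refl) ∷ []

  good-const : ∀ {v} a → Good v 0 (constP a)
  good-const a = ([] , z≤n) ∷ []

  opaque
    unfolding _⊕_

    good-+ : ∀ {v a p q} → Good v a p → Good v a q → Good v a (p + q)
    good-+ = Allₚ.++⁺

    good-* : ∀ {v a b p q} → Good v a p → Good v b q → Good v (a ℕ.+ b) (p * q)
    good-* {p = []} [] Gq = []
    good-* {v} {a} {b} {(x , u) ∷ p} {q} ((vs , le) ∷ Gp) Gq = Allₚ.++⁺
      (Allₚ.map⁺ (All.map (λ { {y , w} (ws , le') → Allₚ.++⁺ vs ws ,
        ℕₚ.≤-trans (ℕₚ.≤-reflexive (Listₚ.length-++ u)) (ℕₚ.+-mono-≤ le le') }) Gq))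
      (good-* {p = p} Gp Gq)

  good-∑ : ∀ {a} {A : Set a} {v n} (xs : List A) (f : A → Poly) → (∀ x → Good v n (f x)) → Good v n (∑ xs f)
  good-∑ [] f h = []
  good-∑ (x ∷ xs) f h = good-+ (h x) (good-∑ xs f h)

  substWord-id : ∀ w → substWord Subst.var w ≡ (𝔽.1# , w)
  substWord-id [] = ≡.refl
  substWord-id (i ∷ w) rewrite substWord-id w = ≡.refl

  subst-id : ∀ p → subst Subst.var p ≈ p
  subst-id p = ≋-ext λ φ → 𝔽.trans (ext-subst φ Subst.var p) (ext-cong-φ p (λ w →
    𝔽.trans (𝔽.reflexive (≡.cong (λ t → proj₁ t 𝔽.* φ (proj₂ t)) (substWord-id w))) (𝔽.*-identityˡ _)))

  module Cycles (k : ℕ) where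
    N = suc k
    V = N ℕ.+ N ℕ.* N

    -- The bits take the first N indices and the edges follow, as `plugBits` demands.
    bitVar : Fin N → ℕ
    bitVar v = toℕ v

    edgeVar : Fin N → Fin N → ℕ
    edgeVar u v = N ℕ.+ xIdx u v

    ν : Poly
    ν = constP (𝔽.- 𝔽.1#)

    1+ν : 1# + ν ≈ 0#
    1+ν = trans (sym (constP-+ 𝔽.1# (𝔽.- 𝔽.1#))) (trans (constP-cong (𝔽.-‿inverseʳ 𝔽.1#)) constP-0)

    open Ryser polySemiring ν 1+ν

    signVar : Fin N → Poly
    signVar v = (varP (bitVar v) + varP (bitVar v)) + ν

    signProduct : Poly
    signProduct = prodF signVar

    -- The product of the signs, a scalar once the bits are substituted, is attached at the end of
    -- the walk, where it enters the innermost layer and is computed once.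
    walkPoly : ℕ → Fin N → Poly
    walkPoly zero u = varP (edgeVar u zero) * signProduct
    walkPoly (suc j) u = ∑ (allFin N) (λ v → varP (bitVar v) * varP (edgeVar u v) * walkPoly j v)

    cyclePoly : Poly
    cyclePoly = varP (bitVar zero) * walkPoly k zero

    L : Fin N → Fin N → Poly
    L u v = varP (xIdx u v)

    module _ (es : List Bool) (len : length es ≡ N) where

      σ = plugBits N es

      subst-bit : ∀ v → subst σ (varP (bitVar v)) ≈ when (nth es (toℕ v)) 1#
      subst-bit v = trans (subst-var σ (toℕ v)) (trans (reflexive (≡.cong atom (plugBits-bit N es (toℕ v) (Finₚ.toℕ<n v))))
        (bitAt-nth es (toℕ v) (≡.subst (toℕ v <_) (≡.sym len) (Finₚ.toℕ<n v))))

      subst-edge : ∀ u v → subst σ (varP (edgeVar u v)) ≈ L u v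
      subst-edge u v = trans (subst-var σ (edgeVar u v)) (reflexive (≡.cong atom (plugBits-var N es (xIdx u v))))

      subst-sign : ∀ v → subst σ (signVar v) ≈ sign (nth es (toℕ v))
      subst-sign v = trans (subst-⊕ σ (varP (bitVar v) + varP (bitVar v)) ν) (trans
        (+-cong (trans (subst-⊕ σ (varP (bitVar v)) (varP (bitVar v))) (+-cong (subst-bit v) (subst-bit v))) (subst-const σ _)) (cases (nth es (toℕ v))))
        where
        cases : ∀ b → (when b 1# + when b 1#) + ν ≈ sign b
        cases true = trans (+-assoc 1# 1# ν) (+-zeroʳ 1+ν)
        cases false = trans (+-congʳ (+-identityʳ 0#)) (+-identityˡ ν)

      subst-prodF : ∀ {n} (f h : Fin n → Poly) → (∀ v → subst σ (f v) ≈ h v) → subst σ (prodF f) ≈ prodF h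
      subst-prodF {zero} f h e = subst-const σ _
      subst-prodF {suc n} f h e = trans (subst-⊗ σ (f zero) (prodF (f ∘ suc))) (*-cong (e zero) (subst-prodF (f ∘ suc) (h ∘ suc) (e ∘ suc)))

      subst-walk : ∀ j u → subst σ (walkPoly j u) ≈ signedWalk L es j u
      subst-walk zero u = trans (subst-⊗ σ (varP (edgeVar u zero)) signProduct) (*-cong (subst-edge u zero) (subst-prodF signVar _ subst-sign))
      subst-walk (suc j) u = trans (reflexive (subst-∑ σ (allFin N) (λ v → varP (bitVar v) * varP (edgeVar u v) * walkPoly j v))) (∑-cong (allFin N) (λ v →
        trans (subst-⊗ σ (varP (bitVar v) * varP (edgeVar u v)) (walkPoly j v))
          (*-cong (trans (subst-⊗ σ (varP (bitVar v)) (varP (edgeVar u v))) (*-cong (subst-bit v) (subst-edge u v))) (subst-walk j v))))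

      subst-cycle : subst σ cyclePoly ≈ when (nth es 0) (signedWalk L es k zero)
      subst-cycle = trans (subst-⊗ σ (varP 0) (walkPoly k zero)) (trans (*-cong (subst-bit zero) (subst-walk k zero))
        (trans (when-*ʳ (nth es 0) 1# _) (when-cong (nth es 0) (λ _ → *-identityˡ _))))

    module AF = Alive (Finₚ._≟_ {N})

    -- At the start only the vertex `zero` counts as visited; the leading factor of `cyclePoly` is
    -- the condition on its bit.
    covers-start : ∀ es → covers (AF._∖_ allAlive zero) es ≡ nth es 0
    covers-start es = bool-≡ to from
      where
      α = AF._∖_ allAlive zero
      to : covers α es ≡ true → nth es 0 ≡ true
      to e = ≡.trans (≡.sym (≡.cong (_∨ nth es 0) (AF.∖-self allAlive zero))) (allF⁻ (λ v → α v ∨ nth es (toℕ v)) e zero)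
      from : nth es 0 ≡ true → covers α es ≡ true
      from e = allF⁺ _ go
        where
        go : ∀ v → (α v ∨ nth es (toℕ v)) ≡ true
        go zero = ≡.trans (≡.cong (α zero ∨_) e) (𝔹ₚ.∨-zeroʳ _)
        go (suc v) = ≡.cong (_∨ nth es (suc (toℕ v))) (AF.∖-other allAlive {zero} {suc v} (λ ()))

    count-start : AF.count (AF._∖_ allAlive zero) (allFin N) ≡ k
    count-start = ℕₚ.suc-injective (≡.trans (≡.sym (AF.count-∖ {allAlive} (Uniqueₚ.allFin⁺ N) (∈-allFin zero) ≡.refl))
      (≡.trans (CycleSum.count-allAlive F polySemiring (allFin N)) (length-allFin N)))

    cube-HC : HC N ≈ sumOverCube N cyclePoly
    cube-HC = sym (begin
      sumOverCube N cyclePoly ≈⟨ reflexive (sumP-map (λ es → subst (plugBits N es) cyclePoly) (allBits N)) ⟩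
      ∑ (allBits N) (λ es → subst (plugBits N es) cyclePoly)
        ≈⟨ ∑-cong-∈ (allBits N) (λ {es} es∈ → trans (subst-cycle es (allBits-length N es∈))
             (when-≡ (≡.sym (covers-start es)) refl)) ⟩
      ∑ (allBits N) (λ es → when (covers (AF._∖_ allAlive zero) es) (signedWalk L es k zero))
        ≈⟨ reflexive (≡.cong (λ bs → ∑ bs (λ es → when (covers (AF._∖_ allAlive zero) es) (signedWalk L es k zero))) (bitStrings≡ N)) ⟩
      weighted L k zero (AF._∖_ allAlive zero) ≈⟨ weighted-walk L k zero (AF._∖_ allAlive zero) count-start ⟩
      _ ≈⟨ subst-HC k Subst.var ⟨
      subst Subst.var (HC N) ≈⟨ subst-id (HC N) ⟩
      HC N ∎)

    xIdx< : ∀ (u v : Fin N) → edgeVar u v < V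
    xIdx< u v = ℕₚ.+-monoʳ-< N (≡.subst (_< N ℕ.* N)
      (≡.trans (Finₚ.toℕ-combine u v) (≡.cong (ℕ._+ toℕ v) (ℕₚ.*-comm N (toℕ u)))) (Finₚ.toℕ<n (Fin.combine u v)))

    bit< : ∀ v → bitVar v < V
    bit< v = ℕₚ.<-≤-trans (Finₚ.toℕ<n v) (ℕₚ.m≤m+n N (N ℕ.* N))

    good-prodF : ∀ {n} (f : Fin n → Poly) → (∀ v → Good V 1 (f v)) → Good V n (prodF f)
    good-prodF {zero} f h = good-const _
    good-prodF {suc n} f h = good-* (h zero) (good-prodF (f ∘ suc) (h ∘ suc))

    good-walk : ∀ j u → Good V (j ℕ.* 2 ℕ.+ suc N) (walkPoly j u)
    good-walk zero u = good-* (good-var (xIdx< u zero)) (good-prodF signVar (λ v →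
      good-+ (good-+ (good-var (bit< v)) (good-var (bit< v))) (good-≤ z≤n (good-const _))))
    good-walk (suc j) u = good-∑ (allFin N) (λ v → varP (bitVar v) * varP (edgeVar u v) * walkPoly j v)
      (λ v → good-* (good-* (good-var (bit< v)) (good-var (xIdx< u v))) (good-walk j v))

    -- Each cycle has N edges, N bits of visited vertices and N signs, which gives the degree 3 N.
    good-cycle : Good V (N ℕ.+ N ℕ.+ N) cyclePoly
    good-cycle = good-≤ (ℕₚ.≤-reflexive (solve 1 (λ k → con 1 :+ (k :* con 2 :+ (con 1 :+ (con 1 :+ k))) :=
        ((con 1 :+ k) :+ (con 1 :+ k)) :+ (con 1 :+ k)) ≡.refl k))
      (good-* (good-var (bit< zero)) (good-walk k zero))
      where open Data.Nat.Solver.+-*-Solver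

    signExp : Fin N → Exp []
    signExp v = add (add (var (bitVar v)) (var (bitVar v))) (const (𝔽.- 𝔽.1#))

    prodExp : ∀ {n} → (Fin n → Exp []) → Exp []
    prodExp {zero} E = const 𝔽.1#
    prodExp {suc n} E = mul (E zero) (prodExp (E ∘ suc))

    ⟦prodExp⟧ : ∀ {n} (E : Fin n → Exp []) → ⟦ prodExp E ⟧ ≡ prodF (λ v → ⟦ E v ⟧)
    ⟦prodExp⟧ {zero} E = ≡.refl
    ⟦prodExp⟧ {suc n} E = ≡.cong (⟦ E zero ⟧ *_) (⟦prodExp⟧ (E ∘ suc))

    cost-prodExp : ∀ {n} (E : Fin n → Exp []) c → (∀ v → cost (E v) ≤ c) → cost (prodExp E) ≤ suc (n ℕ.* suc c)
    cost-prodExp {zero} E c h = ℕₚ.≤-refl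
    cost-prodExp {suc n} E c h = s≤s (ℕₚ.≤-trans (ℕₚ.+-mono-≤ (cost-prodExp (E ∘ suc) c (h ∘ suc)) (h zero))
      (ℕₚ.≤-reflexive (≡.cong suc (ℕₚ.+-comm (n ℕ.* suc c) c))))

    -- Dynamic programming: the walks with j intermediate stops are computed for all starting
    -- vertices together, and sharing them keeps the circuit polynomial.
    layer : ℕ → List Poly
    layer j = map (walkPoly j) (allFin N)

    -- Each of the N sums has N summands, which cost 4 gates and one addition each, and starts from
    -- a constant. In `initialCost`, likewise, each sign costs 5 gates and one multiplication, and
    -- each vertex adds 2.
    layerCost : ℕ
    layerCost = N ℕ.* suc (N ℕ.* 5)

    initialCost : ℕ
    initialCost = N ℕ.* 2 ℕ.+ suc (N ℕ.* 6)

    build-signs : Extension [] (suc (N ℕ.* 6)) (⟦ prodExp signExp ⟧ ∷ [])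
    build-signs = extend-≤ (cost-prodExp signExp 5 (λ v → ℕₚ.≤-refl)) (compile (prodExp signExp) [] [])

    firstExp : Fin N → Exp (⟦ prodExp signExp ⟧ ∷ [])
    firstExp u = mul (var (edgeVar u zero)) (ref (here ≡.refl))

    ⟦firstExp⟧ : ∀ u → ⟦ firstExp u ⟧ ≈ walkPoly 0 u
    ⟦firstExp⟧ u = *-congˡ (reflexive (⟦prodExp⟧ signExp))

    term : ∀ j → Fin N → Fin N → Exp (layer j)
    term j u v = mul (mul (var (bitVar v)) (var (edgeVar u v))) (ref (∈-map⁺ (walkPoly j) (∈-allFin v)))

    stepExp : ∀ j → Fin N → Exp (layer j)
    stepExp j u = sumExp (allFin N) (term j u)

    ⟦stepExp⟧ : ∀ j u → ⟦ stepExp j u ⟧ ≈ walkPoly (suc j) u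
    ⟦stepExp⟧ j u = ⟦sumExp⟧ (allFin N) (term j u)

    cost-stepExp : ∀ j u → cost (stepExp j u) ≤ suc (N ℕ.* 5)
    cost-stepExp j u = ℕₚ.≤-trans (cost-sumExp (allFin N) (term j u) 4 (λ v → ℕₚ.≤-refl))
      (ℕₚ.≤-reflexive (≡.cong (λ n → suc (n ℕ.* 5)) (length-allFin N)))

    build-layer : ∀ j → Extension [] (j ℕ.* layerCost ℕ.+ initialCost) (layer j)
    build-layer zero = extend-≤ (ℕₚ.≤-reflexive (≡.cong (λ n → n ℕ.* 2 ℕ.+ suc (N ℕ.* 6)) (length-allFin N)))
      (extend-map build-signs (allFin N) firstExp (walkPoly 0) 2 (λ u → ℕₚ.≤-refl) ⟦firstExp⟧)
    build-layer (suc j) = extend-≤ (ℕₚ.≤-reflexive (≡.trans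
        (≡.cong (λ n → n ℕ.* suc (N ℕ.* 5) ℕ.+ (j ℕ.* layerCost ℕ.+ initialCost)) (length-allFin N))
        (≡.sym (ℕₚ.+-assoc layerCost (j ℕ.* layerCost) initialCost))))
      (extend-map (build-layer j) (allFin N) (stepExp j) (walkPoly (suc j)) (suc (N ℕ.* 5)) (cost-stepExp j) (⟦stepExp⟧ j))

    cycleCost : ℕ
    cycleCost = 2 ℕ.+ (k ℕ.* layerCost ℕ.+ initialCost)

    build-cycle : Extension [] cycleCost (cyclePoly ∷ [])
    build-cycle = extend-weaken
      (extend-then B (compile (mul (var (bitVar zero)) (ref (∈-map⁺ (walkPoly k) (∈-allFin zero)))) (circuit B) (has B)))
      ℕₚ.≤-refl (λ { (p ∷ _) → p ∷ [] })
      where B = build-layer k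

  -- The polynomial may sit at any gate, while `Computes` reads the last one. Adding the constant
  -- zero in two further gates copies it to the end.
  computing : ∀ {b p} → Extension [] b (p ∷ []) → ∃ λ s → s ≤ suc b × Σ (Circuit (suc s)) λ C → Computes C p
  computing {b} {p} E with has E
  ... | (x , x< , ex) ∷ [] = suc (gates E) , s≤s (ℕₚ.≤-trans (gates≤ E) (ℕₚ.≤-reflexive (ℕₚ.+-identityʳ b))) ,
        (C₁ ▷ add i j) , coeffs (trans (reflexive (last-valueAt (C₁ ▷ add i j))) (trans (reflexive (valueAt-last C₁ (add i j)))
          (trans (reflexive (≡.sym (⊕-def _ _))) (trans (+-cong
            (trans (reflexive (≡.trans (≡.cong (valueAt C₁) (Finₚ.toℕ-fromℕ< _)) (valueAt-old (circuit E) (cnst 𝔽.0#) x<))) ex)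
            (trans (reflexive (≡.trans (≡.cong (valueAt C₁) (Finₚ.toℕ-fromℕ< _)) (valueAt-last (circuit E) (cnst 𝔽.0#)))) constP-0))
            (+-identityʳ p)))))
    where
    C₁ = circuit E ▷ cnst 𝔽.0#
    i j : Fin (suc (gates E))
    i = Fin.fromℕ< (ℕₚ.m≤n⇒m≤1+n x<)
    j = Fin.fromℕ< (ℕₚ.n<1+n (gates E))

  cycleFamily : Family
  cycleFamily zero = 0P
  cycleFamily (suc k) = Cycles.cyclePoly k

  -- The number of layers is a separate argument, so that it can be raised from k to n = k + 1 by
  -- monotonicity.
  sizeBound : ℕ → ℕ → ℕ
  sizeBound k n = 3 ℕ.+ (k ℕ.* (n ℕ.* (1 ℕ.+ n ℕ.* 5)) ℕ.+ (n ℕ.* 2 ℕ.+ (1 ℕ.+ n ℕ.* 6)))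

  sizeBound-mono : ∀ {k l} n → k ≤ l → sizeBound k n ≤ sizeBound l n
  sizeBound-mono n k≤l = ℕₚ.+-monoʳ-≤ 3 (ℕₚ.+-monoˡ-≤ (n ℕ.* 2 ℕ.+ (1 ℕ.+ n ℕ.* 6)) (ℕₚ.*-monoˡ-≤ (n ℕ.* (1 ℕ.+ n ℕ.* 5)) k≤l))

  cycle-circuit : ∀ k → ∃ λ s → s ≤ sizeBound k (suc k) × Σ (Circuit (suc s)) λ C → Computes C (Cycles.cyclePoly k)
  cycle-circuit k = computing (Cycles.build-cycle k)

  cycle-vars : ∀ k → VarsBelow (suc k ℕ.+ suc k ℕ.* suc k) (Cycles.cyclePoly k)
  cycle-vars k = good-vars {a = suc k ℕ.+ suc k ℕ.+ suc k} (Cycles.good-cycle k)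

  cycle-degree : ∀ k → DegreeAtMost (suc k ℕ.+ suc k ℕ.+ suc k) (Cycles.cyclePoly k)
  cycle-degree k = good-degree {v = suc k ℕ.+ suc k ℕ.* suc k} (Cycles.good-cycle k)

  cycleFamily-VP : InVP cycleFamily
  cycleFamily-VP = (λ n → n ℕ.+ n ℕ.* n) , (λ n → n ℕ.+ n ℕ.+ n) , size ,
    (bounded-id ⊞ (bounded-id ⊠ bounded-id)) , ((bounded-id ⊞ bounded-id) ⊞ bounded-id) , size-bounded , props
    where
    one = bounded-const 1
    size : ℕ → ℕ
    size n = sizeBound n n
    size-bounded : Bounded size
    size-bounded = bounded-const 3 ⊞ ((bounded-id ⊠ (bounded-id ⊠ (one ⊞ (bounded-id ⊠ bounded-const 5)))) ⊞
      ((bounded-id ⊠ bounded-const 2) ⊞ (one ⊞ (bounded-id ⊠ bounded-const 6))))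
    props : ∀ n → VarsBelow (n ℕ.+ n ℕ.* n) (cycleFamily n) × DegreeAtMost (n ℕ.+ n ℕ.+ n) (cycleFamily n) ×
      Σ ℕ λ s → s ≤ size n × Σ (Circuit (suc s)) λ C → Computes C (cycleFamily n)
    props zero = (λ _ _ → 𝔽.refl) , (λ _ _ → 𝔽.refl) , 0 , z≤n , ([] ▷ cnst 𝔽.0#) , coeffs constP-0
    props (suc k) = cycle-vars k , cycle-degree k , proj₁ built ,
      ℕₚ.≤-trans (proj₁ (proj₂ built)) (sizeBound-mono (suc k) (ℕₚ.n≤1+n k)) , proj₂ (proj₂ built)
      where built = cycle-circuit k

  HC-VNP : InVNP HC
  HC-VNP = (λ n → n) , cycleFamily , bounded-id , cycleFamily-VP ,
    λ { zero w → 𝔽.refl ; (suc k) → coeffs (Cycles.cube-HC k) }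

theorem5p3 : {c ℓ : Level} (F : CommutativeRing c ℓ) → IsField F → CharZero F →
    NC.VNPComplete F (NC.HC F)
theorem5p3 F _ _ = Membership.HC-VNP F , Hardness.VNP-hard F
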